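{- Let $d\geq 2$ and $n\geq 3$, let $P$ be the set of points and $H$ the set of hyperplanes of a $d$-dimensional finite projective space of order $n$, and let $A\in\{\pm1\}^{P\times H}$ be given by $A_{p,h}=1$ if $p\in h$ and $A_{p,h}=-1$ otherwise. Then $A$ is an $N\times N$ matrix with $N=N_{n,d}:=n^d+n^{d-1}+\dots+n+1=\frac{n^{d+1}-1}{n-1}$, its VC dimension is $d$, and its sign rank is larger than $$\frac{n^d-1}{n^{\frac{d-1}{2}}(n-1)}\geq N^{\frac12-\frac{1}{2d}}.$$
   Context: The sign rank of a $\pm1$ matrix $S$ is $\min\{\text{rank}(M): \text{sign}(M)=S\}$ over real matrices $M$ with no zero entries ($\text{sign}$ entrywise, rank over $\mathbb R$). A set $C$ of columns is shattered if every pattern in $\{\pm1\}^C$ appears as a row of the restriction to $C$; the VC dimension is the maximum size of a shattered set.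
   Formalization: The sign rank bound is stated for rational matrices M, given as products of two rational factors with inner dimension r, instead of real matrices; the real case follows by perturbing real factors to rational ones, since the sign condition is open. -}

module Defs where

open import Data.Bool using (Bool; true; false; if_then_else_)
open import Data.Nat as ℕ using (ℕ; zero; suc; _^_; _≤_)
open import Data.Fin using (Fin) renaming (zero to fzero; suc to fsuc)
open import Data.Fin.Subset as Sub using (Subset; ⊤; ∣_∣)
open import Data.Vec as Vec using (tabulate)
open import Data.List as List using (List; length)
open import Data.List.Relation.Unary.Unique.Propositional using (Unique)
import Data.List.Membership.Propositional as LMem
open import Data.Product using (Σ; ∃; ∃-syntax; _×_)
open import Data.Sum using (_⊎_)
open import Data.Sign using (Sign)
open import Data.Rational as ℚ using (ℚ; 0ℚ)
open import Relation.Binary.PropositionalEquality using (_≡_; _≢_)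
open import Function.Bundles using (_⇔_)

record ProjectiveSpace (np nl : ℕ) : Set where
  field
    inc : Fin np → Fin nl → Bool
  _I_ : Fin np → Fin nl → Set
  p I l = inc p l ≡ true
  field
    line-exists : ∀ p q → p ≢ q → ∃[ l ] (p I l × q I l)
    line-unique : ∀ p q l l′ → p ≢ q → p I l → q I l → p I l′ → q I l′ → l ≡ l′
    veblen-young : ∀ a b c d lab lcd lac lbd →
      a ≢ b → c ≢ d → a ≢ c → b ≢ d →
      a I lab → b I lab → c I lcd → d I lcd → a I lac → c I lac → b I lbd → d I lbd →
      ∃[ x ] (x I lab × x I lcd) → ∃[ y ] (y I lac × y I lbd)
    thick : ∀ l → 3 ≤ ∣ tabulate (λ p → inc p l) ∣

module _ {np nl : ℕ} (PS : ProjectiveSpace np nl) where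
  open ProjectiveSpace PS

  pointsOn : Fin nl → Subset np
  pointsOn l = tabulate (λ p → inc p l)

  HasOrder : ℕ → Set
  HasOrder n = ∀ l → ∣ pointsOn l ∣ ≡ suc n

  IsSubspace : Subset np → Set
  IsSubspace S = ∀ p q l x → p ≢ q → p Sub.∈ S → q Sub.∈ S → p I l → q I l → x I l → x Sub.∈ S

  Spans : Subset np → Set
  Spans X = ∀ S → IsSubspace S → X Sub.⊆ S → S ≡ ⊤

  HasDimension : ℕ → Set
  HasDimension d = (∃[ X ] (Spans X × ∣ X ∣ ≡ suc d)) × (∀ X → Spans X → suc d ≤ ∣ X ∣)

  IsHyperplane : Subset np → Set
  IsHyperplane H = IsSubspace H × H ≢ ⊤ ×
    (∀ S → IsSubspace S → H Sub.⊆ S → S ≡ H ⊎ S ≡ ⊤)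

  EnumeratesHyperplanes : List (Subset np) → Set
  EnumeratesHyperplanes hs = Unique hs × (∀ S → (S LMem.∈ hs) ⇔ IsHyperplane S)

  incMatrix : (hs : List (Subset np)) → Fin np → Fin (length hs) → Sign
  incMatrix hs p j = if Vec.lookup (List.lookup hs j) p then Sign.+ else Sign.-

module _ {m k : ℕ} (A : Fin m → Fin k → Sign) where

  Shattered : Subset k → Set
  Shattered C = ∀ (f : Fin k → Sign) → ∃[ p ] (∀ j → j Sub.∈ C → A p j ≡ f j)

  VCdim≡ : ℕ → Set
  VCdim≡ d = (∃[ C ] (Shattered C × ∣ C ∣ ≡ d)) × (∀ C → Shattered C → ∣ C ∣ ≤ d)

sumℚ : ∀ r → (Fin r → ℚ) → ℚ
sumℚ zero f = 0ℚ
sumℚ (suc r) f = f fzero ℚ.+ sumℚ r (λ i → f (fsuc i))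

hasSign : Sign → ℚ → Set
hasSign Sign.+ x = 0ℚ ℚ.< x
hasSign Sign.- x = x ℚ.< 0ℚ

module _ {m k : ℕ} (A : Fin m → Fin k → Sign) where
  -- A is the sign pattern of some matrix M = U Vᵀ of rank ≤ r (no zero entries)
  SignRealizable : ℕ → Set
  SignRealizable r = Σ (Fin m → Fin r → ℚ) λ U → Σ (Fin k → Fin r → ℚ) λ V →
    ∀ p j → hasSign (A p j) (sumℚ r (λ i → U p i ℚ.* V j i))

Nnd : ℕ → ℕ → ℕ
Nnd n zero = 1
Nnd n (suc d) = n ^ suc d ℕ.+ Nnd n d

{-# OPTIONS --safe #-}
module Submission where

-- Geometry.  If S is a subspace and p ∉ S, the union of the lines joining p to S is a subspace with
-- 1 + n∣S∣ points, so the size of a subspace determines its rank; this yields the counts of points,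
-- of hyperplanes, and of the points common to two hyperplanes.  A shattered set of hyperplanes cuts
-- out a strictly decreasing chain of nonempty subspaces, and conversely the hyperplanes spanned by
-- a basis with one point removed are shattered once one of them is dropped.
--
-- Sign rank.  The bound is Forster's argument applied to Q = N·B − Δ·J, B the incidence matrix.
-- Given M i j = u i ∙ v j with the right signs, one wants weights a i making the vectors a i u i
-- isotropic.  Instead of a compactness argument, start from the quadratic form |y|² and repeatedly
-- enlarge one weight.  The leverage scores a i² (u i ∙ C · u i), C the inverse Gram matrix, sum to
-- less than the dimension r, so some score is below r/N and its weight can grow by a fixed amount;
-- this only lowers the other scores.  Hence some weight gets arbitrarily large while every
-- score stays at most r/N, and then the initial |y|² is negligible.  With x i j the rescaled entries,
-- |x i j| ≤ 1 gives Σ Q x ≥ Δ Σ x², and comparing with the spectral norm of Q yields Δ² ≤ r² n^(d−1)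
-- up to an arbitrarily small factor.  Equality is impossible because Δ ≡ 1 mod n.

open import Defs
open import Level using (0ℓ)
open import Algebra.Bundles using (CommutativeRing)
open import Data.Bool using (Bool; true; false; if_then_else_; _∧_)
import Data.Bool.Properties as Bool
open import Data.Empty using () renaming (⊥ to Empty)
open import Data.Fin using (Fin) renaming (zero to fzero; suc to fsuc)
import Data.Fin.Properties as Fin
import Data.Integer as ℤ
import Data.Integer.Properties as ℤ
open import Data.Nat as ℕ using (ℕ; zero; suc)
import Data.Nat.Properties as ℕ
open import Data.Product using (∃; ∃-syntax; _×_; _,_; proj₁; proj₂)
open import Data.Sign using (Sign)
open import Data.Sum using (_⊎_; inj₁; inj₂)
open import Function using (_∘_)
open import Function.Bundles using (mk⇔; Equivalence)
open import Relation.Binary.PropositionalEquality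
open import Relation.Nullary using (¬_; Dec; yes; no; does; contradiction)
open import Relation.Nullary.Decidable using (dec⇒maybe; dec-true; dec-false; decidable-stable; _×-dec_; _⊎-dec_; _→-dec_; ¬?)
open import Relation.Unary using (Decidable)

-- Forster's bound is N times the least absolute entry of a matrix with the given signs, divided by
-- its spectral norm, so the choice of Q decides the constant. For B itself the all-ones direction
-- dominates the norm; subtracting Δ·J makes every column sum vanish, which leaves norm at most N√σ
-- with σ = n^(d-1). The entries are N - Δ on incidences and -Δ elsewhere, of absolute value at
-- least Δ because 2Δ ≤ N, and the bound becomes Δ/√σ. The factorisation lives over ℚ, which has
-- neither limits nor square roots. Isotropy is therefore replaced by the one-sided estimate that a
-- score of at most r/N provides. Each v j is normalised only up to a factor θ < 1, and the summand
-- |y|², which makes the form invertible whatever the u i are, costs another θ. Both sides of Δ² ≤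
-- r² n^(d-1) are natural numbers, so a θ close enough to 1 removes the loss.

bit : Bool → ℕ
bit b = if b then 1 else 0

module DesignSignRank where
  open import Algebra.Properties.Semiring.Sum ℕ.+-*-semiring using () renaming (sum to sumℕ; sum-cong-≗ to sumℕ-cong)
  open import Data.Rational
  open import Data.Rational.Properties
  import Data.Rational.Unnormalised as ℚᵘ
  import Data.Rational.Unnormalised.Properties as ℚᵘ
  open import Algebra.Properties.Semiring.Sum (CommutativeRing.semiring +-*-commutativeRing) using (sum; sum-cong-≗; ∑-distrib-+; ∑-comm; *-distribˡ-sum; *-distribʳ-sum; sum-replicate-zero)
  open import Tactic.RingSolver using (solve-∀)
  open import Tactic.RingSolver.Core.AlmostCommutativeRing using (AlmostCommutativeRing; fromCommutativeRing)

  -- Rational arithmetic and finite sums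

  ℚ-ring : AlmostCommutativeRing 0ℓ 0ℓ
  ℚ-ring = fromCommutativeRing +-*-commutativeRing (λ x → dec⇒maybe (0ℚ ≟ x))

  -- Most inequalities below are proved by naming their slack `e` as a visibly nonnegative
  -- expression; what remains is a polynomial identity for the ring solver.
  ≤-by : ∀ {p q} e → 0ℚ ≤ e → q ≡ p + e → p ≤ q
  ≤-by {p} e 0≤e refl = subst (_≤ p + e) (+-identityʳ p) (+-monoʳ-≤ p 0≤e)

  <-by : ∀ {p q} e → 0ℚ < e → q ≡ p + e → p < q
  <-by {p} e 0<e refl = subst (_< p + e) (+-identityʳ p) (+-monoʳ-< p 0<e)

  p≤q⇒0≤q-p : ∀ {p q} → p ≤ q → 0ℚ ≤ q - p
  p≤q⇒0≤q-p {p} {q} p≤q = subst (_≤ q - p) (+-inverseʳ p) (+-monoˡ-≤ (- p) p≤q)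

  p<q⇒0<q-p : ∀ {p q} → p < q → 0ℚ < q - p
  p<q⇒0<q-p {p} {q} p<q = subst (_< q - p) (+-inverseʳ p) (+-monoˡ-< (- p) p<q)

  *-monoʳ : ∀ {r p q} → 0ℚ ≤ r → p ≤ q → r * p ≤ r * q
  *-monoʳ {r} 0≤r = *-monoˡ-≤-nonNeg r ⦃ nonNegative 0≤r ⦄

  *-monoˡ : ∀ {r p q} → 0ℚ ≤ r → p ≤ q → p * r ≤ q * r
  *-monoˡ {r} 0≤r = *-monoʳ-≤-nonNeg r ⦃ nonNegative 0≤r ⦄

  0≤* : ∀ {p q} → 0ℚ ≤ p → 0ℚ ≤ q → 0ℚ ≤ p * q
  0≤* {p} {q} 0≤p 0≤q = subst (_≤ p * q) (*-zeroʳ p) (*-monoʳ 0≤p 0≤q)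

  0≤+ : ∀ {p q} → 0ℚ ≤ p → 0ℚ ≤ q → 0ℚ ≤ p + q
  0≤+ = +-mono-≤

  0<* : ∀ {p q} → 0ℚ < p → 0ℚ < q → 0ℚ < p * q
  0<* {p} {q} 0<p 0<q = subst (_< p * q) (*-zeroʳ p) (*-monoʳ-<-pos p ⦃ positive 0<p ⦄ 0<q)

  *-cancel-≤ : ∀ {r p q} → 0ℚ < r → r * p ≤ r * q → p ≤ q
  *-cancel-≤ {r} 0<r = *-cancelˡ-≤-pos r ⦃ positive 0<r ⦄

  0≤1 : 0ℚ ≤ 1ℚ
  0≤1 = nonNegative⁻¹ 1ℚ

  0<1 : 0ℚ < 1ℚ
  0<1 = positive⁻¹ 1ℚ

  0≤sq : ∀ p → 0ℚ ≤ p * p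
  0≤sq p with ≤-total 0ℚ p
  ... | inj₁ 0≤p = 0≤* 0≤p 0≤p
  ... | inj₂ p≤0 = subst (0ℚ ≤_) (lemma p) (0≤* 0≤-p 0≤-p)
    where
    0≤-p : 0ℚ ≤ - p
    0≤-p = neg-antimono-≤ p≤0
    lemma : ∀ p → (- p) * (- p) ≡ p * p
    lemma = solve-∀ ℚ-ring

  reciprocal : ∀ {p} → 0ℚ < p → ∃[ q ] (0ℚ < q × p * q ≡ 1ℚ)
  reciprocal {p} 0<p = 1/ p , positive⁻¹ (1/ p) , *-inverseʳ p
    where
    instance
      p-pos : Positive p
      p-pos = positive 0<p
      p-nonZero : NonZero p
      p-nonZero = pos⇒nonZero p
      1/p-pos : Positive (1/ p)
      1/p-pos = 1/pos⇒pos p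

  divide : ∀ {p q} → 0ℚ < p → 0ℚ < q → ∃[ x ] (0ℚ < x × p * x ≡ q)
  divide {p} {q} 0<p 0<q = let i , 0<i , p*i = reciprocal 0<p in
    i * q , 0<* 0<i 0<q , trans (sym (*-assoc p i q)) (trans (cong (_* q) p*i) (*-identityˡ q))

  -- Recursive rather than a normalised fraction, so that the homomorphism laws are plain
  -- inductions.
  ι : ℕ → ℚ
  ι zero    = 0ℚ
  ι (suc n) = 1ℚ + ι n

  ι-+ : ∀ m n → ι (m ℕ.+ n) ≡ ι m + ι n
  ι-+ zero    n = sym (+-identityˡ (ι n))
  ι-+ (suc m) n = trans (cong (1ℚ +_) (ι-+ m n)) (sym (+-assoc 1ℚ (ι m) (ι n)))

  ι-* : ∀ m n → ι (m ℕ.* n) ≡ ι m * ι n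
  ι-* zero    n = sym (*-zeroˡ (ι n))
  ι-* (suc m) n = trans (ι-+ n (m ℕ.* n)) (trans (cong (ι n +_) (ι-* m n)) (lemma (ι m) (ι n)))
    where
    lemma : ∀ a b → b + a * b ≡ (1ℚ + a) * b
    lemma = solve-∀ ℚ-ring

  0≤ι : ∀ n → 0ℚ ≤ ι n
  0≤ι zero    = ≤-refl
  0≤ι (suc n) = 0≤+ 0≤1 (0≤ι n)

  ι-mono-≤ : ∀ {m n} → m ℕ.≤ n → ι m ≤ ι n
  ι-mono-≤ {n = n} ℕ.z≤n = 0≤ι n
  ι-mono-≤ (ℕ.s≤s m≤n) = +-monoʳ-≤ 1ℚ (ι-mono-≤ m≤n)

  0<ι-suc : ∀ n → 0ℚ < ι (suc n)
  0<ι-suc n = <-≤-trans 0<1 (ι-mono-≤ {1} {suc n} (ℕ.s≤s ℕ.z≤n))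

  toℚᵘ-ι : ∀ n → toℚᵘ (ι n) ℚᵘ.≃ ℚᵘ.mkℚᵘ (ℤ.+ n) 0
  toℚᵘ-ι zero    = ℚᵘ.≃-refl
  toℚᵘ-ι (suc n) = ℚᵘ.≃-trans (toℚᵘ-homo-+ 1ℚ (ι n)) (ℚᵘ.≃-trans (ℚᵘ.+-congʳ (toℚᵘ 1ℚ) (toℚᵘ-ι n))
    (ℚᵘ.*≡* (cong (ℤ._* ℤ.1ℤ) (cong (λ i → ℤ.1ℤ ℤ.+ i) (ℤ.*-identityʳ (ℤ.+ n))))))

  archimedean : ∀ p → ∃[ n ] p < ι n
  archimedean p@record{} = suc m , ≤-<-trans p≤m (<-by 1ℚ 0<1 (+-comm 1ℚ (ι m)))
    where
    m = ℤ.∣ ↥ p ∣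
    bound : toℚᵘ p ℚᵘ.≤ ℚᵘ.mkℚᵘ (ℤ.+ m) 0
    bound = ℚᵘ.*≤* (ℤ.≤-trans (ℤ.≤-reflexive (ℤ.*-identityʳ (↥ p)))
      (ℤ.≤-trans (i≤∣i∣ (↥ p)) (subst (ℤ.+ m ℤ.≤_) (ℤ.pos-* m (↧ₙ p)) (ℤ.+≤+ (ℕ.m≤m*n m (↧ₙ p))))))
      where
      i≤∣i∣ : ∀ i → i ℤ.≤ ℤ.+ ℤ.∣ i ∣
      i≤∣i∣ (ℤ.+ n)      = ℤ.≤-refl
      i≤∣i∣ (ℤ.-[1+ n ]) = ℤ.-≤+
    p≤m : p ≤ ι m
    p≤m = toℚᵘ-cancel-≤ (ℚᵘ.≤-respʳ-≃ (ℚᵘ.≃-sym (toℚᵘ-ι m)) bound)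

  archimedean-* : ∀ {e} → 0ℚ < e → ∀ p → ∃[ n ] p < ι n * e
  archimedean-* {e} 0<e p = let i , _ , e*i = reciprocal 0<e ; n , p*i<n = archimedean (p * i) in
    n , subst (_< ι n * e) (trans (lemma p i e) (trans (cong (p *_) e*i) (*-identityʳ p)))
          (*-monoˡ-<-pos e ⦃ positive 0<e ⦄ p*i<n)
    where
    lemma : ∀ p i e → p * i * e ≡ p * (e * i)
    lemma = solve-∀ ℚ-ring

  sum-mono-≤ : ∀ {n} {f g : Fin n → ℚ} → (∀ i → f i ≤ g i) → sum f ≤ sum g
  sum-mono-≤ {zero}  f≤g = ≤-refl
  sum-mono-≤ {suc n} f≤g = +-mono-≤ (f≤g fzero) (sum-mono-≤ (f≤g ∘ fsuc))

  0≤sum : ∀ {n} {f : Fin n → ℚ} → (∀ i → 0ℚ ≤ f i) → 0ℚ ≤ sum f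
  0≤sum {n} {f} 0≤f = subst (_≤ sum f) (sum-replicate-zero n) (sum-mono-≤ 0≤f)

  term≤sum : ∀ {n} {f : Fin n → ℚ} → (∀ i → 0ℚ ≤ f i) → ∀ i → f i ≤ sum f
  term≤sum {f = f} 0≤f fzero    = ≤-by (sum (f ∘ fsuc)) (0≤sum (0≤f ∘ fsuc)) refl
  term≤sum {f = f} 0≤f (fsuc i) = ≤-trans (term≤sum (0≤f ∘ fsuc) i) (≤-by (f fzero) (0≤f fzero) (+-comm (f fzero) _))

  sum-const : ∀ n c → sum {n} (λ _ → c) ≡ ι n * c
  sum-const zero    c = sym (*-zeroˡ c)
  sum-const (suc n) c = trans (cong (c +_) (sum-const n c)) (lemma c (ι n))
    where
    lemma : ∀ c a → c + a * c ≡ (1ℚ + a) * c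
    lemma = solve-∀ ℚ-ring

  sum-*-sum : ∀ {m n} (f : Fin m → ℚ) (g : Fin n → ℚ) → sum (λ i → sum (λ j → f i * g j)) ≡ sum f * sum g
  sum-*-sum f g = trans (sum-cong-≗ (λ i → sym (*-distribˡ-sum (f i) g))) (sym (*-distribʳ-sum (sum g) f))

  sum-- : ∀ {n} (f g : Fin n → ℚ) → sum (λ i → f i - g i) ≡ sum f - sum g
  sum-- {n} f g = trans (∑-distrib-+ f (λ i → - g i)) (cong (sum f +_) (trans (sum-cong-≗ (λ i → negate (g i)))
    (trans (sym (*-distribˡ-sum (- 1ℚ) g)) (sym (negate (sum g))))))
    where
    negate : ∀ a → - a ≡ - 1ℚ * a
    negate = solve-∀ ℚ-ring

  δ : ∀ {n} → Fin n → Fin n → ℚ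
  δ i j = if does (i Fin.≟ j) then 1ℚ else 0ℚ

  δ-refl : ∀ {n} (i : Fin n) → δ i i ≡ 1ℚ
  δ-refl i = cong (if_then 1ℚ else 0ℚ) (dec-true (i Fin.≟ i) refl)

  δ-≢ : ∀ {n} {i j : Fin n} → i ≢ j → δ i j ≡ 0ℚ
  δ-≢ {i = i} {j} i≢j = cong (if_then 1ℚ else 0ℚ) (dec-false (i Fin.≟ j) i≢j)

  δ-sym : ∀ {n} (i j : Fin n) → δ i j ≡ δ j i
  δ-sym i j with i Fin.≟ j
  ... | yes refl = sym (δ-refl i)
  ... | no i≢j = sym (δ-≢ (i≢j ∘ sym))

  sum-δ : ∀ {n} (i : Fin n) (f : Fin n → ℚ) → sum (λ j → δ i j * f j) ≡ f i
  sum-δ {suc n} fzero f = trans (cong₂ _+_ (*-identityˡ (f fzero))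
    (trans (sum-cong-≗ {n} (λ j → *-zeroˡ (f (fsuc j)))) (sum-replicate-zero n))) (+-identityʳ _)
  sum-δ {suc n} (fsuc i) f = trans (cong₂ _+_ (*-zeroˡ (f fzero)) (sum-δ i (f ∘ fsuc))) (+-identityˡ _)

  -- Inner products and Cauchy-Schwarz inequalities

  -- With w′ = w, a′ = a, b′ = b this is the Lagrange form of the Cauchy–Schwarz inequality.
  lagrange : ∀ {m n} (w a b : Fin m → ℚ) (w′ a′ b′ : Fin n → ℚ) → (∀ i → 0ℚ ≤ w i) → (∀ j → 0ℚ ≤ w′ j) →
    let P = sum (λ i → w i * (a i * b i)); P′ = sum (λ j → w′ j * (a′ j * b′ j)) in
    P * P′ + P * P′ ≤ sum (λ i → w i * (a i * a i)) * sum (λ j → w′ j * (b′ j * b′ j))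
                    + sum (λ i → w i * (b i * b i)) * sum (λ j → w′ j * (a′ j * a′ j))
  lagrange w a b w′ a′ b′ 0≤w 0≤w′ =
    ≤-by _ (0≤sum (λ i → 0≤sum (λ j → 0≤* (0≤* (0≤w i) (0≤w′ j)) (0≤sq (a i * b′ j - b i * a′ j))))) (sym identity)
    where
    open ≡-Reasoning
    P = sum (λ i → w i * (a i * b i))
    P′ = sum (λ j → w′ j * (a′ j * b′ j))
    aa = λ i → w i * (a i * a i)
    bb = λ i → w i * (b i * b i)
    ab = λ i → w i * (a i * b i)
    aa′ = λ j → w′ j * (a′ j * a′ j)
    bb′ = λ j → w′ j * (b′ j * b′ j)
    ab′ = λ j → w′ j * (a′ j * b′ j)
    term : ∀ w a b w′ a′ b′ → w * w′ * ((a * b′ - b * a′) * (a * b′ - b * a′)) + (w * (a * b) * (w′ * (a′ * b′)) + w * (a * b) * (w′ * (a′ * b′)))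
      ≡ w * (a * a) * (w′ * (b′ * b′)) + w * (b * b) * (w′ * (a′ * a′))
    term = solve-∀ ℚ-ring
    sq = λ i j → w i * w′ j * ((a i * b′ j - b i * a′ j) * (a i * b′ j - b i * a′ j))
    S = sum (λ i → sum (sq i))
    sum₂-+ : ∀ {m n} (f g : Fin m → Fin n → ℚ) →
      sum (λ i → sum (λ j → f i j + g i j)) ≡ sum (λ i → sum (f i)) + sum (λ i → sum (g i))
    sum₂-+ f g = trans (sum-cong-≗ (λ i → ∑-distrib-+ (f i) (g i))) (∑-distrib-+ (λ i → sum (f i)) (λ i → sum (g i)))
    identity : P * P′ + P * P′ + S ≡ sum aa * sum bb′ + sum bb * sum aa′
    identity = begin
      P * P′ + P * P′ + S                       ≡⟨ +-comm (P * P′ + P * P′) S ⟩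
      S + (P * P′ + P * P′)                     ≡⟨ cong (S +_) (cong₂ _+_ (sum-*-sum ab ab′) (sum-*-sum ab ab′)) ⟨
      S + (sum (λ i → sum (λ j → ab i * ab′ j)) + sum (λ i → sum (λ j → ab i * ab′ j))) ≡⟨ cong (S +_) (sum₂-+ (λ i j → ab i * ab′ j) (λ i j → ab i * ab′ j)) ⟨
      S + sum (λ i → sum (λ j → ab i * ab′ j + ab i * ab′ j)) ≡⟨ sum₂-+ sq (λ i j → ab i * ab′ j + ab i * ab′ j) ⟨
      sum (λ i → sum (λ j → sq i j + (ab i * ab′ j + ab i * ab′ j)))
        ≡⟨ sum-cong-≗ (λ i → sum-cong-≗ (λ j → term (w i) (a i) (b i) (w′ j) (a′ j) (b′ j))) ⟩
      sum (λ i → sum (λ j → aa i * bb′ j + bb i * aa′ j)) ≡⟨ sum₂-+ (λ i j → aa i * bb′ j) (λ i j → bb i * aa′ j) ⟩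
      sum (λ i → sum (λ j → aa i * bb′ j)) + sum (λ i → sum (λ j → bb i * aa′ j)) ≡⟨ cong₂ _+_ (sum-*-sum aa bb′) (sum-*-sum bb aa′) ⟩
      sum aa * sum bb′ + sum bb * sum aa′       ∎

  sum-interchange : ∀ {m n} (f : Fin m → Fin n → ℚ) (y : Fin n → ℚ) →
    sum (λ k → sum (λ l → f l k) * y k) ≡ sum (λ l → sum (λ k → f l k * y k))
  sum-interchange f y =
    trans (sum-cong-≗ (λ k → *-distribʳ-sum (y k) (λ l → f l k))) (∑-comm (λ k l → f l k * y k))

  infixl 8 _∙_
  infixr 9 _·_

  _∙_ : ∀ {n} → (Fin n → ℚ) → (Fin n → ℚ) → ℚ
  x ∙ y = sum (λ k → x k * y k)

  ∙-comm : ∀ {n} (x y : Fin n → ℚ) → (x ∙ y) ≡ (y ∙ x)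
  ∙-comm x y = sum-cong-≗ (λ k → *-comm (x k) (y k))

  δ-∙ : ∀ {n} k (x : Fin n → ℚ) → (δ k ∙ x) ≡ x k
  δ-∙ = sum-δ

  0≤x∙x : ∀ {n} (x : Fin n → ℚ) → 0ℚ ≤ (x ∙ x)
  0≤x∙x x = 0≤sum (λ k → 0≤sq (x k))

  _·_ : ∀ {n} → (Fin n → Fin n → ℚ) → (Fin n → ℚ) → Fin n → ℚ
  (C · x) k = (C k ∙ x)

  halve-≤ : ∀ {p q} → p + p ≤ q + q → p ≤ q
  halve-≤ {p} {q} 2p≤2q with p ≤? q
  ... | yes p≤q = p≤q
  ... | no p≰q = contradiction (<-≤-trans (+-mono-< (≰⇒> p≰q) (≰⇒> p≰q)) 2p≤2q) (<-irrefl refl)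

  cauchy-schwarz : ∀ {n} (w a b : Fin n → ℚ) → (∀ i → 0ℚ ≤ w i) →
    sum (λ i → w i * (a i * b i)) * sum (λ i → w i * (a i * b i)) ≤
    sum (λ i → w i * (a i * a i)) * sum (λ i → w i * (b i * b i))
  cauchy-schwarz w a b 0≤w = halve-≤ (≤-trans (lagrange w a b w a b 0≤w 0≤w)
    (≤-reflexive (cong (sum (λ i → w i * (a i * a i)) * sum (λ i → w i * (b i * b i)) +_)
      (*-comm (sum (λ i → w i * (b i * b i))) (sum (λ i → w i * (a i * a i)))))))

  -- The energy form, its inverse, and rank-one updates

  module Rescaling {N r : ℕ} (u : Fin N → Fin r → ℚ) where

    energy : (Fin N → ℚ) → (Fin r → ℚ) → ℚ
    energy w y = sum (λ l → w l * ((u l ∙ y) * (u l ∙ y))) + (y ∙ y)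

    energy-nonNeg : ∀ {w} → (∀ l → 0ℚ ≤ w l) → ∀ y → 0ℚ ≤ energy w y
    energy-nonNeg 0≤w y = 0≤+ (0≤sum (λ l → 0≤* (0≤w l) (0≤sq (u l ∙ y)))) (0≤x∙x y)

    -- C is the inverse of the Gram operator I + Σ w_l u_l u_lᵀ, whose quadratic form is the energy.
    record IsInverse (w : Fin N → ℚ) (C : Fin r → Fin r → ℚ) : Set where
      field
        symmetric : ∀ k m → C k m ≡ C m k
        inverse   : ∀ k m → sum (λ l → w l * ((C · u l) m * u l k)) + C k m ≡ δ k m

      pairing-sym : ∀ x y → (x ∙ C · y) ≡ (y ∙ C · x)
      pairing-sym x y = begin
        sum (λ k → x k * sum (λ m → C k m * y m))   ≡⟨ sum-cong-≗ (λ k → *-distribˡ-sum (x k) (λ m → C k m * y m)) ⟩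
        sum (λ k → sum (λ m → x k * (C k m * y m))) ≡⟨ ∑-comm (λ k m → x k * (C k m * y m)) ⟩
        sum (λ m → sum (λ k → x k * (C k m * y m))) ≡⟨ sum-cong-≗ (λ m → sum-cong-≗ (λ k → trans (cong (λ c → x k * (c * y m)) (symmetric k m)) (lemma (x k) (C m k) (y m)))) ⟩
        sum (λ m → sum (λ k → y m * (C m k * x k))) ≡⟨ sum-cong-≗ (λ m → *-distribˡ-sum (y m) (λ k → C m k * x k)) ⟨
        sum (λ m → y m * sum (λ k → C m k * x k))   ∎
        where
        open ≡-Reasoning
        lemma : ∀ a b c → a * (b * c) ≡ c * (b * a)
        lemma = solve-∀ ℚ-ring

      -- With G = I + Σ w_l u_l u_lᵀ this is G(Cx) = x, where the symmetry of C has turned u_lᵀC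
      -- into C u_l.
      inverse-· : ∀ x k → sum (λ l → w l * ((u l ∙ C · x) * u l k)) + (C · x) k ≡ x k
      inverse-· x k = begin
        sum (λ l → w l * ((u l ∙ C · x) * u l k)) + (C · x) k
          ≡⟨ cong (_+ (C · x) k) (sum-cong-≗ term) ⟩
        sum (λ l → sum (λ m → w l * ((C · u l) m * u l k) * x m)) + (C · x) k
          ≡⟨ cong (_+ (C · x) k) (sum-interchange (λ l m → w l * ((C · u l) m * u l k)) x) ⟨
        sum (λ m → sum (λ l → w l * ((C · u l) m * u l k)) * x m) + (C · x) k
          ≡⟨ ∑-distrib-+ (λ m → sum (λ l → w l * ((C · u l) m * u l k)) * x m) (λ m → C k m * x m) ⟨
        sum (λ m → sum (λ l → w l * ((C · u l) m * u l k)) * x m + C k m * x m)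
          ≡⟨ sum-cong-≗ (λ m → trans (sym (*-distribʳ-+ (x m) (sum (λ l → w l * ((C · u l) m * u l k))) (C k m))) (cong (_* x m) (inverse k m))) ⟩
        sum (λ m → δ k m * x m)
          ≡⟨ sum-δ k x ⟩
        x k ∎
        where
        open ≡-Reasoning
        lemma : ∀ w c u x → w * (c * u) * x ≡ (w * u) * (x * c)
        lemma = solve-∀ ℚ-ring
        lemma′ : ∀ w c u → w * (c * u) ≡ (w * u) * c
        lemma′ = solve-∀ ℚ-ring
        term : ∀ l → w l * ((u l ∙ C · x) * u l k) ≡ sum (λ m → w l * ((C · u l) m * u l k) * x m)
        term l = begin
          w l * ((u l ∙ C · x) * u l k)                   ≡⟨ lemma′ (w l) (u l ∙ C · x) (u l k) ⟩
          (w l * u l k) * (u l ∙ C · x)                   ≡⟨ cong ((w l * u l k) *_) (pairing-sym (u l) x) ⟩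
          (w l * u l k) * (x ∙ C · u l)                   ≡⟨ *-distribˡ-sum (w l * u l k) (λ m → x m * (C · u l) m) ⟩
          sum (λ m → (w l * u l k) * (x m * (C · u l) m))   ≡⟨ sum-cong-≗ (λ m → lemma (w l) ((C · u l) m) (u l k) (x m)) ⟨
          sum (λ m → w l * ((C · u l) m * u l k) * x m)     ∎

      -- The Euclidean product of x and y is the energy inner product of `C · x` and y, because x =
      -- G(Cx).
      ∙-via-inverse : ∀ x y → (x ∙ y) ≡ sum (λ l → w l * ((u l ∙ C · x) * (u l ∙ y))) + (C · x ∙ y)
      ∙-via-inverse x y = begin
        sum (λ k → x k * y k)
          ≡⟨ sum-cong-≗ (λ k → trans (cong (_* y k) (sym (inverse-· x k))) (*-distribʳ-+ (y k) (sum (λ l → w l * (c l * u l k))) ((C · x) k))) ⟩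
        sum (λ k → sum (λ l → w l * (c l * u l k)) * y k + (C · x) k * y k)
          ≡⟨ ∑-distrib-+ (λ k → sum (λ l → w l * (c l * u l k)) * y k) (λ k → (C · x) k * y k) ⟩
        sum (λ k → sum (λ l → w l * (c l * u l k)) * y k) + (C · x ∙ y)
          ≡⟨ cong (_+ (C · x ∙ y)) (sum-interchange (λ l k → w l * (c l * u l k)) y) ⟩
        sum (λ l → sum (λ k → w l * (c l * u l k) * y k)) + (C · x ∙ y)
          ≡⟨ cong (_+ (C · x ∙ y)) (sum-cong-≗ (λ l → trans (sum-cong-≗ (λ k → lemma (w l) (c l) (u l k) (y k)))
               (trans (sym (*-distribˡ-sum (w l * c l) (λ k → u l k * y k))) (*-assoc (w l) (c l) (u l ∙ y))))) ⟩
        sum (λ l → w l * (c l * (u l ∙ y))) + (C · x ∙ y) ∎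
        where
        open ≡-Reasoning
        c : Fin N → ℚ
        c l = (u l ∙ C · x)
        lemma : ∀ w c u y → w * (c * u) * y ≡ (w * c) * (u * y)
        lemma = solve-∀ ℚ-ring

      pairing-energy : ∀ x → (x ∙ C · x) ≡ energy w (C · x)
      pairing-energy x = ∙-via-inverse x (C · x)

      -- Cauchy-Schwarz for the energy inner product of `C · x` and y, since the energy of `C · x`
      -- is `x ∙ C · x`. The two summands of the energy are indexed by different sets; hence the
      -- two-family form of `lagrange` for the cross terms.
      dual-cauchy-schwarz : (∀ l → 0ℚ ≤ w l) → ∀ x y → (x ∙ y) * (x ∙ y) ≤ (x ∙ C · x) * energy w y
      dual-cauchy-schwarz 0≤w x y = begin
        (x ∙ y) * (x ∙ y)                    ≡⟨ cong (λ p → p * p) (∙-via-inverse x y) ⟩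
        (P₁ + P₂) * (P₁ + P₂)                    ≡⟨ expand P₁ P₂ ⟩
        P₁ * P₁ + (P₁ * P₂ + P₁ * P₂) + P₂ * P₂  ≤⟨ +-mono-≤ (+-mono-≤ (cauchy-schwarz w c d 0≤w) mixed) plain ⟩
        A₁ * B₁ + (A₁ * B₂ + B₁ * A₂) + A₂ * B₂  ≡⟨ collect A₁ A₂ B₁ B₂ ⟨
        (A₁ + A₂) * (B₁ + B₂)                    ≡⟨ cong (_* energy w y) (pairing-energy x) ⟨
        (x ∙ C · x) * energy w y               ∎
        where
        open ≤-Reasoning
        z = C · x
        c = λ l → (u l ∙ z)
        d = λ l → (u l ∙ y)
        P₁ = sum (λ l → w l * (c l * d l))
        P₂ = (z ∙ y)
        A₁ = sum (λ l → w l * (c l * c l))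
        A₂ = (z ∙ z)
        B₁ = sum (λ l → w l * (d l * d l))
        B₂ = (y ∙ y)
        expand : ∀ p q → (p + q) * (p + q) ≡ p * p + (p * q + p * q) + q * q
        expand = solve-∀ ℚ-ring
        collect : ∀ a a′ b b′ → (a + a′) * (b + b′) ≡ a * b + (a * b′ + b * a′) + a′ * b′
        collect = solve-∀ ℚ-ring
        weight-one : ∀ (a b : Fin r → ℚ) → sum (λ k → 1ℚ * (a k * b k)) ≡ (a ∙ b)
        weight-one a b = sum-cong-≗ (λ k → *-identityˡ (a k * b k))
        mixed : P₁ * P₂ + P₁ * P₂ ≤ A₁ * B₂ + B₁ * A₂
        mixed = subst₂ _≤_ (cong (λ p → P₁ * p + P₁ * p) (weight-one z y))
          (cong₂ (λ a b → A₁ * a + B₁ * b) (weight-one y y) (weight-one z z))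
          (lagrange w c d (λ _ → 1ℚ) z y 0≤w (λ _ → 0≤1))
        plain : P₂ * P₂ ≤ A₂ * B₂
        plain = subst₂ _≤_ (cong (λ p → p * p) (weight-one z y)) (cong₂ _*_ (weight-one z z) (weight-one y y))
          (cauchy-schwarz (λ _ → 1ℚ) z y (λ _ → 0≤1))

      -- The trace of GC = I. It says that the leverage scores fall short of r by exactly the trace
      -- of C, the room in which a weight can grow.
      trace : sum (λ l → w l * (u l ∙ C · u l)) + sum (λ k → C k k) ≡ ι r
      trace = begin
        sum (λ l → w l * (u l ∙ C · u l)) + sum (λ k → C k k)
          ≡⟨ cong (_+ sum (λ k → C k k)) (sum-cong-≗ (λ l → trans (*-distribˡ-sum (w l) (λ k → u l k * (C · u l) k)) (sum-cong-≗ (λ k → cong (w l *_) (*-comm (u l k) ((C · u l) k)))))) ⟩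
        sum (λ l → sum (λ k → w l * ((C · u l) k * u l k))) + sum (λ k → C k k)
          ≡⟨ cong (_+ sum (λ k → C k k)) (∑-comm (λ l k → w l * ((C · u l) k * u l k))) ⟩
        sum (λ k → sum (λ l → w l * ((C · u l) k * u l k))) + sum (λ k → C k k)
          ≡⟨ ∑-distrib-+ (λ k → sum (λ l → w l * ((C · u l) k * u l k))) (λ k → C k k) ⟨
        sum (λ k → sum (λ l → w l * ((C · u l) k * u l k)) + C k k)
          ≡⟨ sum-cong-≗ (λ k → trans (inverse k k) (δ-refl k)) ⟩
        sum {r} (λ _ → 1ℚ)
          ≡⟨ trans (sum-const r 1ℚ) (*-identityʳ (ι r)) ⟩
        ι r ∎
        where open ≡-Reasoning

    inverse-zero : IsInverse (λ _ → 0ℚ) δ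
    inverse-zero = record
      { symmetric = δ-sym
      ; inverse = λ k m → trans (cong (_+ δ k m) (trans (sum-cong-≗ (λ l → *-zeroˡ ((δ · u l) m * u l k))) (sum-replicate-zero N)))
          (+-identityˡ (δ k m))
      }

    IsInverse-cong : ∀ {w w′ C} → (∀ l → w l ≡ w′ l) → IsInverse w C → IsInverse w′ C
    IsInverse-cong {C = C} w≗w′ inv = record
      { symmetric = IsInverse.symmetric inv
      ; inverse = λ k m → trans (cong (_+ C k m) (sum-cong-≗ (λ l → cong (_* ((C · u l) m * u l k)) (sym (w≗w′ l)))))
          (IsInverse.inverse inv k m)
      }

    -- The Sherman–Morrison formula.
    module RankOneUpdate {w C} (inv : IsInverse w C) (0≤w : ∀ l → 0ℚ ≤ w l) (p : Fin N) {s : ℚ} (0≤s : 0ℚ ≤ s) where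
      open IsInverse inv

      z : Fin r → ℚ
      z = C · u p

      q : ℚ
      q = (u p ∙ z)

      -- `q` is itself an energy by `pairing-energy`, so the Sherman-Morrison denominator is at
      -- least 1.
      0<1+sq : 0ℚ < 1ℚ + s * q
      0<1+sq = <-≤-trans 0<1 (≤-by (s * q) (0≤* 0≤s (subst (0ℚ ≤_) (sym (pairing-energy (u p))) (energy-nonNeg 0≤w z))) refl)

      t : ℚ
      t = s * proj₁ (reciprocal 0<1+sq)

      0≤t : 0ℚ ≤ t
      0≤t = 0≤* 0≤s (<⇒≤ (proj₁ (proj₂ (reciprocal 0<1+sq))))

      t-eq : t * (1ℚ + s * q) ≡ s
      t-eq = trans (lemma s (proj₁ (reciprocal 0<1+sq)) (1ℚ + s * q))
        (trans (cong (s *_) (proj₂ (proj₂ (reciprocal 0<1+sq)))) (*-identityʳ s))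
        where
        lemma : ∀ s i d → s * i * d ≡ s * (d * i)
        lemma = solve-∀ ℚ-ring

      w′ : Fin N → ℚ
      w′ l = w l + δ p l * s

      C′ : Fin r → Fin r → ℚ
      C′ k m = C k m - t * (z k * z m)

      C′-· : ∀ x k → (C′ · x) k ≡ (C · x) k - t * (z k * (x ∙ z))
      C′-· x k = begin
        sum (λ m → (C k m - t * (z k * z m)) * x m)                 ≡⟨ sum-cong-≗ (λ m → lemma (C k m) t (z k) (z m) (x m)) ⟩
        sum (λ m → C k m * x m - t * z k * (x m * z m))             ≡⟨ sum-- (λ m → C k m * x m) (λ m → t * z k * (x m * z m)) ⟩
        (C · x) k - sum (λ m → t * z k * (x m * z m))               ≡⟨ cong (λ a → (C · x) k - a) (*-distribˡ-sum (t * z k) (λ m → x m * z m)) ⟨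
        (C · x) k - t * z k * (x ∙ z)                             ≡⟨ cong (λ a → (C · x) k - a) (*-assoc t (z k) (x ∙ z)) ⟩
        (C · x) k - t * (z k * (x ∙ z))                           ∎
        where
        open ≡-Reasoning
        lemma : ∀ c t zk zm x → (c - t * (zk * zm)) * x ≡ c * x - t * zk * (x * zm)
        lemma = solve-∀ ℚ-ring

      -- C - C′ is the positive semidefinite matrix t z zᵀ, so raising a single weight lowers the
      -- form of every vector simultaneously.
      shrinks : ∀ x → (x ∙ C′ · x) ≤ (x ∙ C · x)
      shrinks x = ≤-by (t * ((x ∙ z) * (x ∙ z))) (0≤* 0≤t (0≤sq (x ∙ z))) (sym (begin
        (x ∙ C′ · x) + D                                      ≡⟨ cong (_+ D) (sum-cong-≗ (λ k → trans (cong (x k *_) (C′-· x k)) (lemma (x k) ((C · x) k) t (z k) (x ∙ z)))) ⟩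
        sum (λ k → x k * (C · x) k - t * (x ∙ z) * (x k * z k)) + D ≡⟨ cong (_+ D) (sum-- (λ k → x k * (C · x) k) (λ k → t * (x ∙ z) * (x k * z k))) ⟩
        (x ∙ C · x) - sum (λ k → t * (x ∙ z) * (x k * z k)) + D   ≡⟨ cong (λ a → (x ∙ C · x) - a + D) (*-distribˡ-sum (t * (x ∙ z)) (λ k → x k * z k)) ⟨
        (x ∙ C · x) - t * (x ∙ z) * (x ∙ z) + D                 ≡⟨ lemma′ (x ∙ C · x) t (x ∙ z) ⟩
        (x ∙ C · x)                                                 ∎))
        where
        open ≡-Reasoning
        D = t * ((x ∙ z) * (x ∙ z))
        lemma : ∀ x c t z y → x * (c - t * (z * y)) ≡ x * c - t * y * (x * z)
        lemma = solve-∀ ℚ-ring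
        lemma′ : ∀ a t b → a - t * b * b + t * (b * b) ≡ a
        lemma′ = solve-∀ ℚ-ring

      isInverse : IsInverse w′ C′
      isInverse = record
        { symmetric = λ k m → cong₂ (λ c e → c - t * e) (symmetric k m) (*-comm (z k) (z m))
        ; inverse = inverse′
        }
        where
        open ≡-Reasoning
        term : ∀ w d s a t zm b u → (w + d * s) * ((a - t * (zm * b)) * u)
          ≡ (w * (a * u) - t * zm * (w * (b * u))) + d * (s * ((a - t * (zm * b)) * u))
        term = solve-∀ ℚ-ring
        -- Substituting the inverse equations for C and for z leaves a multiple of s - t(1 + sq) as
        -- the only defect, which `t-eq` annihilates.
        total : ∀ S₁ S₂ C t zm zk s q D U → S₁ + C ≡ D → S₂ + zk ≡ U →
          (S₁ - t * zm * S₂ + s * ((zm - t * (zm * q)) * U)) + (C - t * (zk * zm)) ≡ D + zm * U * (s - t * (1ℚ + s * q))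
        total S₁ S₂ C t zm zk s q D U refl refl = lemma S₁ S₂ C t zm zk s q
          where
          lemma : ∀ S₁ S₂ C t zm zk s q →
            (S₁ - t * zm * S₂ + s * ((zm - t * (zm * q)) * (S₂ + zk))) + (C - t * (zk * zm)) ≡ S₁ + C + zm * (S₂ + zk) * (s - t * (1ℚ + s * q))
          lemma = solve-∀ ℚ-ring
        vanish : ∀ D e s → D + e * (s - s) ≡ D
        vanish = solve-∀ ℚ-ring
        inverse′ : ∀ k m → sum (λ l → w′ l * ((C′ · u l) m * u l k)) + C′ k m ≡ δ k m
        inverse′ k m = begin
          sum (λ l → w′ l * ((C′ · u l) m * u l k)) + C′ k m
            ≡⟨ cong (_+ C′ k m) (sum-cong-≗ (λ l → trans (cong (λ c → w′ l * (c * u l k)) (C′-· (u l) m))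
                 (term (w l) (δ p l) s ((C · u l) m) t (z m) (u l ∙ z) (u l k)))) ⟩
          sum (λ l → (f l - t * z m * g l) + δ p l * h l) + C′ k m
            ≡⟨ cong (_+ C′ k m) (trans (∑-distrib-+ (λ l → f l - t * z m * g l) (λ l → δ p l * h l))
                 (cong₂ _+_ (trans (sum-- f (λ l → t * z m * g l)) (cong (λ a → sum f - a) (sym (*-distribˡ-sum (t * z m) g))))
                   (sum-δ p h))) ⟩
          (sum f - t * z m * sum g + h p) + C′ k m
            ≡⟨ total (sum f) (sum g) (C k m) t (z m) (z k) s q (δ k m) (u p k) (inverse k m) (inverse-· (u p) k) ⟩
          δ k m + z m * u p k * (s - t * (1ℚ + s * q))
            ≡⟨ cong (λ a → δ k m + z m * u p k * (s - a)) t-eq ⟩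
          δ k m + z m * u p k * (s - s)
            ≡⟨ vanish (δ k m) (z m * u p k) s ⟩
          δ k m ∎
          where
          f g h : Fin N → ℚ
          f l = w l * ((C · u l) m * u l k)
          g l = w l * ((u l ∙ z) * u l k)
          h l = s * (((C · u l) m - t * (z m * (u l ∙ z))) * u l k)

  -- Greedy growth of the weights

  sum-mono-< : ∀ {n} {f g : Fin (suc n) → ℚ} → (∀ i → f i < g i) → sum f < sum g
  sum-mono-< f<g = +-mono-<-≤ (f<g fzero) (sum-mono-≤ (λ i → <⇒≤ (f<g (fsuc i))))

  δ-elim : ∀ {n} (P : ℚ → Set) (i j : Fin n) → (i ≡ j → P 1ℚ) → P 0ℚ → P (δ i j)
  δ-elim P i j P1 P0 = by-cases (i Fin.≟ j)
    where
    by-cases : (i≟j : Dec (i ≡ j)) → P (if does i≟j then 1ℚ else 0ℚ)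
    by-cases (yes i≡j) = P1 i≡j
    by-cases (no _)    = P0

  module Greedy {N r : ℕ} (u : Fin (suc N) → Fin (suc r) → ℚ) {T : ℚ} (0≤T : 0ℚ ≤ T) where
    open Rescaling u

    private
      n₊ r₊ : ℚ
      n₊ = ι (suc N)
      r₊ = ι (suc r)

    -- The energy weights are squares because the vectors being made isotropic are a i u i. `short`
    -- keeps C below the identity it starts from; this bounds `u i ∙ C · u i` uniformly along the
    -- process and permits a constant step.
    record State (a : Fin (suc N) → ℚ) : Set where
      field
        0≤a : ∀ i → 0ℚ ≤ a i
        C      : Fin (suc r) → Fin (suc r) → ℚ
        inv    : IsInverse (λ l → a l * a l) C
        short  : ∀ x → x ∙ C · x ≤ x ∙ x
        cap    : ∀ i → n₊ * (a i * a i * (u i ∙ C · u i)) ≤ r₊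

    initial : State (λ _ → 0ℚ)
    initial = record
      { 0≤a = λ _ → ≤-refl
      ; C      = δ
      ; inv    = IsInverse-cong (λ _ → sym (*-zeroˡ 0ℚ)) inverse-zero
      ; short  = λ x → ≤-reflexive (sum-cong-≗ (λ k → cong (x k *_) (sum-δ k x)))
      ; cap    = λ i → subst (_≤ r₊) (sym (lemma n₊ (u i ∙ δ · u i))) (0≤ι (suc r))
      }
      where
      lemma : ∀ n q → n * (0ℚ * 0ℚ * q) ≡ 0ℚ
      lemma = solve-∀ ℚ-ring

    private
      S₀ : ℚ
      S₀ = sum (λ l → u l fzero * u l fzero)

      D : ℚ
      D = 1ℚ + T * T * S₀

      0≤D-1 : 0ℚ ≤ T * T * S₀
      0≤D-1 = 0≤* (0≤sq T) (0≤sum (λ l → 0≤sq (u l fzero)))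

      0<D : 0ℚ < D
      0<D = <-≤-trans 0<1 (≤-by (T * T * S₀) 0≤D-1 refl)

    -- `dual-cauchy-schwarz` with both vectors equal to the first basis vector e gives 1 ≤ e∙Ce
    -- times the energy of e, and that energy is at most `D` while no weight exceeds T. So the trace
    -- of C stays away from zero.
    diagonal-bound : ∀ {a} (st : State a) → (∀ i → a i ≤ T) → 1ℚ ≤ D * sum (λ k → State.C st k k)
    diagonal-bound {a} st a≤T = ≤-trans 1≤CD (≤-trans (≤-reflexive (*-comm (C fzero fzero) D))
        (*-monoʳ (<⇒≤ 0<D) (term≤sum 0≤diag fzero)))
      where
      open State st
      open IsInverse inv
      e : Fin (suc r) → ℚ
      e = δ fzero
      0≤a² : ∀ l → 0ℚ ≤ a l * a l
      0≤a² l = 0≤sq (a l)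
      diag : ∀ k → δ k ∙ C · δ k ≡ C k k
      diag k = trans (δ-∙ k (C · δ k)) (trans (∙-comm (C k) (δ k)) (δ-∙ k (C k)))
      0≤diag : ∀ k → 0ℚ ≤ C k k
      0≤diag k = subst (0ℚ ≤_) (trans (sym (pairing-energy (δ k))) (diag k)) (energy-nonNeg 0≤a² (C · δ k))
      e∙e : e ∙ e ≡ 1ℚ
      e∙e = trans (δ-∙ fzero e) (δ-refl {suc r} fzero)
      energy≤D : energy (λ l → a l * a l) e ≤ D
      energy≤D = ≤-trans (+-mono-≤ (≤-trans (sum-mono-≤ term) (≤-reflexive (sym (*-distribˡ-sum (T * T) (λ l → u l fzero * u l fzero)))))
          (≤-reflexive e∙e)) (≤-reflexive (+-comm (T * T * S₀) 1ℚ))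
        where
        term : ∀ l → a l * a l * ((u l ∙ e) * (u l ∙ e)) ≤ T * T * (u l fzero * u l fzero)
        term l = ≤-trans (≤-reflexive (cong (λ p → a l * a l * (p * p)) (trans (∙-comm (u l) e) (δ-∙ fzero (u l)))))
          (*-monoˡ (0≤sq (u l fzero)) (≤-trans (*-monoˡ (0≤a l) (a≤T l)) (*-monoʳ 0≤T (a≤T l))))
      1≤CD : 1ℚ ≤ C fzero fzero * D
      1≤CD = begin
        1ℚ                                              ≡⟨ *-identityˡ 1ℚ ⟨
        1ℚ * 1ℚ                                         ≡⟨ cong₂ _*_ e∙e e∙e ⟨
        (e ∙ e) * (e ∙ e)                               ≤⟨ dual-cauchy-schwarz 0≤a² e e ⟩
        (e ∙ C · e) * energy (λ l → a l * a l) e        ≡⟨ cong (_* energy (λ l → a l * a l) e) (diag fzero) ⟩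
        C fzero fzero * energy (λ l → a l * a l) e      ≤⟨ *-monoʳ (0≤diag fzero) energy≤D ⟩
        C fzero fzero * D                               ∎
        where open ≤-Reasoning

    private
      U : ℚ
      U = sum (λ i → u i ∙ u i)

      0≤U : 0ℚ ≤ U
      0≤U = 0≤sum (λ i → 0≤x∙x (u i))

    -- `γ` is the guaranteed slack and `ε` the increment of a weight at most T. The square then
    -- grows by at most ε(2T + 1), which is multiplied by a form of value at most `U`; `budget`
    -- makes this fit into the slack.
    record StepSizes : Set where
      field
        γ ε    : ℚ
        0<ε    : 0ℚ < ε
        ε≤1    : ε ≤ 1ℚ
        budget : n₊ * (ε * (T + T + 1ℚ) * U) ≤ γ
        trace≥ : ∀ {a} (st : State a) → (∀ i → a i ≤ T) → γ ≤ sum (λ k → State.C st k k)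

    -- γ = 1/D and ε = γ/E, where D bounds the first diagonal entry of the Gram operator.
    step-sizes : StepSizes
    step-sizes = let γ , 0<γ , D*γ = divide 0<D 0<1
                     ε , 0<ε , E*ε = divide 0<E 0<γ
      in record
        { γ = γ ; ε = ε ; 0<ε = 0<ε
        ; ε≤1 = ≤-trans (≤-1+ 0≤E-1 (<⇒≤ 0<ε) E*ε) (≤-1+ 0≤D-1 (<⇒≤ 0<γ) D*γ)
        ; budget = ≤-by ε (<⇒≤ 0<ε) (trans (sym E*ε) (lemma ε n₊ (T + T + 1ℚ) U))
        ; trace≥ = λ st a≤T → *-cancel-≤ 0<D (≤-trans (≤-reflexive D*γ) (diagonal-bound st a≤T))
        }
      where
      E : ℚ
      E = 1ℚ + n₊ * ((T + T + 1ℚ) * U)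
      0≤E-1 : 0ℚ ≤ n₊ * ((T + T + 1ℚ) * U)
      0≤E-1 = 0≤* (0≤ι (suc N)) (0≤* (0≤+ (0≤+ 0≤T 0≤T) 0≤1) 0≤U)
      0<E : 0ℚ < E
      0<E = <-≤-trans 0<1 (≤-by _ 0≤E-1 refl)
      ≤-1+ : ∀ {x p q} → 0ℚ ≤ x → 0ℚ ≤ p → (1ℚ + x) * p ≡ q → p ≤ q
      ≤-1+ {x} {p} 0≤x 0≤p eq = ≤-by (x * p) (0≤* 0≤x 0≤p) (trans (sym eq) (lemma′ x p))
        where
        lemma′ : ∀ x p → (1ℚ + x) * p ≡ p + x * p
        lemma′ = solve-∀ ℚ-ring
      lemma : ∀ e n t u → (1ℚ + n * (t * u)) * e ≡ n * (e * t * u) + e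
      lemma = solve-∀ ℚ-ring

    Tall : Set
    Tall = ∃[ a ] (State a × ∃[ i ] T < a i)

    module Growth (sizes : StepSizes) where
      open StepSizes sizes

      -- Averaging: by `trace` the mean over i of the quantities n₊ times a score is r₊ minus the
      -- trace of C, hence at most r₊ - γ.
      slack : ∀ {a} (st : State a) → (∀ i → a i ≤ T) →
        ∃[ i ] n₊ * (a i * a i * (u i ∙ State.C st · u i)) + γ ≤ r₊
      slack {a} st a≤T = search (Fin.any? (λ i → (n₊ * (a i * a i * (u i ∙ State.C st · u i)) + γ) ≤? r₊))
        where
        open State st
        open IsInverse inv
        search : Dec (∃[ i ] n₊ * (a i * a i * (u i ∙ C · u i)) + γ ≤ r₊) → ∃[ i ] n₊ * (a i * a i * (u i ∙ C · u i)) + γ ≤ r₊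
        search (yes found) = found
        search (no none) = contradiction (<-≤-trans too-big (≤-trans (*-monoʳ (0≤ι (suc N)) bound) (≤-reflexive (cong (n₊ *_) trace)))) (<-irrefl refl)
          where
          τ : Fin (suc N) → ℚ
          τ i = a i * a i * (u i ∙ C · u i)
          bound : sum τ + γ ≤ sum τ + sum (λ k → C k k)
          bound = +-monoʳ-≤ (sum τ) (trace≥ st a≤T)
          too-big : n₊ * r₊ < n₊ * (sum τ + γ)
          too-big = subst₂ _<_ (sum-const (suc N) r₊)
            (trans (∑-distrib-+ (λ i → n₊ * τ i) (λ _ → γ)) (trans (cong₂ _+_ (sym (*-distribˡ-sum n₊ τ)) (sum-const (suc N) γ))
              (sym (*-distribˡ-+ n₊ (sum τ) γ))))
            (sum-mono-< {f = λ _ → r₊} (λ i → ≰⇒> (λ le → none (i , le))))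

      raise : (Fin (suc N) → ℚ) → Fin (suc N) → Fin (suc N) → ℚ
      raise a i l = a l + δ i l * ε

      sum-raise : ∀ a i → sum (raise a i) ≡ sum a + ε
      sum-raise a i = trans (∑-distrib-+ a (λ l → δ i l * ε)) (cong (sum a +_) (sum-δ i (λ _ → ε)))

      step : ∀ {a} (st : State a) → (∀ i → a i ≤ T) → ∀ i →
        n₊ * (a i * a i * (u i ∙ State.C st · u i)) + γ ≤ r₊ → State (raise a i)
      step {a} st a≤T i room = record
        { 0≤a = λ l → 0≤+ (0≤a l) (0≤* (0≤δ l) (<⇒≤ 0<ε))
        ; C      = C′
        ; inv    = IsInverse-cong squares isInverse
        ; short  = λ x → ≤-trans (shrinks x) (short x)
        ; cap    = λ l → ≤-trans (*-monoʳ (0≤ι (suc N)) (*-monoʳ (0≤sq (raise a i l)) (shrinks (u l)))) (cap′ l)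
        }
        where
        open State st
        s : ℚ
        -- The increment (a i + ε)² - (a i)² of the squared weight.
        s = (a i + a i + ε) * ε
        0≤s : 0ℚ ≤ s
        0≤s = 0≤* (0≤+ (0≤+ (0≤a i) (0≤a i)) (<⇒≤ 0<ε)) (<⇒≤ 0<ε)
        open RankOneUpdate inv (λ l → 0≤sq (a l)) i 0≤s
        0≤δ : ∀ l → 0ℚ ≤ δ i l
        0≤δ l = δ-elim (0ℚ ≤_) i l (λ _ → 0≤1) ≤-refl
        square₁ : ∀ a e → a * a + 1ℚ * ((a + a + e) * e) ≡ (a + 1ℚ * e) * (a + 1ℚ * e)
        square₁ = solve-∀ ℚ-ring
        square₀ : ∀ a e s → a * a + 0ℚ * s ≡ (a + 0ℚ * e) * (a + 0ℚ * e)
        square₀ = solve-∀ ℚ-ring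
        squares : ∀ l → a l * a l + δ i l * s ≡ raise a i l * raise a i l
        squares l = δ-elim (λ d → a l * a l + d * s ≡ (a l + d * ε) * (a l + d * ε)) i l
          (λ { refl → square₁ (a i) ε }) (square₀ (a l) ε s)
        cap′ : ∀ l → n₊ * (raise a i l * raise a i l * (u l ∙ C · u l)) ≤ r₊
        cap′ l = subst (λ v → n₊ * (v * (u l ∙ C · u l)) ≤ r₊) (squares l) (by-cases (i Fin.≟ l))
          where
          open ≤-Reasoning
          other : ∀ b s → b + 0ℚ * s ≡ b
          other = solve-∀ ℚ-ring
          distr : ∀ n b s q → n * ((b + 1ℚ * s) * q) ≡ n * (b * q) + n * (s * q)
          distr = solve-∀ ℚ-ring
          by-cases : Dec (i ≡ l) → n₊ * ((a l * a l + δ i l * s) * (u l ∙ C · u l)) ≤ r₊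
          by-cases (no i≢l) = subst (λ v → n₊ * (v * (u l ∙ C · u l)) ≤ r₊)
            (sym (trans (cong (λ d → a l * a l + d * s) (δ-≢ i≢l)) (other (a l * a l) s))) (cap l)
          by-cases (yes refl) = begin
            n₊ * ((a i * a i + δ i i * s) * κ)           ≡⟨ cong (λ d → n₊ * ((a i * a i + d * s) * κ)) (δ-refl i) ⟩
            n₊ * ((a i * a i + 1ℚ * s) * κ)              ≡⟨ distr n₊ (a i * a i) s κ ⟩
            n₊ * (a i * a i * κ) + n₊ * (s * κ)          ≤⟨ +-monoʳ-≤ (n₊ * (a i * a i * κ)) (≤-trans (*-monoʳ (0≤ι (suc N)) s*κ) budget) ⟩
            n₊ * (a i * a i * κ) + γ                     ≤⟨ room ⟩
            r₊                                           ∎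
            where
            κ = u i ∙ C · u i
            s*κ : s * κ ≤ ε * (T + T + 1ℚ) * U
            s*κ = begin
              s * κ                        ≤⟨ *-monoʳ 0≤s (≤-trans (short (u i)) (term≤sum (λ l → 0≤x∙x (u l)) i)) ⟩
              s * U                        ≤⟨ *-monoˡ 0≤U (*-monoˡ (<⇒≤ 0<ε) (+-mono-≤ (+-mono-≤ (a≤T i) (a≤T i)) ε≤1)) ⟩
              (T + T + 1ℚ) * ε * U         ≡⟨ cong (_* U) (*-comm (T + T + 1ℚ) ε) ⟩
              ε * (T + T + 1ℚ) * U         ∎

      -- The total weight serves as potential: each step adds exactly ε, while weights at most T add
      -- up to at most n₊T, so `tall` needs only the archimedean property.
      grow : ∀ m → Tall ⊎ ∃[ a ] (State a × (∀ i → a i ≤ T) × sum a ≡ ι m * ε)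
      grow zero = inj₂ ((λ _ → 0ℚ) , initial , (λ _ → 0≤T) , trans (sum-replicate-zero (suc N)) (sym (*-zeroˡ ε)))
      grow (suc m) with grow m
      ... | inj₁ tall = inj₁ tall
      ... | inj₂ (a , st , a≤T , total) with slack st a≤T
      ...   | i , room with Fin.any? (λ l → T <? raise a i l)
      ...     | yes tall = inj₁ (raise a i , step st a≤T i room , tall)
      ...     | no none = inj₂ (raise a i , step st a≤T i room , (λ l → ≮⇒≥ (λ lt → none (l , lt)))
                , trans (sum-raise a i) (trans (cong (_+ ε) total) (lemma (ι m) ε)))
        where
        lemma : ∀ m e → m * e + e ≡ (1ℚ + m) * e
        lemma = solve-∀ ℚ-ring

      tall : Tall
      tall = let m , big = archimedean-* 0<ε (n₊ * T) in by-cases m big (grow m)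
        where
        by-cases : ∀ m → n₊ * T < ι m * ε → Tall ⊎ ∃[ a ] (State a × (∀ i → a i ≤ T) × sum a ≡ ι m * ε) → Tall
        by-cases m big (inj₁ found) = found
        by-cases m big (inj₂ (a , st , a≤T , total)) = contradiction (<-≤-trans big small) (<-irrefl refl)
          where
          small : ι m * ε ≤ n₊ * T
          small = subst (_≤ n₊ * T) total (≤-trans (sum-mono-≤ a≤T) (≤-reflexive (sum-const (suc N) T)))

    -- For unit vectors in exactly isotropic position, (u i ∙ y)² ≤ |y|² = (r/N) Σ (u l ∙ y)². This
    -- one-sided consequence, with the energy in place of the sum, carries the whole of Forster's
    -- argument.
    nearly-isotropic : ∃[ a ] ((∀ i → 0ℚ ≤ a i) × (∃[ i ] T < a i) ×
      (∀ i y → n₊ * (a i * a i * ((u i ∙ y) * (u i ∙ y))) ≤ r₊ * energy (λ l → a l * a l) y))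
    nearly-isotropic = let a , st , some = Growth.tall step-sizes in a , State.0≤a st , some , bound st
      where
      bound : ∀ {a} → State a → ∀ i y → n₊ * (a i * a i * ((u i ∙ y) * (u i ∙ y))) ≤ r₊ * energy (λ l → a l * a l) y
      bound {a} st i y = begin
        n₊ * (a i * a i * ((u i ∙ y) * (u i ∙ y)))                                  ≤⟨ *-monoʳ (0≤ι (suc N)) (*-monoʳ (0≤sq (a i)) (dual-cauchy-schwarz (λ l → 0≤sq (a l)) (u i) y)) ⟩
        n₊ * (a i * a i * ((u i ∙ C · u i) * energy (λ l → a l * a l) y))           ≡⟨ lemma n₊ (a i * a i) (u i ∙ C · u i) (energy (λ l → a l * a l) y) ⟩
        n₊ * (a i * a i * (u i ∙ C · u i)) * energy (λ l → a l * a l) y             ≤⟨ *-monoˡ (energy-nonNeg (λ l → 0≤sq (a l)) y) (cap i) ⟩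
        r₊ * energy (λ l → a l * a l) y                                             ∎
        where
        open State st
        open IsInverse inv
        open ≤-Reasoning
        lemma : ∀ n b q e → n * (b * (q * e)) ≡ n * (b * q) * e
        lemma = solve-∀ ℚ-ring

  -- Spectral estimate and Forster's comparison

  sum-square-≤ : ∀ {n} (f : Fin n → ℚ) → sum f * sum f ≤ ι n * sum (λ i → f i * f i)
  sum-square-≤ {n} f = subst₂ _≤_
    (cong (λ p → p * p) (sum-cong-≗ (λ i → trans (*-identityˡ (f i * 1ℚ)) (*-identityʳ (f i)))))
    (trans (*-comm _ (sum {n} (λ _ → 1ℚ * (1ℚ * 1ℚ)))) (cong₂ _*_
      (trans (sum-cong-≗ {n} (λ _ → refl)) (trans (sum-const n 1ℚ) (*-identityʳ (ι n))))
      (sum-cong-≗ (λ i → *-identityˡ (f i * f i)))))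
    (cauchy-schwarz (λ _ → 1ℚ) f (λ _ → 1ℚ) (λ _ → 0≤1))

  square-mono-≤ : ∀ {p q} → 0ℚ ≤ p → p ≤ q → p * p ≤ q * q
  square-mono-≤ 0≤p p≤q = ≤-trans (*-monoʳ 0≤p p≤q) (*-monoˡ (≤-trans 0≤p p≤q) p≤q)

  -- The spectral bound for N·B − Δ·J, where B is the incidence matrix of a design whose blocks
  -- have Δ points and pairwise meet in μ = Δ − σ points.
  module Spectral {m h : ℕ} (b : Fin m → Fin h → ℚ) {Δ μ σ : ℚ}
      (block-size : ∀ j → sum (λ i → b i j) ≡ Δ)
      (block-meet : ∀ j j′ → sum (λ i → b i j * b i j′) ≡ μ + δ j j′ * σ)
      (design : ι m * μ ≤ Δ * Δ) where

    private
      n : ℚ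
      n = ι m

    Q : Fin m → Fin h → ℚ
    Q i j = n * b i j - Δ

    module _ (z : Fin h → ℚ) where
      private
        S Z : ℚ
        S = sum z
        Z = sum (λ j → z j * z j)
        y : Fin m → ℚ
        y i = sum (λ j → b i j * z j)

      row : ∀ i → sum (λ j → Q i j * z j) ≡ n * y i - Δ * S
      row i = trans (sum-cong-≗ (λ j → lemma n (b i j) Δ (z j)))
        (trans (sum-- (λ j → n * (b i j * z j)) (λ j → Δ * z j))
          (cong₂ _-_ (sym (*-distribˡ-sum n (λ j → b i j * z j))) (sym (*-distribˡ-sum Δ z))))
        where
        lemma : ∀ n b d z → (n * b - d) * z ≡ n * (b * z) - d * z
        lemma = solve-∀ ℚ-ring

      sum-y : sum y ≡ Δ * S
      sum-y = begin
        sum (λ i → sum (λ j → b i j * z j))   ≡⟨ sum-interchange (λ i j → b i j) z ⟨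
        sum (λ j → sum (λ i → b i j) * z j)   ≡⟨ sum-cong-≗ (λ j → cong (_* z j) (block-size j)) ⟩
        sum (λ j → Δ * z j)                   ≡⟨ *-distribˡ-sum Δ z ⟨
        Δ * S                                 ∎
        where open ≡-Reasoning

      -- The quadratic form of BᵀB = μJ + σI, which is what `block-meet` states entrywise.
      sum-y² : sum (λ i → y i * y i) ≡ μ * (S * S) + σ * Z
      sum-y² = begin
        sum (λ i → y i * y i)
          ≡⟨ sum-cong-≗ (λ i → sum-*-sum (λ j → b i j * z j) (λ j′ → b i j′ * z j′)) ⟨
        sum (λ i → sum (λ j → sum (λ j′ → b i j * z j * (b i j′ * z j′))))
          ≡⟨ ∑-comm (λ i j → sum (λ j′ → b i j * z j * (b i j′ * z j′))) ⟩
        sum (λ j → sum (λ i → sum (λ j′ → b i j * z j * (b i j′ * z j′))))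
          ≡⟨ sum-cong-≗ (λ j → ∑-comm (λ i j′ → b i j * z j * (b i j′ * z j′))) ⟩
        sum (λ j → sum (λ j′ → sum (λ i → b i j * z j * (b i j′ * z j′))))
          ≡⟨ sum-cong-≗ (λ j → sum-cong-≗ (λ j′ → pair j j′)) ⟩
        sum (λ j → sum (λ j′ → μ * z j * z j′ + δ j j′ * (σ * (z j * z j′))))
          ≡⟨ sum-cong-≗ (λ j → trans (∑-distrib-+ (λ j′ → μ * z j * z j′) (λ j′ → δ j j′ * (σ * (z j * z j′))))
               (cong₂ _+_ (sym (*-distribˡ-sum (μ * z j) z)) (sum-δ j (λ j′ → σ * (z j * z j′))))) ⟩
        sum (λ j → μ * z j * S + σ * (z j * z j))
          ≡⟨ ∑-distrib-+ (λ j → μ * z j * S) (λ j → σ * (z j * z j)) ⟩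
        sum (λ j → μ * z j * S) + sum (λ j → σ * (z j * z j))
          ≡⟨ cong₂ _+_ (trans (sum-cong-≗ (λ j → lemma′ μ (z j) S)) (trans (sym (*-distribˡ-sum (μ * S) z)) (*-assoc μ S S)))
               (sym (*-distribˡ-sum σ (λ j → z j * z j))) ⟩
        μ * (S * S) + σ * Z ∎
        where
        open ≡-Reasoning
        lemma : ∀ b z b′ z′ → b * z * (b′ * z′) ≡ b * b′ * (z * z′)
        lemma = solve-∀ ℚ-ring
        lemma′ : ∀ μ z S → μ * z * S ≡ μ * S * z
        lemma′ = solve-∀ ℚ-ring
        expand : ∀ μ d σ z z′ → (μ + d * σ) * (z * z′) ≡ μ * z * z′ + d * (σ * (z * z′))
        expand = solve-∀ ℚ-ring
        pair : ∀ j j′ → sum (λ i → b i j * z j * (b i j′ * z j′)) ≡ μ * z j * z j′ + δ j j′ * (σ * (z j * z j′))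
        pair j j′ = trans (sum-cong-≗ (λ i → lemma (b i j) (z j) (b i j′) (z j′)))
          (trans (sym (*-distribʳ-sum (z j * z j′) (λ i → b i j * b i j′)))
            (trans (cong (_* (z j * z j′)) (block-meet j j′)) (expand μ (δ j j′) σ (z j) (z j′))))

      -- The left side equals n²σZ - n(Δ² - nμ)S² exactly, and `design` makes the subtracted term
      -- nonnegative.
      spectral : sum (λ i → sum (λ j → Q i j * z j) * sum (λ j → Q i j * z j)) ≤ n * n * σ * Z
      spectral = ≤-by (n * (Δ * Δ - n * μ) * (S * S)) (0≤* (0≤* (0≤ι m) (p≤q⇒0≤q-p design)) (0≤sq S)) (sym (begin
        sum (λ i → sum (λ j → Q i j * z j) * sum (λ j → Q i j * z j)) + n * (Δ * Δ - n * μ) * (S * S)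
          ≡⟨ cong (_+ n * (Δ * Δ - n * μ) * (S * S)) total ⟩
        (n * n * (μ * (S * S) + σ * Z) - (n * (Δ * S) + n * (Δ * S)) * (Δ * S) + n * (Δ * S * (Δ * S))) + n * (Δ * Δ - n * μ) * (S * S)
          ≡⟨ lemma n μ S σ Z Δ ⟩
        n * n * σ * Z ∎))
        where
        open ≡-Reasoning
        lemma : ∀ n μ S σ Z Δ →
          (n * n * (μ * (S * S) + σ * Z) - (n * (Δ * S) + n * (Δ * S)) * (Δ * S) + n * (Δ * S * (Δ * S))) + n * (Δ * Δ - n * μ) * (S * S) ≡ n * n * σ * Z
        lemma = solve-∀ ℚ-ring
        square : ∀ n y e → (n * y - e) * (n * y - e) ≡ (n * n * (y * y) - (n * e + n * e) * y) + e * e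
        square = solve-∀ ℚ-ring
        total : sum (λ i → sum (λ j → Q i j * z j) * sum (λ j → Q i j * z j)) ≡
          n * n * (μ * (S * S) + σ * Z) - (n * (Δ * S) + n * (Δ * S)) * (Δ * S) + n * (Δ * S * (Δ * S))
        total = begin
          sum (λ i → sum (λ j → Q i j * z j) * sum (λ j → Q i j * z j))
            ≡⟨ sum-cong-≗ (λ i → trans (cong (λ p → p * p) (row i)) (square n (y i) e)) ⟩
          sum (λ i → (n * n * (y i * y i) - (n * e + n * e) * y i) + e * e)
            ≡⟨ ∑-distrib-+ (λ i → n * n * (y i * y i) - (n * e + n * e) * y i) (λ _ → e * e) ⟩
          sum (λ i → n * n * (y i * y i) - (n * e + n * e) * y i) + sum {m} (λ _ → e * e)
            ≡⟨ cong₂ _+_ (trans (sum-- (λ i → n * n * (y i * y i)) (λ i → (n * e + n * e) * y i))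
                 (cong₂ _-_ (trans (sym (*-distribˡ-sum (n * n) (λ i → y i * y i))) (cong (n * n *_) sum-y²))
                   (trans (sym (*-distribˡ-sum (n * e + n * e) y)) (cong ((n * e + n * e) *_) sum-y))))
                 (sum-const m (e * e)) ⟩
          n * n * (μ * (S * S) + σ * Z) - (n * e + n * e) * e + n * (e * e) ∎
          where
          e = Δ * S

  -- The scaled vectors c j v j have energy close to N/r. The loss θ occurs twice: in `c-lower`,
  -- where a square root is approximated, and in `captured`, where the share of |y|² in the energy
  -- is discarded. Squaring turns this into the θ⁴ of `comparison`.
  module Comparison {N r h : ℕ} (Q : Fin (suc N) → Fin h → ℚ) (ι-h : ι h ≡ ι (suc N))
      (u : Fin (suc N) → Fin (suc r) → ℚ) (v : Fin h → Fin (suc r) → ℚ) (a : Fin (suc N) → ℚ) (c : Fin h → ℚ)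
      {Δ σ θ : ℚ} (0≤Δ : 0ℚ ≤ Δ) (0≤σ : 0ℚ ≤ σ) (0≤θ : 0ℚ ≤ θ)
      (spectral : ∀ (z : Fin h → ℚ) → sum (λ i → sum (λ j → Q i j * z j) * sum (λ j → Q i j * z j))
                          ≤ ι (suc N) * ι (suc N) * σ * sum (λ j → z j * z j))
      (isotropic : ∀ i y → ι (suc N) * (a i * a i * ((u i ∙ y) * (u i ∙ y)))
                             ≤ ι (suc r) * Rescaling.energy u (λ l → a l * a l) y)
      (c-upper : ∀ j → ι (suc r) * (c j * c j * Rescaling.energy u (λ l → a l * a l) (v j)) ≤ ι (suc N))
      (c-lower : ∀ j → θ * ι (suc N) ≤ ι (suc r) * (c j * c j * Rescaling.energy u (λ l → a l * a l) (v j)))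
      (captured : ∀ j → θ * Rescaling.energy u (λ l → a l * a l) (v j)
                          ≤ sum (λ l → a l * a l * ((u l ∙ v j) * (u l ∙ v j))))
      (aligned : ∀ i j → Δ * (a i * (c j * (u i ∙ v j)) * (a i * (c j * (u i ∙ v j)))) ≤ Q i j * (a i * (c j * (u i ∙ v j)))) where
    open Rescaling u

    private
      n r₊ : ℚ
      n = ι (suc N)
      r₊ = ι (suc r)

      A β : Fin h → ℚ
      A j = sum (λ l → a l * a l * ((u l ∙ v j) * (u l ∙ v j)))
      β j = energy (λ l → a l * a l) (v j)

      X : Fin (suc N) → Fin h → ℚ
      X i j = a i * (c j * (u i ∙ v j))

      L : ℚ
      L = sum (λ i → sum (λ j → Q i j * X i j))

    -- Column j contributes Σ x² = c² A j to the sum, at least θ times c² β j and hence at least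
    -- θ²n/r₊; `aligned` then exchanges Δx² for Qx.
    lower : Δ * θ * θ * (n * n) ≤ r₊ * L
    lower = begin
      Δ * θ * θ * (n * n)                                  ≡⟨ lemma Δ θ n ⟩
      n * (Δ * θ * (θ * n))                                ≡⟨ cong (_* (Δ * θ * (θ * n))) ι-h ⟨
      ι h * (Δ * θ * (θ * n))                              ≡⟨ sum-const h (Δ * θ * (θ * n)) ⟨
      sum {h} (λ _ → Δ * θ * (θ * n))                      ≤⟨ sum-mono-≤ column ⟩
      sum (λ j → r₊ * (Δ * (c j * c j) * A j))             ≡⟨ *-distribˡ-sum r₊ (λ j → Δ * (c j * c j) * A j) ⟨
      r₊ * sum (λ j → Δ * (c j * c j) * A j)               ≡⟨ cong (r₊ *_) (sum-cong-≗ (λ j → trans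
                                                                (*-distribˡ-sum (Δ * (c j * c j)) (λ i → a i * a i * ((u i ∙ v j) * (u i ∙ v j))))
                                                                (sum-cong-≗ (λ i → squares Δ (c j) (a i) (u i ∙ v j))))) ⟩
      r₊ * sum (λ j → sum (λ i → Δ * (X i j * X i j)))     ≡⟨ cong (r₊ *_) (∑-comm (λ j i → Δ * (X i j * X i j))) ⟩
      r₊ * sum (λ i → sum (λ j → Δ * (X i j * X i j)))     ≤⟨ *-monoʳ (0≤ι (suc r)) (sum-mono-≤ (λ i → sum-mono-≤ (λ j → aligned i j))) ⟩
      r₊ * L                                               ∎
      where
      open ≤-Reasoning
      lemma : ∀ Δ θ n → Δ * θ * θ * (n * n) ≡ n * (Δ * θ * (θ * n))
      lemma = solve-∀ ℚ-ring
      squares : ∀ Δ c a p → Δ * (c * c) * (a * a * (p * p)) ≡ Δ * (a * (c * p) * (a * (c * p)))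
      squares = solve-∀ ℚ-ring
      shuffle : ∀ Δ θ r c β → Δ * θ * (r * (c * c * β)) ≡ r * (Δ * (c * c)) * (θ * β)
      shuffle = solve-∀ ℚ-ring
      column : ∀ j → Δ * θ * (θ * n) ≤ r₊ * (Δ * (c j * c j) * A j)
      column j = begin
        Δ * θ * (θ * n)                          ≤⟨ *-monoʳ (0≤* 0≤Δ 0≤θ) (c-lower j) ⟩
        Δ * θ * (r₊ * (c j * c j * β j))         ≡⟨ shuffle Δ θ r₊ (c j) (β j) ⟩
        r₊ * (Δ * (c j * c j)) * (θ * β j)       ≤⟨ *-monoʳ (0≤* (0≤ι (suc r)) (0≤* 0≤Δ (0≤sq (c j)))) (captured j) ⟩
        r₊ * (Δ * (c j * c j)) * A j             ≡⟨ *-assoc r₊ (Δ * (c j * c j)) (A j) ⟩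
        r₊ * (Δ * (c j * c j) * A j)             ∎

    private
      -- Row i of Q applied to the vectors c j v j: the whole i-th row of `L` becomes one product
      -- with u i, to which `isotropic` applies.
      y : Fin (suc N) → Fin (suc r) → ℚ
      y i k = sum (λ j → Q i j * (c j * v j k))

    ∙-y : ∀ (x : Fin (suc r) → ℚ) i → x ∙ y i ≡ sum (λ j → Q i j * (c j * (x ∙ v j)))
    ∙-y x i = begin
      sum (λ k → x k * y i k)                                     ≡⟨ sum-cong-≗ (λ k → *-comm (x k) (y i k)) ⟩
      sum (λ k → y i k * x k)                                     ≡⟨ sum-interchange (λ j k → Q i j * (c j * v j k)) x ⟩
      sum (λ j → sum (λ k → Q i j * (c j * v j k) * x k))         ≡⟨ sum-cong-≗ (λ j → trans (sum-cong-≗ (λ k → lemma (Q i j) (c j) (v j k) (x k)))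
                                                                       (trans (sym (*-distribˡ-sum (Q i j * c j) (λ k → x k * v j k))) (*-assoc (Q i j) (c j) (x ∙ v j)))) ⟩
      sum (λ j → Q i j * (c j * (x ∙ v j)))                       ∎
      where
      open ≡-Reasoning
      lemma : ∀ q c v x → q * (c * v) * x ≡ q * c * (x * v)
      lemma = solve-∀ ℚ-ring

    L-row : ∀ i → sum (λ j → Q i j * X i j) ≡ a i * (u i ∙ y i)
    L-row i = trans (sum-cong-≗ (λ j → lemma (Q i j) (a i) (c j * (u i ∙ v j))))
      (trans (sym (*-distribˡ-sum (a i) (λ j → Q i j * (c j * (u i ∙ v j))))) (cong (a i *_) (sym (∙-y (u i) i))))
      where
      lemma : ∀ q a p → q * (a * p) ≡ a * (q * p)
      lemma = solve-∀ ℚ-ring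

    -- The energy is a sum of squares of linear functionals, namely a l u l and the coordinates.
    -- `spectral` applies to each one separately, with z the list of its values at the c j v j.
    total-energy : sum (λ i → energy (λ l → a l * a l) (y i)) ≤ n * n * σ * sum (λ j → c j * c j * β j)
    total-energy = begin
      sum (λ i → energy (λ l → a l * a l) (y i))
        ≡⟨ ∑-distrib-+ (λ i → sum (λ l → a l * a l * ((u l ∙ y i) * (u l ∙ y i)))) (λ i → y i ∙ y i) ⟩
      sum (λ i → sum (λ l → a l * a l * ((u l ∙ y i) * (u l ∙ y i)))) + sum (λ i → sum (λ k → y i k * y i k))
        ≡⟨ cong₂ _+_ (∑-comm (λ i l → a l * a l * ((u l ∙ y i) * (u l ∙ y i)))) (∑-comm (λ i k → y i k * y i k)) ⟩
      sum (λ l → sum (λ i → a l * a l * ((u l ∙ y i) * (u l ∙ y i)))) + sum (λ k → sum (λ i → y i k * y i k))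
        ≤⟨ +-mono-≤ (sum-mono-≤ weighted) (sum-mono-≤ (λ k → spectral (λ j → c j * v j k))) ⟩
      sum (λ l → K * sum (λ j → c j * c j * (a l * a l * ((u l ∙ v j) * (u l ∙ v j))))) + sum (λ k → K * sum (λ j → c j * v j k * (c j * v j k)))
        ≡⟨ cong₂ _+_ (*-distribˡ-sum K (λ l → sum (λ j → c j * c j * (a l * a l * ((u l ∙ v j) * (u l ∙ v j))))))
             (*-distribˡ-sum K (λ k → sum (λ j → c j * v j k * (c j * v j k)))) ⟨
      K * sum (λ l → sum (λ j → c j * c j * (a l * a l * ((u l ∙ v j) * (u l ∙ v j))))) + K * sum (λ k → sum (λ j → c j * v j k * (c j * v j k)))
        ≡⟨ cong₂ (λ p q → K * p + K * q)
             (trans (∑-comm (λ l j → c j * c j * (a l * a l * ((u l ∙ v j) * (u l ∙ v j)))))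
               (sum-cong-≗ (λ j → sym (*-distribˡ-sum (c j * c j) (λ l → a l * a l * ((u l ∙ v j) * (u l ∙ v j)))))))
             (trans (∑-comm (λ k j → c j * v j k * (c j * v j k)))
               (sum-cong-≗ (λ j → trans (sum-cong-≗ (λ k → square (c j) (v j k))) (sym (*-distribˡ-sum (c j * c j) (λ k → v j k * v j k)))))) ⟩
      K * sum (λ j → c j * c j * A j) + K * sum (λ j → c j * c j * (v j ∙ v j))
        ≡⟨ *-distribˡ-+ K (sum (λ j → c j * c j * A j)) (sum (λ j → c j * c j * (v j ∙ v j))) ⟨
      K * (sum (λ j → c j * c j * A j) + sum (λ j → c j * c j * (v j ∙ v j)))
        ≡⟨ cong (K *_) (trans (sym (∑-distrib-+ (λ j → c j * c j * A j) (λ j → c j * c j * (v j ∙ v j))))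
             (sum-cong-≗ (λ j → sym (*-distribˡ-+ (c j * c j) (A j) (v j ∙ v j))))) ⟩
      K * sum (λ j → c j * c j * β j) ∎
      where
      open ≤-Reasoning
      K : ℚ
      K = n * n * σ
      square : ∀ c v → c * v * (c * v) ≡ c * c * (v * v)
      square = solve-∀ ℚ-ring
      move : ∀ a c p → a * (c * p * (c * p)) ≡ c * c * (a * (p * p))
      move = solve-∀ ℚ-ring
      swap : ∀ a K s → a * (K * s) ≡ K * (a * s)
      swap = solve-∀ ℚ-ring
      weighted : ∀ l → sum (λ i → a l * a l * ((u l ∙ y i) * (u l ∙ y i))) ≤
        K * sum (λ j → c j * c j * (a l * a l * ((u l ∙ v j) * (u l ∙ v j))))
      weighted l = begin
        sum (λ i → a l * a l * ((u l ∙ y i) * (u l ∙ y i)))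
          ≡⟨ *-distribˡ-sum (a l * a l) (λ i → (u l ∙ y i) * (u l ∙ y i)) ⟨
        a l * a l * sum (λ i → (u l ∙ y i) * (u l ∙ y i))
          ≡⟨ cong (a l * a l *_) (sum-cong-≗ (λ i → cong (λ p → p * p) (∙-y (u l) i))) ⟩
        a l * a l * sum (λ i → sum (λ j → Q i j * (c j * (u l ∙ v j))) * sum (λ j → Q i j * (c j * (u l ∙ v j))))
          ≤⟨ *-monoʳ (0≤sq (a l)) (spectral (λ j → c j * (u l ∙ v j))) ⟩
        a l * a l * (K * sum (λ j → c j * (u l ∙ v j) * (c j * (u l ∙ v j))))
          ≡⟨ swap (a l * a l) K (sum (λ j → c j * (u l ∙ v j) * (c j * (u l ∙ v j)))) ⟩
        K * (a l * a l * sum (λ j → c j * (u l ∙ v j) * (c j * (u l ∙ v j))))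
          ≡⟨ cong (K *_) (trans (*-distribˡ-sum (a l * a l) (λ j → c j * (u l ∙ v j) * (c j * (u l ∙ v j))))
               (sum-cong-≗ (λ j → move (a l * a l) (c j) (u l ∙ v j)))) ⟩
        K * sum (λ j → c j * c j * (a l * a l * ((u l ∙ v j) * (u l ∙ v j)))) ∎

    -- The factor r₊ brought in by `isotropic` is absorbed by `c-upper`, so r enters `comparison`
    -- only through `lower`.
    upper : L * L ≤ n * n * σ * (n * n)
    upper = begin
      L * L
        ≤⟨ sum-square-≤ (λ i → sum (λ j → Q i j * X i j)) ⟩
      n * sum (λ i → sum (λ j → Q i j * X i j) * sum (λ j → Q i j * X i j))
        ≡⟨ *-distribˡ-sum n (λ i → sum (λ j → Q i j * X i j) * sum (λ j → Q i j * X i j)) ⟩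
      sum (λ i → n * (sum (λ j → Q i j * X i j) * sum (λ j → Q i j * X i j)))
        ≡⟨ sum-cong-≗ (λ i → cong (n *_) (trans (cong (λ p → p * p) (L-row i)) (square (a i) (u i ∙ y i)))) ⟩
      sum (λ i → n * (a i * a i * ((u i ∙ y i) * (u i ∙ y i))))
        ≤⟨ sum-mono-≤ (λ i → isotropic i (y i)) ⟩
      sum (λ i → r₊ * energy (λ l → a l * a l) (y i))
        ≡⟨ *-distribˡ-sum r₊ (λ i → energy (λ l → a l * a l) (y i)) ⟨
      r₊ * sum (λ i → energy (λ l → a l * a l) (y i))
        ≤⟨ *-monoʳ (0≤ι (suc r)) total-energy ⟩
      r₊ * (n * n * σ * sum (λ j → c j * c j * β j))
        ≡⟨ swap r₊ (n * n * σ) (sum (λ j → c j * c j * β j)) ⟩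
      n * n * σ * (r₊ * sum (λ j → c j * c j * β j))
        ≡⟨ cong (n * n * σ *_) (*-distribˡ-sum r₊ (λ j → c j * c j * β j)) ⟩
      n * n * σ * sum (λ j → r₊ * (c j * c j * β j))
        ≤⟨ *-monoʳ (0≤* (0≤sq n) 0≤σ) (sum-mono-≤ c-upper) ⟩
      n * n * σ * sum {h} (λ _ → n)
        ≡⟨ cong (n * n * σ *_) (trans (sum-const h n) (cong (_* n) ι-h)) ⟩
      n * n * σ * (n * n) ∎
      where
      open ≤-Reasoning
      square : ∀ c v → c * v * (c * v) ≡ c * c * (v * v)
      square = solve-∀ ℚ-ring
      swap : ∀ a K s → a * (K * s) ≡ K * (a * s)
      swap = solve-∀ ℚ-ring

    comparison : Δ * Δ * (θ * θ * (θ * θ)) ≤ r₊ * r₊ * σ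
    comparison = *-cancel-≤ (0<* (0<* 0<n 0<n) (0<* 0<n 0<n)) (begin
      n * n * (n * n) * (Δ * Δ * (θ * θ * (θ * θ)))         ≡⟨ lemma n Δ θ ⟩
      Δ * θ * θ * (n * n) * (Δ * θ * θ * (n * n))           ≤⟨ square-mono-≤ (0≤* (0≤* (0≤* 0≤Δ 0≤θ) 0≤θ) (0≤sq n)) lower ⟩
      r₊ * L * (r₊ * L)                                     ≡⟨ lemma′ r₊ L ⟩
      r₊ * r₊ * (L * L)                                     ≤⟨ *-monoʳ (0≤sq r₊) upper ⟩
      r₊ * r₊ * (n * n * σ * (n * n))                       ≡⟨ lemma″ r₊ n σ ⟩
      n * n * (n * n) * (r₊ * r₊ * σ)                       ∎)
      where
      open ≤-Reasoning
      0<n : 0ℚ < n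
      0<n = 0<ι-suc N
      lemma : ∀ n Δ θ → n * n * (n * n) * (Δ * Δ * (θ * θ * (θ * θ))) ≡ Δ * θ * θ * (n * n) * (Δ * θ * θ * (n * n))
      lemma = solve-∀ ℚ-ring
      lemma′ : ∀ r L → r * L * (r * L) ≡ r * r * (L * L)
      lemma′ = solve-∀ ℚ-ring
      lemma″ : ∀ r n σ → r * r * (n * n * σ * (n * n)) ≡ n * n * (n * n) * (r * r * σ)
      lemma″ = solve-∀ ℚ-ring

  -- Rational approximation of an inverse square root

  module ApproximateRoot {ρ θ : ℚ} (0<ρ : 0ℚ < ρ) (0≤θ : 0ℚ ≤ θ) (θ<1 : θ < 1ℚ) where

    private
      value : ℚ → ℚ
      value x = x * x * ρ

    last-below : ∀ s m → 1ℚ < value (ι m * s) → ∃[ k ] (value (ι k * s) ≤ 1ℚ × 1ℚ < value (ι (suc k) * s))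
    last-below s zero    above = contradiction (<-trans above (subst (_< 1ℚ) (sym (lemma s ρ)) 0<1)) (<-irrefl refl)
      where
      lemma : ∀ s ρ → 0ℚ * s * (0ℚ * s) * ρ ≡ 0ℚ
      lemma = solve-∀ ℚ-ring
    last-below s (suc m) above = by-cases (value (ι m * s) ≤? 1ℚ)
      where
      by-cases : Dec (value (ι m * s) ≤ 1ℚ) → ∃[ k ] (value (ι k * s) ≤ 1ℚ × 1ℚ < value (ι (suc k) * s))
      by-cases (yes below) = m , below , above
      by-cases (no  ¬below) = last-below s m (≰⇒> ¬below)

    eventually-above : ∀ {s} → 0ℚ < s → ∃[ m ] 1ℚ < value (ι m * s)
    eventually-above {s} 0<s = let i , 0<i , ρ*i = reciprocal 0<ρ ; m , big = archimedean-* 0<s (1ℚ + i) in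
      m , <-≤-trans (<-by (ρ + 1ℚ + i) (positive-sum (<⇒≤ 0<i)) (trans (expand ρ i) (trans (cong (λ q → ρ + (q + q) + q * i) ρ*i) (tidy ρ i))))
        (*-monoˡ (<⇒≤ 0<ρ) (square-mono-≤ (0≤+ 0≤1 (<⇒≤ 0<i)) (<⇒≤ big)))
      where
      expand : ∀ ρ i → (1ℚ + i) * (1ℚ + i) * ρ ≡ ρ + (ρ * i + ρ * i) + ρ * i * i
      expand = solve-∀ ℚ-ring
      tidy : ∀ ρ i → ρ + (1ℚ + 1ℚ) + 1ℚ * i ≡ 1ℚ + (ρ + 1ℚ + i)
      tidy = solve-∀ ℚ-ring
      positive-sum : ∀ {i} → 0ℚ ≤ i → 0ℚ < ρ + 1ℚ + i
      positive-sum 0≤i = +-mono-<-≤ (+-mono-< 0<ρ 0<1) 0≤i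

    -- A stand-in for 1/√ρ: among the multiples of a small step s, one with value at most 1 whose
    -- successor exceeds 1.
    approximate-root : ∃[ x ] (0ℚ ≤ x × θ ≤ x * x * ρ × x * x * ρ ≤ 1ℚ)
    approximate-root =
      let s , 0<s , E*s = divide 0<E (p<q⇒0<q-p θ<1)
          m , above = eventually-above 0<s
          k , below , above′ = last-below s m above
      in ι k * s , 0≤* (0≤ι k) (<⇒≤ 0<s) , close {ι k * s} (<⇒≤ 0<s) E*s below (subst (λ x → 1ℚ < x * x * ρ) (next (ι k) s) above′) , below
      where
      E : ℚ
      -- Passing from x to x + s changes the value by s(2xρ + sρ). Here 2xρ ≤ x²ρ + ρ ≤ 1 + ρ and s
      -- ≤ 1, so the change is at most s(1 + 2ρ), which the choice of s makes equal to 1 - θ.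
      E = 1ℚ + ρ + ρ
      0<E : 0ℚ < E
      0<E = +-mono-< (+-mono-< 0<1 0<ρ) 0<ρ
      next : ∀ k s → (1ℚ + k) * s ≡ k * s + s
      next = solve-∀ ℚ-ring
      s≤1 : ∀ {s} → 0ℚ ≤ s → E * s ≡ 1ℚ - θ → s ≤ 1ℚ
      s≤1 {s} 0≤s E*s = ≤-by ((ρ + ρ) * s + θ) (0≤+ (0≤* (0≤+ (<⇒≤ 0<ρ) (<⇒≤ 0<ρ)) 0≤s) 0≤θ)
        (trans (back θ) (trans (cong (_+ θ) (sym E*s)) (lemma ρ s θ)))
        where
        back : ∀ θ → 1ℚ ≡ 1ℚ - θ + θ
        back = solve-∀ ℚ-ring
        lemma : ∀ ρ s θ → (1ℚ + ρ + ρ) * s + θ ≡ s + ((ρ + ρ) * s + θ)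
        lemma = solve-∀ ℚ-ring
      close : ∀ {x s} → 0ℚ ≤ s → E * s ≡ 1ℚ - θ → x * x * ρ ≤ 1ℚ → 1ℚ < (x + s) * (x + s) * ρ → θ ≤ x * x * ρ
      close {x} {s} 0≤s E*s below above = ≤-by _ (0≤+ (p≤q⇒0≤q-p (<⇒≤ above))
          (0≤* 0≤s (0≤+ (0≤+ (p≤q⇒0≤q-p below) (0≤* (0≤sq (x - 1ℚ)) (<⇒≤ 0<ρ))) (0≤* (<⇒≤ 0<ρ) (p≤q⇒0≤q-p (s≤1 0≤s E*s))))))
        (trans (lemma x s ρ) (trans (cong (λ e → (1ℚ - e) + slack) E*s) (cancel θ slack)))
        where
        slack : ℚ
        slack = ((x + s) * (x + s) * ρ - 1ℚ) + s * ((1ℚ - x * x * ρ) + (x - 1ℚ) * (x - 1ℚ) * ρ + ρ * (1ℚ - s))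
        lemma : ∀ x s ρ → x * x * ρ ≡ (1ℚ - (1ℚ + ρ + ρ) * s) +
          (((x + s) * (x + s) * ρ - 1ℚ) + s * ((1ℚ - x * x * ρ) + (x - 1ℚ) * (x - 1ℚ) * ρ + ρ * (1ℚ - s)))
        lemma = solve-∀ ℚ-ring
        cancel : ∀ θ e → (1ℚ - (1ℚ - θ)) + e ≡ θ + e
        cancel = solve-∀ ℚ-ring

  -- From a sign realisation to the approximate bound

  hasSign⇒0<sq : ∀ s {p} → hasSign s p → 0ℚ < p * p
  hasSign⇒0<sq Sign.+ 0<p = 0<* 0<p 0<p
  hasSign⇒0<sq Sign.- {p} p<0 = subst (0ℚ <_) (lemma p) (0<* (neg-antimono-< p<0) (neg-antimono-< p<0))
    where
    lemma : ∀ p → (- p) * (- p) ≡ p * p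
    lemma = solve-∀ ℚ-ring

  square≤1⇒square≤ : ∀ {x} → 0ℚ ≤ x → x * x ≤ 1ℚ → x * x ≤ x
  square≤1⇒square≤ {x} 0≤x x²≤1 = ≤-trans (*-monoʳ 0≤x x≤1) (≤-reflexive (*-identityʳ x))
    where
    x≤1 : x ≤ 1ℚ
    x≤1 with x ≤? 1ℚ
    ... | yes x≤1 = x≤1
    ... | no x≰1 = contradiction (<-≤-trans (≰⇒> x≰1) (≤-trans (≤-trans (≤-reflexive (sym (*-identityʳ x))) (*-monoʳ 0≤x (<⇒≤ (≰⇒> x≰1)))) x²≤1)) (<-irrefl refl)

  module Realisation {N r h : ℕ} (B : Fin (suc N) → Fin h → Bool) (ι-h : ι h ≡ ι (suc N)) {Δ μ σ : ℚ}
      (0≤Δ : 0ℚ ≤ Δ) (0≤σ : 0ℚ ≤ σ) (2Δ≤n : Δ + Δ ≤ ι (suc N))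
      (block-size : ∀ j → sum (λ i → if B i j then 1ℚ else 0ℚ) ≡ Δ)
      (block-meet : ∀ j j′ → sum (λ i → (if B i j then 1ℚ else 0ℚ) * (if B i j′ then 1ℚ else 0ℚ)) ≡ μ + δ j j′ * σ)
      (design : ι (suc N) * μ ≤ Δ * Δ)
      (u : Fin (suc N) → Fin (suc r) → ℚ) (v : Fin h → Fin (suc r) → ℚ)
      (realises : ∀ i j → hasSign (if B i j then Sign.+ else Sign.-) (u i ∙ v j)) where
    open Rescaling u
    open Spectral (λ i j → if B i j then 1ℚ else 0ℚ) block-size block-meet design using (Q; spectral)

    private
      n r₊ : ℚ
      n = ι (suc N)
      r₊ = ι (suc r)

    module _ {θ : ℚ} (0≤θ : 0ℚ ≤ θ) (θ<1 : θ < 1ℚ) where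

      -- A threshold beyond which a single a_i makes the |y|² term of the energy negligible on every v_j.
      threshold : ∃[ T ] (1ℚ ≤ T × ∀ i j → v j ∙ v j ≤ (1ℚ - θ) * (T * ((u i ∙ v j) * (u i ∙ v j))))
      threshold = 1ℚ + total , ≤-by total 0≤total refl , bound
        where
        e : Fin (suc N) → Fin h → ℚ
        e i j = (1ℚ - θ) * ((u i ∙ v j) * (u i ∙ v j))
        0<e : ∀ i j → 0ℚ < e i j
        0<e i j = 0<* (p<q⇒0<q-p θ<1) (hasSign⇒0<sq (if B i j then Sign.+ else Sign.-) (realises i j))
        x : Fin (suc N) → Fin h → ℚ
        x i j = proj₁ (reciprocal (0<e i j)) * (v j ∙ v j)
        0≤x : ∀ i j → 0ℚ ≤ x i j
        0≤x i j = 0≤* (<⇒≤ (proj₁ (proj₂ (reciprocal (0<e i j))))) (0≤x∙x (v j))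
        total : ℚ
        total = sum (λ i → sum (x i))
        0≤total : 0ℚ ≤ total
        0≤total = 0≤sum (λ i → 0≤sum (0≤x i))
        bound : ∀ i j → v j ∙ v j ≤ (1ℚ - θ) * ((1ℚ + total) * ((u i ∙ v j) * (u i ∙ v j)))
        bound i j = begin
          v j ∙ v j                                                ≡⟨ *-identityˡ (v j ∙ v j) ⟨
          1ℚ * (v j ∙ v j)                                         ≡⟨ cong (_* (v j ∙ v j)) (proj₂ (proj₂ (reciprocal (0<e i j)))) ⟨
          e i j * proj₁ (reciprocal (0<e i j)) * (v j ∙ v j)       ≡⟨ *-assoc (e i j) (proj₁ (reciprocal (0<e i j))) (v j ∙ v j) ⟩
          e i j * x i j                                            ≤⟨ *-monoʳ (<⇒≤ (0<e i j)) x≤ ⟩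
          e i j * (1ℚ + total)             ≡⟨ lemma (1ℚ - θ) ((u i ∙ v j) * (u i ∙ v j)) (1ℚ + total) ⟩
          (1ℚ - θ) * ((1ℚ + total) * ((u i ∙ v j) * (u i ∙ v j))) ∎
          where
          open ≤-Reasoning
          lemma : ∀ a b c → a * b * c ≡ a * (c * b)
          lemma = solve-∀ ℚ-ring
          x≤ : x i j ≤ 1ℚ + total
          x≤ = ≤-trans (term≤sum (0≤x i) j) (≤-trans (term≤sum (λ i → 0≤sum (0≤x i)) i) (≤-by 1ℚ 0≤1 (+-comm 1ℚ total)))

      module _ {T : ℚ} (1≤T : 1ℚ ≤ T)
          (negligible : ∀ i j → v j ∙ v j ≤ (1ℚ - θ) * (T * ((u i ∙ v j) * (u i ∙ v j))))
          {a : Fin (suc N) → ℚ} (0≤a : ∀ i → 0ℚ ≤ a i) (tall : ∃[ i ] T < a i)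
          (isotropic : ∀ i y → n * (a i * a i * ((u i ∙ y) * (u i ∙ y))) ≤ r₊ * energy (λ l → a l * a l) y) where

        private
          A β : Fin h → ℚ
          A j = sum (λ l → a l * a l * ((u l ∙ v j) * (u l ∙ v j)))
          β j = energy (λ l → a l * a l) (v j)

          i₀ : Fin (suc N)
          i₀ = proj₁ tall

          m² : Fin h → ℚ
          m² j = (u i₀ ∙ v j) * (u i₀ ∙ v j)

          T≤a² : T ≤ a i₀ * a i₀
          T≤a² = ≤-trans (≤-reflexive (sym (*-identityʳ T)))
            (≤-trans (*-monoʳ (≤-trans 0≤1 1≤T) 1≤T) (square-mono-≤ (≤-trans 0≤1 1≤T) (<⇒≤ (proj₂ tall))))

          T*m²≤A : ∀ j → T * m² j ≤ A j
          T*m²≤A j = ≤-trans (*-monoˡ (0≤sq (u i₀ ∙ v j)) T≤a²)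
            (term≤sum (λ l → 0≤* (0≤sq (a l)) (0≤sq (u l ∙ v j))) i₀)

        -- The one weight beyond T already makes (1 - θ) `A j` at least v j ∙ v j, so dropping |y|²
        -- from the energy costs no more than the factor θ.
        captured : ∀ j → θ * β j ≤ A j
        captured j = begin
          θ * (A j + v j ∙ v j)              ≡⟨ *-distribˡ-+ θ (A j) (v j ∙ v j) ⟩
          θ * A j + θ * (v j ∙ v j)          ≤⟨ +-monoʳ-≤ (θ * A j) (≤-trans (*-monoˡ (0≤x∙x (v j)) (<⇒≤ θ<1)) (≤-reflexive (*-identityˡ (v j ∙ v j)))) ⟩
          θ * A j + v j ∙ v j                ≤⟨ +-monoʳ-≤ (θ * A j) (≤-trans (negligible i₀ j) (*-monoʳ (p≤q⇒0≤q-p (<⇒≤ θ<1)) (T*m²≤A j))) ⟩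
          θ * A j + (1ℚ - θ) * A j           ≡⟨ lemma θ (A j) ⟩
          A j                                ∎
          where
          open ≤-Reasoning
          lemma : ∀ θ a → θ * a + (1ℚ - θ) * a ≡ a
          lemma = solve-∀ ℚ-ring

        0<β : ∀ j → 0ℚ < β j
        0<β j = <-≤-trans (0<* (<-≤-trans 0<1 1≤T) (hasSign⇒0<sq (if B i₀ j then Sign.+ else Sign.-) (realises i₀ j)))
          (≤-trans (T*m²≤A j) (≤-by (v j ∙ v j) (0≤x∙x (v j)) refl))

        -- The ideal scale √(n/(r₊ β j)) may be irrational. It is approached from below, so that
        -- `X²≤1` holds without loss and only the lower estimate pays θ.
        normaliser : ∀ j → ∃[ c ] (0ℚ ≤ c × θ * n ≤ r₊ * (c * c * β j) × r₊ * (c * c * β j) ≤ n)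
        normaliser j =
          let ρ , 0<ρ , n*ρ = divide (0<ι-suc N) (0<* (0<ι-suc r) (0<β j))
              c , 0≤c , lo , hi = ApproximateRoot.approximate-root 0<ρ 0≤θ θ<1
              scale : n * (c * c * ρ) ≡ r₊ * (c * c * β j)
              scale = trans (lemma n c ρ) (trans (cong (c * c *_) n*ρ) (lemma′ c r₊ (β j)))
          in c , 0≤c
            , ≤-trans (≤-reflexive (*-comm θ n)) (≤-trans (*-monoʳ (0≤ι (suc N)) lo) (≤-reflexive scale))
            , ≤-trans (≤-reflexive (sym scale)) (≤-trans (*-monoʳ (0≤ι (suc N)) hi) (≤-reflexive (*-identityʳ n)))
          where
          lemma : ∀ n c ρ → n * (c * c * ρ) ≡ c * c * (n * ρ)
          lemma = solve-∀ ℚ-ring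
          lemma′ : ∀ c r β → c * c * (r * β) ≡ r * (c * c * β)
          lemma′ = solve-∀ ℚ-ring

        module _ {c : Fin h → ℚ} (0≤c : ∀ j → 0ℚ ≤ c j) (c-upper : ∀ j → r₊ * (c j * c j * β j) ≤ n) where

          X²≤1 : ∀ i j → let x = a i * (c j * (u i ∙ v j)) in x * x ≤ 1ℚ
          X²≤1 i j = *-cancel-≤ (0<ι-suc N) (begin
            n * (a i * (c j * (u i ∙ v j)) * (a i * (c j * (u i ∙ v j))))     ≡⟨ lemma n (a i) (c j) (u i ∙ v j) ⟩
            c j * c j * (n * (a i * a i * ((u i ∙ v j) * (u i ∙ v j))))       ≤⟨ *-monoʳ (0≤sq (c j)) (isotropic i (v j)) ⟩
            c j * c j * (r₊ * β j)                                            ≡⟨ lemma′ (c j) r₊ (β j) ⟩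
            r₊ * (c j * c j * β j)                                            ≤⟨ c-upper j ⟩
            n                                                                 ≡⟨ *-identityʳ n ⟨
            n * 1ℚ                                                            ∎)
            where
            open ≤-Reasoning
            lemma : ∀ n a c p → n * (a * (c * p) * (a * (c * p))) ≡ c * c * (n * (a * a * (p * p)))
            lemma = solve-∀ ℚ-ring
            lemma′ : ∀ c r β → c * c * (r * β) ≡ r * (c * c * β)
            lemma′ = solve-∀ ℚ-ring

          -- x has the sign of the entry of Q or vanishes, and |x| ≤ 1 gives x² ≤ |x|. The entry is
          -- -Δ off the blocks and n - Δ ≥ Δ on them, the latter by `2Δ≤n`.
          aligned : ∀ i j → let x = a i * (c j * (u i ∙ v j)) in Δ * (x * x) ≤ Q i j * x
          aligned i j = by-sign (B i j) (realises i j)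
            where
            x : ℚ
            x = a i * (c j * (u i ∙ v j))
            by-sign : ∀ s → hasSign (if s then Sign.+ else Sign.-) (u i ∙ v j) → Δ * (x * x) ≤ (n * (if s then 1ℚ else 0ℚ) - Δ) * x
            by-sign true 0<p = ≤-trans (*-monoʳ 0≤Δ (square≤1⇒square≤ 0≤x (X²≤1 i j)))
              (≤-by ((n - (Δ + Δ)) * x) (0≤* (p≤q⇒0≤q-p 2Δ≤n) 0≤x) (lemma n Δ x))
              where
              0≤x : 0ℚ ≤ x
              0≤x = 0≤* (0≤a i) (0≤* (0≤c j) (<⇒≤ 0<p))
              lemma : ∀ n Δ x → (n * 1ℚ - Δ) * x ≡ Δ * x + (n - (Δ + Δ)) * x
              lemma = solve-∀ ℚ-ring
            by-sign false p<0 = ≤-trans (≤-reflexive (cong (Δ *_) (sym (square x)))) (≤-trans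
                (*-monoʳ 0≤Δ (square≤1⇒square≤ 0≤-x (subst (_≤ 1ℚ) (sym (square x)) (X²≤1 i j)))) (≤-reflexive (lemma n Δ x)))
              where
              square : ∀ x → (- x) * (- x) ≡ x * x
              square = solve-∀ ℚ-ring
              lemma : ∀ n Δ x → Δ * (- x) ≡ (n * 0ℚ - Δ) * x
              lemma = solve-∀ ℚ-ring
              negate : ∀ a c p → a * (c * (- p)) ≡ - (a * (c * p))
              negate = solve-∀ ℚ-ring
              0≤-x : 0ℚ ≤ - x
              0≤-x = subst (0ℚ ≤_) (negate (a i) (c j) (u i ∙ v j))
                (0≤* (0≤a i) (0≤* (0≤c j) (<⇒≤ (neg-antimono-< p<0))))

        bound-by-normaliser : (∀ j → ∃[ c ] (0ℚ ≤ c × θ * n ≤ r₊ * (c * c * β j) × r₊ * (c * c * β j) ≤ n)) →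
          Δ * Δ * (θ * θ * (θ * θ)) ≤ r₊ * r₊ * σ
        bound-by-normaliser norm = Comparison.comparison Q ι-h u v a (λ j → proj₁ (norm j)) 0≤Δ 0≤σ 0≤θ spectral isotropic
          (λ j → proj₂ (proj₂ (proj₂ (norm j)))) (λ j → proj₁ (proj₂ (proj₂ (norm j)))) captured
          (aligned (λ j → proj₁ (proj₂ (norm j))) (λ j → proj₂ (proj₂ (proj₂ (norm j)))))

      approximate-bound : Δ * Δ * (θ * θ * (θ * θ)) ≤ r₊ * r₊ * σ
      approximate-bound = by-threshold threshold
        where
        by-threshold : ∃[ T ] (1ℚ ≤ T × ∀ i j → v j ∙ v j ≤ (1ℚ - θ) * (T * ((u i ∙ v j) * (u i ∙ v j)))) → _
        by-threshold (T , 1≤T , negligible) = by-weights (Greedy.nearly-isotropic u (≤-trans 0≤1 1≤T))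
          where
          by-weights : ∃[ a ] ((∀ i → 0ℚ ≤ a i) × (∃[ i ] T < a i) ×
            (∀ i y → n * (a i * a i * ((u i ∙ y) * (u i ∙ y))) ≤ r₊ * energy (λ l → a l * a l) y)) → _
          by-weights (a , 0≤a , tall , isotropic) = bound-by-normaliser 1≤T negligible 0≤a tall isotropic
            (normaliser 1≤T negligible 0≤a tall isotropic)

  -- If the integer inequality failed, the gap D - R would be at least 1. Taking θ = 1 - e with e =
  -- 1/(1 + 4D), Bernoulli's θ⁴ ≥ 1 - 4e bounds the loss D - Dθ⁴ by 1 - e, a contradiction.
  limit-bound : ∀ Δ r σ → (∀ θ → 0ℚ ≤ θ → θ < 1ℚ → ι Δ * ι Δ * (θ * θ * (θ * θ)) ≤ ι r * ι r * ι σ) →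
    Δ ℕ.* Δ ℕ.≤ r ℕ.* r ℕ.* σ
  limit-bound Δ r σ bound = by-cases (Δ ℕ.* Δ ℕ.≤? r ℕ.* r ℕ.* σ)
    where
    D R : ℚ
    D = ι Δ * ι Δ
    R = ι r * ι r * ι σ
    0≤D : 0ℚ ≤ D
    0≤D = 0≤sq (ι Δ)
    impossible : 1ℚ + R ≤ D → ∃[ e ] (0ℚ < e × (1ℚ + (D + D + (D + D))) * e ≡ 1ℚ) → Empty
    impossible gap (e , 0<e , eq) = <-irrefl refl (<-≤-trans (<-by e 0<e refl) (≤-trans D+e≤ gap))
      where
      0≤4D : 0ℚ ≤ D + D + (D + D)
      0≤4D = 0≤+ (0≤+ 0≤D 0≤D) (0≤+ 0≤D 0≤D)
      e≤1 : e ≤ 1ℚ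
      e≤1 = ≤-by ((D + D + (D + D)) * e) (0≤* 0≤4D (<⇒≤ 0<e)) (trans (sym eq) (lemma (D + D + (D + D)) e))
        where
        lemma : ∀ x e → (1ℚ + x) * e ≡ e + x * e
        lemma = solve-∀ ℚ-ring
      θ : ℚ
      θ = 1ℚ - e
      back : ∀ e → 1ℚ ≡ (1ℚ - e) + e
      back = solve-∀ ℚ-ring
      bernoulli : ∀ D e → (1ℚ + (D + D + (D + D))) * e + D * ((1ℚ - e) * (1ℚ - e) * ((1ℚ - e) * (1ℚ - e)))
        ≡ (D + e) + D * (e * e * ((1ℚ + 1ℚ) + (1ℚ + 1ℚ - e) * (1ℚ + 1ℚ - e)))
      bernoulli = solve-∀ ℚ-ring
      D+e≤ : D + e ≤ 1ℚ + R
      D+e≤ = ≤-trans (≤-by (D * (e * e * ((1ℚ + 1ℚ) + (1ℚ + 1ℚ - e) * (1ℚ + 1ℚ - e))))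
          (0≤* 0≤D (0≤* (0≤sq e) (0≤+ (0≤+ 0≤1 0≤1) (0≤sq (1ℚ + 1ℚ - e)))))
          (trans (cong (_+ D * (θ * θ * (θ * θ))) (sym eq)) (bernoulli D e)))
        (+-monoʳ-≤ 1ℚ (bound θ (p≤q⇒0≤q-p e≤1) (<-by e 0<e (back e))))
    by-cases : Dec (Δ ℕ.* Δ ℕ.≤ r ℕ.* r ℕ.* σ) → Δ ℕ.* Δ ℕ.≤ r ℕ.* r ℕ.* σ
    by-cases (yes le) = le
    by-cases (no ¬le) = contradiction (reciprocal (<-≤-trans 0<1 (≤-by (D + D + (D + D)) (0≤+ (0≤+ 0≤D 0≤D) (0≤+ 0≤D 0≤D)) refl)))
      (impossible (subst₂ _≤_ (cong (1ℚ +_) (trans (ι-* (r ℕ.* r) σ) (cong (_* ι σ) (ι-* r r)))) (ι-* Δ Δ)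
        (ι-mono-≤ (ℕ.≰⇒> ¬le))))

  -- The bound for symmetric designs, over the natural numbers

  ι-bit : ∀ b → ι (bit b) ≡ (if b then 1ℚ else 0ℚ)
  ι-bit true  = refl
  ι-bit false = refl

  ι-sum : ∀ {n} (f : Fin n → ℕ) → ι (sumℕ f) ≡ sum (ι ∘ f)
  ι-sum {zero}  f = refl
  ι-sum {suc n} f = trans (ι-+ (f fzero) (sumℕ (f ∘ fsuc))) (cong (ι (f fzero) +_) (ι-sum (f ∘ fsuc)))

  sumℚ≡sum : ∀ r (f : Fin r → ℚ) → sumℚ r f ≡ sum f
  sumℚ≡sum zero    f = refl
  sumℚ≡sum (suc r) f = cong (f fzero +_) (sumℚ≡sum r (f ∘ fsuc))

  bit-idem : ∀ b → bit b ℕ.* bit b ≡ bit b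
  bit-idem true  = refl
  bit-idem false = refl

  symmetric-design-sign-rank : ∀ {m h} (B : Fin m → Fin h → Bool) {Δ μ σ : ℕ} → m ≢ 0 → h ≡ m →
    (∀ j → sumℕ (λ i → bit (B i j)) ≡ Δ) →
    (∀ j j′ → j ≢ j′ → sumℕ (λ i → bit (B i j) ℕ.* bit (B i j′)) ≡ μ) →
    Δ ≡ μ ℕ.+ σ → m ℕ.* μ ℕ.≤ Δ ℕ.* Δ → Δ ℕ.+ Δ ℕ.≤ m →
    ∀ r → SignRealizable (λ i j → if B i j then Sign.+ else Sign.-) r → Δ ℕ.* Δ ℕ.≤ r ℕ.* r ℕ.* σ
  symmetric-design-sign-rank {zero} B m≢0 = contradiction refl m≢0
  -- In dimension 0 all products vanish and so have no sign; the greedy construction relies on a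
  -- first coordinate.
  symmetric-design-sign-rank {suc N} {suc h} B m≢0 h≡m size meet Δ≡ design 2Δ≤m zero (u , v , realises) =
    contradiction (realises fzero fzero) (no-sign (B fzero fzero))
    where
    no-sign : ∀ b → ¬ hasSign (if b then Sign.+ else Sign.-) 0ℚ
    no-sign true  = <-irrefl refl
    no-sign false = <-irrefl refl
  symmetric-design-sign-rank {suc N} {h} B {Δ} {μ} {σ} m≢0 h≡m size meet Δ≡ design 2Δ≤m (suc r) (u , v , realises) =
    limit-bound Δ (suc r) σ (λ θ 0≤θ θ<1 → Realisation.approximate-bound B (cong ι h≡m) (0≤ι Δ) (0≤ι σ)
      (subst (_≤ ι (suc N)) (ι-+ Δ Δ) (ι-mono-≤ 2Δ≤m)) size′ meet′
      (subst₂ _≤_ (ι-* (suc N) μ) (ι-* Δ Δ) (ι-mono-≤ design)) u v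
      (λ i j → subst (hasSign (if B i j then Sign.+ else Sign.-)) (sumℚ≡sum (suc r) (λ k → u i k * v j k)) (realises i j)) 0≤θ θ<1)
    where
    size′ : ∀ j → sum (λ i → if B i j then 1ℚ else 0ℚ) ≡ ι Δ
    size′ j = trans (sum-cong-≗ (λ i → sym (ι-bit (B i j)))) (trans (sym (ι-sum (λ i → bit (B i j)))) (cong ι (size j)))
    products : ∀ j j′ → sum (λ i → (if B i j then 1ℚ else 0ℚ) * (if B i j′ then 1ℚ else 0ℚ)) ≡ ι (sumℕ (λ i → bit (B i j) ℕ.* bit (B i j′)))
    products j j′ = trans (sum-cong-≗ (λ i → trans (cong₂ _*_ (sym (ι-bit (B i j))) (sym (ι-bit (B i j′)))) (sym (ι-* (bit (B i j)) (bit (B i j′))))))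
      (sym (ι-sum (λ i → bit (B i j) ℕ.* bit (B i j′))))
    one : ∀ a b → a + b ≡ a + 1ℚ * b
    one = solve-∀ ℚ-ring
    nil : ∀ a b → a ≡ a + 0ℚ * b
    nil = solve-∀ ℚ-ring
    meet′ : ∀ j j′ → sum (λ i → (if B i j then 1ℚ else 0ℚ) * (if B i j′ then 1ℚ else 0ℚ)) ≡ ι μ + δ j j′ * ι σ
    meet′ j j′ = trans (products j j′) (by-cases (j Fin.≟ j′))
      where
      by-cases : Dec (j ≡ j′) → ι (sumℕ (λ i → bit (B i j) ℕ.* bit (B i j′))) ≡ ι μ + δ j j′ * ι σ
      by-cases (yes refl) = trans (cong ι (trans (sumℕ-cong (λ i → bit-idem (B i j))) (trans (size j) Δ≡)))
        (trans (ι-+ μ σ) (trans (one (ι μ) (ι σ)) (cong (λ d → ι μ + d * ι σ) (sym (δ-refl j)))))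
      by-cases (no j≢j′) = trans (cong ι (meet j j′ j≢j′)) (trans (nil (ι μ) (ι σ)) (cong (λ d → ι μ + d * ι σ) (sym (δ-≢ j≢j′))))

open DesignSignRank using (symmetric-design-sign-rank)
open import Data.Fin.Subset using (Subset; inside; outside; ⊤; ⊥; ⁅_⁆; _∪_; _∩_; ∣_∣; _∈_; _∉_; _⊆_)
open import Data.Fin.Subset.Properties
open import Data.List as List using (List; []; _∷_; length; _++_)
open import Data.List.Membership.Propositional using () renaming (_∈_ to _∈ₗ_)
open import Data.List.Membership.Propositional.Properties using (∈-∃++; ∈-++⁻; ∈-++⁺ˡ; ∈-++⁺ʳ; ∈-map⁺; ∈-map⁻; ∈-filter⁺; ∈-filter⁻; ∈-lookup)
open import Data.List.Properties using (length-++)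
open import Data.List.Relation.Unary.All as All using ([]; _∷_)
open import Data.List.Relation.Unary.AllPairs using ([]; _∷_)
open import Data.List.Relation.Unary.Any as Any using (here; there)
open import Data.List.Relation.Unary.Any.Properties using (lookup-index)
open import Data.List.Relation.Unary.Unique.Propositional using (Unique)
import Data.List.Relation.Unary.Unique.Propositional.Properties as Unique
open import Data.Nat using (_+_; _*_; _∸_; _^_; _≤_; _<_; z≤n; s≤s; NonZero; _≟_)
open import Data.Nat.Divisibility using (_∣_; ∣m+n∣m⇒∣n; m∣m*n; ∣1⇒≡1; ∣n⇒∣m*n)
open import Data.Nat.ListAction using () renaming (sum to sumₗ)
open import Data.Nat.Properties hiding (_≟_)
open import Data.Nat.Tactic.RingSolver using (solve-∀)
open import Data.Vec as Vec using (tabulate; []; _∷_; here; there)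
import Data.Vec.Properties as Vec
open import Algebra.Properties.Semiring.Sum +-*-semiring using (sum; sum-cong-≗; ∑-distrib-+; ∑-comm; *-distribˡ-sum; sum-replicate-zero)

-- Cardinalities of finite subsets as sums of indicators

⟦_⟧ : ∀ {P : Set} → Dec P → ℕ
⟦ P? ⟧ = bit (does P?)

⟦⟧-yes : ∀ {P : Set} (P? : Dec P) → P → ⟦ P? ⟧ ≡ 1
⟦⟧-yes P? p = cong bit (dec-true P? p)

⟦⟧-no : ∀ {P : Set} (P? : Dec P) → ¬ P → ⟦ P? ⟧ ≡ 0
⟦⟧-no P? ¬p = cong bit (dec-false P? ¬p)

∣tabulate∣ : ∀ {n} (f : Fin n → Bool) → ∣ tabulate f ∣ ≡ sum (bit ∘ f)
∣tabulate∣ {zero}  f = refl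
∣tabulate∣ {suc n} f with f fzero
... | true  = cong suc (∣tabulate∣ (f ∘ fsuc))
... | false = ∣tabulate∣ (f ∘ fsuc)

∣∣≡sum : ∀ {n} (S : Subset n) → ∣ S ∣ ≡ sum (bit ∘ Vec.lookup S)
∣∣≡sum S = trans (cong ∣_∣ (sym (Vec.tabulate∘lookup S))) (∣tabulate∣ (Vec.lookup S))

does-∈? : ∀ {n} (x : Fin n) (S : Subset n) → does (x ∈? S) ≡ Vec.lookup S x
does-∈? x S with x ∈? S
... | yes x∈S = sym (Vec.[]=⇒lookup x∈S)
... | no  x∉S with Vec.lookup S x in eq
...   | true  = contradiction (Vec.lookup⇒[]= x S eq) x∉S
...   | false = refl

∣∣≡sum-∈? : ∀ {n} (S : Subset n) → ∣ S ∣ ≡ sum (λ x → ⟦ x ∈? S ⟧)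
∣∣≡sum-∈? S = trans (∣∣≡sum S) (sum-cong-≗ (λ x → cong bit (sym (does-∈? x S))))

⟪_⟫ : ∀ {n} {P : Fin n → Set} → Decidable P → Subset n
⟪ P? ⟫ = tabulate (does ∘ P?)

∈⟪⟫⁺ : ∀ {n} {P : Fin n → Set} (P? : Decidable P) {x} → P x → x ∈ ⟪ P? ⟫
∈⟪⟫⁺ P? {x} px =
  Vec.lookup⇒[]= x _ (trans (Vec.lookup∘tabulate (does ∘ P?) x) (dec-true (P? x) px))

∈⟪⟫⁻ : ∀ {n} {P : Fin n → Set} (P? : Decidable P) {x} → x ∈ ⟪ P? ⟫ → P x
∈⟪⟫⁻ P? {x} x∈ with P? x | trans (sym (Vec.lookup∘tabulate (does ∘ P?) x)) (Vec.[]=⇒lookup x∈)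
... | yes px | _ = px

sum-zero : ∀ {n} {f : Fin n → ℕ} → (∀ x → f x ≡ 0) → sum f ≡ 0
sum-zero {n} f≡0 = trans (sum-cong-≗ f≡0) (sum-replicate-zero n)

sum-⟦⟧-singleton : ∀ {n} {P : Fin n → Set} (P? : Decidable P) →
  (∀ x y → P x → P y → x ≡ y) → ∀ x → P x → sum (λ x → ⟦ P? x ⟧) ≡ 1
sum-⟦⟧-singleton P? uniq fzero p =
  cong₂ _+_ (⟦⟧-yes (P? fzero) p)
    (sum-zero (λ y → ⟦⟧-no (P? (fsuc y)) (λ q → Fin.0≢1+n (uniq fzero (fsuc y) p q))))
sum-⟦⟧-singleton P? uniq (fsuc x) p =
  cong₂ _+_ (⟦⟧-no (P? fzero) (λ q → Fin.0≢1+n (uniq fzero (fsuc x) q p)))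
    (sum-⟦⟧-singleton (P? ∘ fsuc) (λ y z q q′ → Fin.suc-injective (uniq (fsuc y) (fsuc z) q q′)) x p)

sum-⟦⟧-unique : ∀ {n} {P : Fin n → Set} {Q : Set} (P? : Decidable P) (Q? : Dec Q) →
  (∀ x y → P x → P y → x ≡ y) → (∀ x → P x → Q) → (Q → ∃ P) → sum (λ x → ⟦ P? x ⟧) ≡ ⟦ Q? ⟧
sum-⟦⟧-unique P? (yes q) uniq _ wit = sum-⟦⟧-singleton P? uniq (proj₁ (wit q)) (proj₂ (wit q))
sum-⟦⟧-unique P? (no ¬q) _ imp _ = sum-zero (λ x → ⟦⟧-no (P? x) (¬q ∘ imp x))

∣S∪⁅x⁆∣ : ∀ {n} (S : Subset n) x → x ∉ S → ∣ S ∪ ⁅ x ⁆ ∣ ≡ suc ∣ S ∣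
∣S∪⁅x⁆∣ (true  ∷ S) fzero    x∉S = contradiction here x∉S
∣S∪⁅x⁆∣ (false ∷ S) fzero    x∉S = cong (suc ∘ ∣_∣) (∪-identityʳ S)
∣S∪⁅x⁆∣ (true  ∷ S) (fsuc x) x∉S = cong suc (∣S∪⁅x⁆∣ S x (x∉S ∘ there))
∣S∪⁅x⁆∣ (false ∷ S) (fsuc x) x∉S = ∣S∪⁅x⁆∣ S x (x∉S ∘ there)

Subset-induction : ∀ {n} (P : Subset n → Set) → P ⊥ →
  (∀ S x → x ∉ S → P S → P (S ∪ ⁅ x ⁆)) → ∀ S → P S
Subset-induction P base step [] = base
Subset-induction P base step (b ∷ S) = go b
  where
  tail : P (outside ∷ S)
  tail = Subset-induction (P ∘ (outside ∷_)) base
    (λ D x x∉D → step (outside ∷ D) (fsuc x) (λ { (there x∈D) → x∉D x∈D })) S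
  go : ∀ b → P (b ∷ S)
  go false = tail
  go true  = subst (λ D → P (inside ∷ D)) (∪-identityʳ S) (step (outside ∷ S) fzero (λ ()) tail)

⊆-∣∣-≡ : ∀ {n} {S T : Subset n} → S ⊆ T → ∣ S ∣ ≡ ∣ T ∣ → S ≡ T
⊆-∣∣-≡ {S = S} {T} S⊆T eq = ⊆-antisym S⊆T λ {x} x∈T → decidable-stable (x ∈? S) λ x∉S →
  <-irrefl eq (p⊂q⇒∣p∣<∣q∣ (S⊆T , x , x∈T , x∉S))

Nonempty-∣∣ : ∀ {n} {S : Subset n} {x} → x ∈ S → 1 ≤ ∣ S ∣
Nonempty-∣∣ {S = S} {x} x∈S =
  subst (_≤ ∣ S ∣) (∣⁅x⁆∣≡1 x) (p⊆q⇒∣p∣≤∣q∣ (λ y∈ → subst (_∈ S) (sym (x∈⁅y⁆⇒x≡y x y∈)) x∈S))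

-- Counting with duplicate-free lists

length-≤-injection : ∀ {A B : Set} (f : A → B) {xs : List A} {ys : List B} → Unique xs →
  (∀ {x} → x ∈ₗ xs → f x ∈ₗ ys) → (∀ {x x′} → x ∈ₗ xs → x′ ∈ₗ xs → f x ≡ f x′ → x ≡ x′) →
  length xs ≤ length ys
length-≤-injection f {[]} _ _ _ = z≤n
length-≤-injection f {x ∷ xs} (x∉xs ∷ uniq) into inj with ∈-∃++ (into (here refl))
... | as , bs , refl = subst (suc (length xs) ≤_) (sym len)
    (s≤s (length-≤-injection f uniq into′ (λ p q → inj (there p) (there q))))
  where
  len : length (as ++ f x ∷ bs) ≡ suc (length (as ++ bs))
  len = trans (length-++ as) (trans (+-suc _ _) (cong suc (sym (length-++ as))))
  into′ : ∀ {y} → y ∈ₗ xs → f y ∈ₗ as ++ bs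
  into′ y∈xs with ∈-++⁻ as (into (there y∈xs))
  ... | inj₁ p = ∈-++⁺ˡ p
  ... | inj₂ (here eq) = contradiction (inj (here refl) (there y∈xs) (sym eq)) (All.lookup x∉xs y∈xs)
  ... | inj₂ (there p) = ∈-++⁺ʳ as p

allSubsets : ∀ n → List (Subset n)
allSubsets zero    = [] ∷ []
allSubsets (suc n) = List.map (outside ∷_) (allSubsets n) ++ List.map (inside ∷_) (allSubsets n)

∈-allSubsets : ∀ {n} (S : Subset n) → S ∈ₗ allSubsets n
∈-allSubsets []          = here refl
∈-allSubsets (false ∷ S) = ∈-++⁺ˡ (∈-map⁺ _ (∈-allSubsets S))
∈-allSubsets (true  ∷ S) = ∈-++⁺ʳ _ (∈-map⁺ _ (∈-allSubsets S))

allSubsets-unique : ∀ n → Unique (allSubsets n)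
allSubsets-unique zero    = [] ∷ []
allSubsets-unique (suc n) =
  Unique.++⁺ (Unique.map⁺ Vec.∷-injectiveʳ (allSubsets-unique n))
             (Unique.map⁺ Vec.∷-injectiveʳ (allSubsets-unique n)) disjoint
  where
  disjoint : ∀ {S} → ¬ (S ∈ₗ List.map (outside ∷_) (allSubsets n) × S ∈ₗ List.map (inside ∷_) (allSubsets n))
  disjoint (p , q) with ∈-map⁻ _ p | ∈-map⁻ _ q
  ... | _ , _ , refl | _ , _ , ()

-- Double counting of the pairs of a point and a listed subset containing it.
sum-length-filter : ∀ {n} (Ss : List (Subset n)) →
  sum (λ x → length (List.filter (x ∈?_) Ss)) ≡ sumₗ (List.map ∣_∣ Ss)
sum-length-filter {n} [] = sum-replicate-zero n
sum-length-filter (S ∷ Ss) = trans (sum-cong-≗ split) (trans (∑-distrib-+ (λ x → ⟦ x ∈? S ⟧) _)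
    (cong₂ _+_ (sym (∣∣≡sum-∈? S)) (sum-length-filter Ss)))
  where
  split : ∀ x → length (List.filter (x ∈?_) (S ∷ Ss)) ≡ ⟦ x ∈? S ⟧ + length (List.filter (x ∈?_) Ss)
  split x with does (x ∈? S)
  ... | true  = refl
  ... | false = refl

List-sum-const : ∀ {A : Set} (f : A → ℕ) c (xs : List A) → (∀ {x} → x ∈ₗ xs → f x ≡ c) →
  sumₗ (List.map f xs) ≡ length xs * c
List-sum-const f c [] _ = refl
List-sum-const f c (x ∷ xs) eq = cong₂ _+_ (eq (here refl)) (List-sum-const f c xs (eq ∘ there))

-- The size of a subspace of rank k, i.e. of projective dimension k − 1: num n (suc d) is N_{n,d}.
num : ℕ → ℕ → ℕ
num n zero    = 0
num n (suc k) = suc (n * num n k)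

-- Subspaces and joins with a point

module Geometry {np nl : ℕ} (PS : ProjectiveSpace np nl) where
  open ProjectiveSpace PS

  _I?_ : ∀ p l → Dec (p I l)
  p I? l = inc p l Bool.≟ true

  Subspace : Subset np → Set
  Subspace = IsSubspace PS

  subspace? : Decidable Subspace
  subspace? S = Fin.all? λ p → Fin.all? λ q → Fin.all? λ l → Fin.all? λ x →
    ¬? (p Fin.≟ q) →-dec ((p ∈? S) →-dec ((q ∈? S) →-dec
      ((p I? l) →-dec ((q I? l) →-dec ((x I? l) →-dec (x ∈? S))))))

  ⊥-subspace : Subspace ⊥
  ⊥-subspace p q l x _ p∈⊥ = contradiction p∈⊥ ∉⊥

  ⊤-subspace : Subspace ⊤
  ⊤-subspace _ _ _ _ _ _ _ _ _ _ = ∈⊤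

  ∩-subspace : ∀ {S T} → Subspace S → Subspace T → Subspace (S ∩ T)
  ∩-subspace {S} {T} subS subT p q l x p≢q p∈ q∈ pl ql xl = x∈p∩q⁺
    ( subS p q l x p≢q (proj₁ (x∈p∩q⁻ S T p∈)) (proj₁ (x∈p∩q⁻ S T q∈)) pl ql xl
    , subT p q l x p≢q (proj₂ (x∈p∩q⁻ S T p∈)) (proj₂ (x∈p∩q⁻ S T q∈)) pl ql xl )

  -- The disjunct `x ≡ p` matters for empty S, where no line joins p to S and the join is the point
  -- p alone.
  Joined : Subset np → Fin np → Fin np → Set
  Joined S p x = x ≡ p ⊎ ∃[ s ] (s ∈ S × ∃[ l ] (s I l × p I l × x I l))

  joined? : ∀ S p → Decidable (Joined S p)
  joined? S p x = (x Fin.≟ p) ⊎-dec Fin.any? λ s → (s ∈? S) ×-dec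
    Fin.any? λ l → (s I? l) ×-dec ((p I? l) ×-dec (x I? l))

  join : Subset np → Fin np → Subset np
  join S p = ⟪ joined? S p ⟫

  ∈-join⁺ : ∀ S p {x} → Joined S p x → x ∈ join S p
  ∈-join⁺ S p = ∈⟪⟫⁺ (joined? S p)

  ∈-join⁻ : ∀ S p {x} → x ∈ join S p → Joined S p x
  ∈-join⁻ S p = ∈⟪⟫⁻ (joined? S p)

  p∈join : ∀ S p → p ∈ join S p
  p∈join S p = ∈-join⁺ S p (inj₁ refl)

  ∈∉⇒≢ : ∀ {S : Subset np} {s p} → s ∈ S → p ∉ S → s ≢ p
  ∈∉⇒≢ s∈S p∉S refl = p∉S s∈S

  S⊆join : ∀ S p → S ⊆ join S p
  S⊆join S p {x} x∈S with x Fin.≟ p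
  ... | yes eq = ∈-join⁺ S p (inj₁ eq)
  ... | no x≢p with line-exists x p x≢p
  ...   | l , xl , pl = ∈-join⁺ S p (inj₂ (x , x∈S , l , xl , pl , xl))

  join-least : ∀ {S p T} → Subspace T → p ∉ S → S ⊆ T → p ∈ T → join S p ⊆ T
  join-least {S} {p} subT p∉S S⊆T p∈T x∈ with ∈-join⁻ S p x∈
  ... | inj₁ refl = p∈T
  ... | inj₂ (s , s∈S , l , sl , pl , xl) = subT s p l _ (∈∉⇒≢ s∈S p∉S) (S⊆T s∈S) p∈T sl pl xl

  module _ {S : Subset np} {p : Fin np} (subS : Subspace S) (p∉S : p ∉ S) where

    private
      ≢p : ∀ {s} → s ∈ S → s ≢ p
      ≢p s∈S = ∈∉⇒≢ s∈S p∉S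

    -- Let y lie on the line pt with t ∈ S. The lines zs and pt meet in y, so by Veblen-Young zp and
    -- st meet; their common point lies in S and places z on a line from p to S.
    line-base-point : ∀ {s y z m} → s ∈ S → Joined S p y → s ≢ y → s I m → y I m → z I m → Joined S p z
    line-base-point {s} {m = m} s∈S (inj₁ refl) s≢y sm ym zm = inj₂ (s , s∈S , m , sm , ym , zm)
    line-base-point {s} {y} {z} {m} s∈S (inj₂ (t , t∈S , l , tl , pl , yl)) s≢y sm ym zm
      with z Fin.≟ p | z Fin.≟ s | s Fin.≟ t
    ... | yes z≡p | _ | _ = inj₁ z≡p
    ... | no z≢p | yes refl | _ = ∈-join⁻ S p (S⊆join S p s∈S)
    ... | no z≢p | no z≢s | yes refl
        rewrite line-unique s y m l s≢y sm ym tl yl = inj₂ (t , t∈S , l , tl , pl , zm)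
    ... | no z≢p | no z≢s | no s≢t with line-exists z p z≢p | line-exists s t s≢t
    ...   | zp , z-zp , p-zp | st , s-st , t-st
        with veblen-young z s p t m l zp st z≢s (≢p t∈S ∘ sym) z≢p s≢t zm sm pl tl z-zp p-zp s-st t-st (y , ym , yl)
    ...     | w , w-zp , w-st =
        inj₂ (w , subS s t st w s≢t s∈S t∈S s-st t-st w-st , zp , w-zp , p-zp , z-zp)

    -- For x on ps and y on pt, both outside S, the lines xs and yt meet in p. Veblen-Young then
    -- makes xy meet st, hence S, which reduces the claim to `line-base-point`.
    join-subspace : Subspace (join S p)
    join-subspace x y m z x≢y x∈J y∈J xm ym zm = ∈-join⁺ S p (go (∈-join⁻ S p x∈J) (∈-join⁻ S p y∈J))
      where
      go : Joined S p x → Joined S p y → Joined S p z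
      go (inj₁ refl) (inj₁ refl) = contradiction refl x≢y
      go (inj₁ refl) (inj₂ (t , t∈S , l , tl , pl , yl))
        rewrite line-unique p y m l x≢y xm ym pl yl = inj₂ (t , t∈S , l , tl , pl , zm)
      go (inj₂ (s , s∈S , l , sl , pl , xl)) (inj₁ refl)
        rewrite line-unique x p m l x≢y xm ym xl pl = inj₂ (s , s∈S , l , sl , pl , zm)
      go jx@(inj₂ (s , s∈S , l , sl , pl , xl)) jy@(inj₂ (t , t∈S , l′ , tl , pl′ , yl))
        with x ∈? S | y ∈? S | s Fin.≟ t
      ... | yes x∈S | _ | _ = line-base-point x∈S jy x≢y xm ym zm
      ... | no _ | yes y∈S | _ = line-base-point y∈S jx (x≢y ∘ sym) ym xm zm
      ... | no _ | no _ | yes refl with line-unique s p l l′ (≢p s∈S) sl pl tl pl′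
      ...   | refl rewrite line-unique x y m l x≢y xm ym xl yl = inj₂ (s , s∈S , l , sl , pl , zm)
      go jx@(inj₂ (s , s∈S , l , sl , pl , xl)) jy@(inj₂ (t , t∈S , l′ , tl , pl′ , yl))
        | no x∉S | no y∉S | no s≢t with line-exists s t s≢t
      ... | st , s-st , t-st
          with veblen-young x s y t l l′ m st (∈∉⇒≢ s∈S x∉S ∘ sym) (∈∉⇒≢ t∈S y∉S ∘ sym) x≢y s≢t
                 xl sl yl tl xm ym s-st t-st (p , pl , pl′)
      ...   | w , wm , w-st = line-base-point w∈S jy (∈∉⇒≢ w∈S y∉S) wm ym zm
        where w∈S = subS s t st w s≢t s∈S t∈S s-st t-st w-st

    exchange : ∀ {q} → q ∉ S → q ∈ join S p → p ∈ join S q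
    exchange {q} q∉S q∈J with ∈-join⁻ S p q∈J
    ... | inj₁ refl = p∈join S p
    ... | inj₂ (s , s∈S , l , sl , pl , ql) = ∈-join⁺ S q (inj₂ (s , s∈S , l , sl , ql , pl))

    -- A point x ≠ p of the join comes from a unique s ∈ S, since two would put p on a line inside
    -- S; and each line ps carries n points other than p.
    ∣join∣ : ∀ {n} → HasOrder PS n → ∣ join S p ∣ ≡ suc (n * ∣ S ∣)
    ∣join∣ {n} order = begin
      ∣ join S p ∣                                                        ≡⟨ ∣tabulate∣ (does ∘ joined? S p) ⟩
      sum (λ x → ⟦ joined? S p x ⟧)                                       ≡⟨ sum-cong-≗ split ⟩
      sum (λ x → ⟦ x Fin.≟ p ⟧ + sum (λ s → ⟦ R? s x ⟧))                  ≡⟨ ∑-distrib-+ (λ x → ⟦ x Fin.≟ p ⟧) _ ⟩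
      sum (λ x → ⟦ x Fin.≟ p ⟧) + sum (λ x → sum (λ s → ⟦ R? s x ⟧))      ≡⟨ cong₂ _+_ (sum-⟦⟧-singleton (Fin._≟ p) (λ _ _ eq eq′ → trans eq (sym eq′)) p refl) (∑-comm (λ x s → ⟦ R? s x ⟧)) ⟩
      suc (sum (λ s → sum (λ x → ⟦ R? s x ⟧)))                            ≡⟨ cong suc (sum-cong-≗ fibre) ⟩
      suc (sum (λ s → n * ⟦ s ∈? S ⟧))                                    ≡⟨ cong suc (*-distribˡ-sum n (λ s → ⟦ s ∈? S ⟧)) ⟨
      suc (n * sum (λ s → ⟦ s ∈? S ⟧))                                    ≡⟨ cong (λ k → suc (n * k)) (∣∣≡sum-∈? S) ⟨
      suc (n * ∣ S ∣)                                                     ∎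
      where
      open ≡-Reasoning

      R : Fin np → Fin np → Set
      R s x = s ∈ S × x ≢ p × ∃[ l ] (s I l × p I l × x I l)

      R? : ∀ s x → Dec (R s x)
      R? s x = (s ∈? S) ×-dec (¬? (x Fin.≟ p) ×-dec Fin.any? λ l → (s I? l) ×-dec ((p I? l) ×-dec (x I? l)))

      unique : ∀ x s t → R s x → R t x → s ≡ t
      unique x s t (s∈S , x≢p , l , sl , pl , xl) (t∈S , _ , l′ , tl , pl′ , xl′)
        with line-unique x p l l′ x≢p xl pl xl′ pl′
      ... | refl = decidable-stable (s Fin.≟ t) λ s≢t → p∉S (subS s t l p s≢t s∈S t∈S sl tl pl)

      split : ∀ x → ⟦ joined? S p x ⟧ ≡ ⟦ x Fin.≟ p ⟧ + sum (λ s → ⟦ R? s x ⟧)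
      split x = by-cases (x Fin.≟ p)
        where
        by-cases : (x≟p : Dec (x ≡ p)) → ⟦ joined? S p x ⟧ ≡ ⟦ x≟p ⟧ + sum (λ s → ⟦ R? s x ⟧)
        by-cases (yes x≡p) = trans (⟦⟧-yes (joined? S p x) (inj₁ x≡p))
          (cong suc (sym (sum-zero (λ s → ⟦⟧-no (R? s x) (λ { (_ , x≢p , _) → x≢p x≡p })))))
        by-cases (no x≢p) = sym (sum-⟦⟧-unique (λ s → R? s x) (joined? S p x) (unique x)
          (λ { s (s∈S , _ , l , rest) → inj₂ (s , s∈S , l , rest) })
          (λ { (inj₁ x≡p) → contradiction x≡p x≢p ; (inj₂ (s , s∈S , l , rest)) → s , s∈S , x≢p , l , rest }))

      fibre : ∀ s → sum (λ x → ⟦ R? s x ⟧) ≡ n * ⟦ s ∈? S ⟧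
      fibre s = by-cases (s ∈? S)
        where
        by-cases : (s∈?S : Dec (s ∈ S)) → sum (λ x → ⟦ R? s x ⟧) ≡ n * ⟦ s∈?S ⟧
        by-cases (no s∉S) = trans (sum-zero (λ x → ⟦⟧-no (R? s x) (s∉S ∘ proj₁))) (sym (*-zeroʳ n))
        by-cases (yes s∈S) with line-exists s p (≢p s∈S)
        ... | l , sl , pl = trans (suc-injective eq) (sym (*-identityʳ n))
          where
          point : ∀ x → bit (inc x l) ≡ ⟦ x Fin.≟ p ⟧ + ⟦ R? s x ⟧
          point x = by-cases′ (x Fin.≟ p)
            where
            to : R s x → inc x l ≡ true
            to (_ , _ , l′ , sl′ , pl′ , xl′) = subst (x I_) (line-unique s p l′ l (≢p s∈S) sl′ pl′ sl pl) xl′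
            by-cases′ : (x≟p : Dec (x ≡ p)) → bit (inc x l) ≡ ⟦ x≟p ⟧ + ⟦ R? s x ⟧
            by-cases′ (yes refl) = trans (cong bit pl) (cong suc (sym (⟦⟧-no (R? s x) (λ { (_ , x≢p , _) → x≢p refl }))))
            by-cases′ (no x≢p) with inc x l in xl
            ... | true  = sym (⟦⟧-yes (R? s x) (s∈S , x≢p , l , sl , pl , xl))
            ... | false = sym (⟦⟧-no (R? s x) (λ r → contradiction (trans (sym xl) (to r)) (λ ())))
          eq : suc (sum (λ x → ⟦ R? s x ⟧)) ≡ suc n
          eq = begin
            suc (sum (λ x → ⟦ R? s x ⟧))                              ≡⟨ cong (_+ sum (λ x → ⟦ R? s x ⟧)) (sum-⟦⟧-singleton (Fin._≟ p) (λ _ _ eq eq′ → trans eq (sym eq′)) p refl) ⟨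
            sum (λ x → ⟦ x Fin.≟ p ⟧) + sum (λ x → ⟦ R? s x ⟧)        ≡⟨ ∑-distrib-+ (λ x → ⟦ x Fin.≟ p ⟧) _ ⟨
            sum (λ x → ⟦ x Fin.≟ p ⟧ + ⟦ R? s x ⟧)                    ≡⟨ sum-cong-≗ point ⟨
            sum (λ x → bit (inc x l))                                 ≡⟨ ∣tabulate∣ (λ x → inc x l) ⟨
            ∣ pointsOn PS l ∣                                         ≡⟨ order l ⟩
            suc n                                                     ∎

-- Rank, and the enumeration of flats and hyperplanes

num-injective : ∀ n .{{_ : NonZero n}} {j k} → num n j ≡ num n k → j ≡ k
num-injective n {zero}  {zero}  _  = refl
num-injective n {suc j} {suc k} eq =
  cong suc (num-injective n (*-cancelˡ-≡ (num n j) (num n k) n (suc-injective eq)))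

module Counting {np nl : ℕ} (PS : ProjectiveSpace np nl) (n : ℕ) .{{_ : NonZero n}} (order : HasOrder PS n) where
  open ProjectiveSpace PS
  open Geometry PS

  -- Y is a basis extracted from X: the cardinality of S expresses that Y is independent, and
  -- leastness among the subspaces containing Y, not just X, that Y already generates S.
  Hull : Subset np → Set
  Hull X = ∃[ S ] ∃[ Y ] (Subspace S × X ⊆ S × Y ⊆ X × ∣ S ∣ ≡ num n ∣ Y ∣ ×
                          (∀ T → Subspace T → Y ⊆ T → S ⊆ T))

  hull : ∀ X → Hull X
  hull = Subset-induction Hull base step
    where
    base : Hull ⊥
    base = ⊥ , ⊥ , ⊥-subspace , ⊆-refl , ⊆-refl , trans (∣⊥∣≡0 np) (cong (num n) (sym (∣⊥∣≡0 np))) , λ _ _ Y⊆T → Y⊆T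

    insert-⊆ : ∀ {X T x} → X ⊆ T → x ∈ T → X ∪ ⁅ x ⁆ ⊆ T
    insert-⊆ {X} {T} {x} X⊆T x∈T y∈ with x∈p∪q⁻ X ⁅ x ⁆ y∈
    ... | inj₁ y∈X = X⊆T y∈X
    ... | inj₂ y∈x = subst (_∈ T) (sym (x∈⁅y⁆⇒x≡y x y∈x)) x∈T

    step : ∀ X x → x ∉ X → Hull X → Hull (X ∪ ⁅ x ⁆)
    step X x x∉X (S , Y , subS , X⊆S , Y⊆X , card , least) with x ∈? S
    ... | yes x∈S = S , Y , subS , insert-⊆ X⊆S x∈S , ⊆-trans Y⊆X (p⊆p∪q ⁅ x ⁆) , card , least
    ... | no x∉S = join S x , Y ∪ ⁅ x ⁆ , join-subspace subS x∉S
        , insert-⊆ (⊆-trans X⊆S (S⊆join S x)) (p∈join S x)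
        , insert-⊆ (⊆-trans Y⊆X (p⊆p∪q ⁅ x ⁆)) (q⊆p∪q X ⁅ x ⁆ (x∈⁅x⁆ x))
        , trans (∣join∣ subS x∉S order)
            (trans (cong (λ k → suc (n * k)) card) (cong (num n) (sym (∣S∪⁅x⁆∣ Y x (x∉X ∘ Y⊆X)))))
        , λ T subT Yx⊆T → join-least subT x∉S (least T subT (⊆-trans (p⊆p∪q ⁅ x ⁆) Yx⊆T))
            (Yx⊆T (q⊆p∪q Y ⁅ x ⁆ (x∈⁅x⁆ x)))

  -- The basis extracted from a spanning set of size d + 1 spans as well, so minimality forces it to
  -- have d + 1 elements too.
  point-count : ∀ {d} → HasDimension PS d → np ≡ num n (suc d)
  point-count {d} ((X , spans , ∣X∣) , minimal) with hull X
  ... | S , Y , subS , X⊆S , Y⊆X , card , least =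
    trans (sym (∣⊤∣≡n np)) (trans (cong ∣_∣ (sym S≡⊤)) (trans card (cong (num n) ∣Y∣)))
    where
    S≡⊤ : S ≡ ⊤
    S≡⊤ = spans S subS X⊆S
    ∣Y∣ : ∣ Y ∣ ≡ suc d
    ∣Y∣ = ≤-antisym (subst (∣ Y ∣ ≤_) ∣X∣ (p⊆q⇒∣p∣≤∣q∣ Y⊆X))
      (minimal Y (λ T subT Y⊆T → ⊆-antisym ⊆⊤ (subst (_⊆ T) S≡⊤ (least T subT Y⊆T))))

  -- An instance of the modular law: a point of W other than p is projected from p into H along a
  -- line that stays inside W.
  join-∩ : ∀ {W H p} → Subspace W → p ∈ W → p ∉ H → W ⊆ join H p → join (W ∩ H) p ≡ W
  join-∩ {W} {H} {p} subW p∈W p∉H W⊆ = ⊆-antisym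
    (join-least subW (p∉H ∘ proj₂ ∘ x∈p∩q⁻ W H) (p∩q⊆p W H) p∈W) λ {x} x∈W →
      ∈-join⁺ (W ∩ H) p (go x x∈W (∈-join⁻ H p (W⊆ x∈W)))
    where
    go : ∀ x → x ∈ W → Joined H p x → Joined (W ∩ H) p x
    go x x∈W (inj₁ x≡p) = inj₁ x≡p
    go x x∈W (inj₂ (s , s∈H , l , sl , pl , xl)) with x Fin.≟ p
    ... | yes x≡p = inj₁ x≡p
    ... | no x≢p = inj₂ (s , x∈p∩q⁺ (subW x p l s x≢p x∈W p∈W xl pl sl , s∈H) , l , sl , pl , xl)

  ∣W∩H∣ : ∀ {W H p} → Subspace W → Subspace H → p ∈ W → p ∉ H → W ⊆ join H p → ∣ W ∣ ≡ suc (n * ∣ W ∩ H ∣)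
  ∣W∩H∣ {W} {H} {p} subW subH p∈W p∉H W⊆ = trans (cong ∣_∣ (sym (join-∩ subW p∈W p∉H W⊆)))
    (∣join∣ (∩-subspace subW subH) (p∉H ∘ proj₂ ∘ x∈p∩q⁻ W H) order)

  ∩-join : ∀ {W H p} → Subspace H → W ⊆ H → p ∉ H → join W p ∩ H ≡ W
  ∩-join {W} {H} {p} subH W⊆H p∉H = ⊆-antisym to (λ x∈W → x∈p∩q⁺ (S⊆join W p x∈W , W⊆H x∈W))
    where
    to : join W p ∩ H ⊆ W
    to {x} x∈ with x∈p∩q⁻ (join W p) H x∈
    ... | x∈J , x∈H with ∈-join⁻ W p x∈J
    ...   | inj₁ refl = contradiction x∈H p∉H
    ...   | inj₂ (s , s∈W , l , sl , pl , xl) with x Fin.≟ s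
    ...     | yes refl = s∈W
    ...     | no x≢s = contradiction (subH x s l p x≢s x∈H (W⊆H s∈W) xl sl pl) p∉H

  -- Points of T not yet in `join S p` are added to S one after another. Each addition leaves p
  -- outside, for otherwise `exchange` would put the new point into `join S p`.
  complement : ∀ {T p} → Subspace T → p ∈ T →
    ∃[ S ] (Subspace S × p ∉ S × S ⊆ T × T ⊆ join S p)
  complement {T} {p} subT p∈T
    = let S , subS , p∉S , S⊆T , covers = Subset-induction Covers base step ⊤
      in S , subS , p∉S , S⊆T , covers ∈⊤
    where
    Covers : Subset np → Set
    Covers D = ∃[ S ] (Subspace S × p ∉ S × S ⊆ T × (∀ {x} → x ∈ D → x ∈ T → x ∈ join S p))

    base : Covers ⊥
    base = ⊥ , ⊥-subspace , ∉⊥ , ⊥⊆ , λ x∈⊥ → contradiction x∈⊥ ∉⊥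

    step : ∀ D x → x ∉ D → Covers D → Covers (D ∪ ⁅ x ⁆)
    step D x _ (S , subS , p∉S , S⊆T , covers) with x ∈? T | x ∈? join S p
    ... | yes x∈T | no x∉J = join S x , join-subspace subS x∉S , p∉J , join-least subT x∉S S⊆T x∈T , covers′
      where
      x∉S : x ∉ S
      x∉S = x∉J ∘ S⊆join S p
      p∉J : p ∉ join S x
      p∉J p∈J = x∉J (exchange subS x∉S p∉S p∈J)
      covers′ : ∀ {y} → y ∈ D ∪ ⁅ x ⁆ → y ∈ T → y ∈ join (join S x) p
      covers′ y∈ y∈T with x∈p∪q⁻ D ⁅ x ⁆ y∈
      ... | inj₁ y∈D = join-least (join-subspace (join-subspace subS x∉S) p∉J) p∉S
              (⊆-trans (S⊆join S x) (S⊆join (join S x) p)) (p∈join (join S x) p) (covers y∈D y∈T)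
      ... | inj₂ y∈x = S⊆join (join S x) p (subst (_∈ join S x) (sym (x∈⁅y⁆⇒x≡y x y∈x)) (p∈join S x))
    ... | no x∉T | _ = S , subS , p∉S , S⊆T , λ {y} y∈ y∈T → covers′ (x∈p∪q⁻ D ⁅ x ⁆ y∈) y∈T
      where
      covers′ : ∀ {y} → y ∈ D ⊎ y ∈ ⁅ x ⁆ → y ∈ T → y ∈ join S p
      covers′ (inj₁ y∈D) y∈T = covers y∈D y∈T
      covers′ (inj₂ y∈x) y∈T = contradiction (subst (_∈ T) (x∈⁅y⁆⇒x≡y x y∈x) y∈T) x∉T
    ... | yes _ | yes x∈J = S , subS , p∉S , S⊆T , λ {y} y∈ y∈T → covers′ (x∈p∪q⁻ D ⁅ x ⁆ y∈) y∈T
      where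
      covers′ : ∀ {y} → y ∈ D ⊎ y ∈ ⁅ x ⁆ → y ∈ T → y ∈ join S p
      covers′ (inj₁ y∈D) y∈T = covers y∈D y∈T
      covers′ (inj₂ y∈x) y∈T = subst (_∈ join S p) (sym (x∈⁅y⁆⇒x≡y x y∈x)) x∈J

  -- Rank is encoded by cardinality, which makes it decidable: flats can be listed by filtering all
  -- subsets.
  IsFlat : Subset np → ℕ → Subset np → Set
  IsFlat T k S = Subspace S × S ⊆ T × ∣ S ∣ ≡ num n k

  isFlat? : ∀ T k → Decidable (IsFlat T k)
  isFlat? T k S = subspace? S ×-dec ((S ⊆? T) ×-dec (∣ S ∣ ≟ num n k))

  flats : Subset np → ℕ → List (Subset np)
  flats T k = List.filter (isFlat? T k) (allSubsets np)

  ∈-flats⁺ : ∀ {T k S} → IsFlat T k S → S ∈ₗ flats T k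
  ∈-flats⁺ {T} {k} = ∈-filter⁺ (isFlat? T k) (∈-allSubsets _)

  ∈-flats⁻ : ∀ {T k S} → S ∈ₗ flats T k → IsFlat T k S
  ∈-flats⁻ {T} {k} S∈ = proj₂ (∈-filter⁻ (isFlat? T k) {xs = allSubsets np} S∈)

  flats-unique : ∀ T k → Unique (flats T k)
  flats-unique T k = Unique.filter⁺ (isFlat? T k) (allSubsets-unique np)

  -- Duality of counts: T has as many hyperplanes as points. Double counting of incident pairs gives
  -- a common factor `num n (suc k)`: it is the size of each flat, and by induction also the number
  -- of flats through each point. A single point has only the empty flat.
  flats-count : ∀ k {T} → Subspace T → ∣ T ∣ ≡ num n (suc k) → length (flats T k) ≡ num n (suc k)
  flats-count zero {T} subT ∣T∣ = trans (≤-antisym at-most at-least) (cong suc (sym (*-zeroʳ n)))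
    where
    at-most : length (flats T 0) ≤ 1
    at-most = length-≤-injection (λ S → S) {ys = ⊥ ∷ []} (flats-unique T 0)
      (λ S∈ → here (sym (⊆-∣∣-≡ ⊥⊆ (trans (∣⊥∣≡0 np) (sym (proj₂ (proj₂ (∈-flats⁻ {T} {0} S∈)))))))) (λ _ _ eq → eq)
    at-least : 1 ≤ length (flats T 0)
    at-least = length-≤-injection (λ S → S) {xs = ⊥ ∷ []} ([] ∷ [])
      (λ { (here refl) → ∈-flats⁺ (⊥-subspace , ⊥⊆ , ∣⊥∣≡0 np) }) (λ _ _ eq → eq)
  flats-count (suc k) {T} subT ∣T∣ = *-cancelʳ-≡ _ _ (num n (suc k)) (begin
    length (flats T (suc k)) * num n (suc k)                         ≡⟨ List-sum-const ∣_∣ (num n (suc k)) (flats T (suc k)) (λ S∈ → proj₂ (proj₂ (∈-flats⁻ {T} {suc k} S∈))) ⟨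
    sumₗ (List.map ∣_∣ (flats T (suc k)))                            ≡⟨ sum-length-filter (flats T (suc k)) ⟨
    sum (λ p → length (List.filter (p ∈?_) (flats T (suc k))))       ≡⟨ sum-cong-≗ (λ p → through p (p ∈? T)) ⟩
    sum (λ p → num n (suc k) * ⟦ p ∈? T ⟧)                           ≡⟨ *-distribˡ-sum (num n (suc k)) (λ p → ⟦ p ∈? T ⟧) ⟨
    num n (suc k) * sum (λ p → ⟦ p ∈? T ⟧)                           ≡⟨ cong (num n (suc k) *_) (trans (sym (∣∣≡sum-∈? T)) ∣T∣) ⟩
    num n (suc k) * num n (suc (suc k))                              ≡⟨ *-comm (num n (suc k)) (num n (suc (suc k))) ⟩
    num n (suc (suc k)) * num n (suc k)                              ∎)
    where
    open ≡-Reasoning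

    flatsThrough : Fin np → List (Subset np)
    flatsThrough p = List.filter (p ∈?_) (flats T (suc k))

    ∈-flatsThrough⁻ : ∀ {p S} → S ∈ₗ flatsThrough p → IsFlat T (suc k) S × p ∈ S
    ∈-flatsThrough⁻ {p} S∈ with ∈-filter⁻ (p ∈?_) {xs = flats T (suc k)} S∈
    ... | S∈fl , p∈S = ∈-flats⁻ S∈fl , p∈S

    -- Flats through p correspond to flats of a complement of p, by intersection and join.
    through : ∀ p (p∈?T : Dec (p ∈ T)) → length (flatsThrough p) ≡ num n (suc k) * ⟦ p∈?T ⟧
    through p (no p∉T) = trans (n≤0⇒n≡0 (length-≤-injection (λ S → S) {ys = []} (Unique.filter⁺ (p ∈?_) (flats-unique T (suc k)))
      (λ S∈ → let ((_ , S⊆T , _) , p∈S) = ∈-flatsThrough⁻ S∈ in contradiction (S⊆T p∈S) p∉T) (λ _ _ eq → eq)))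
      (sym (*-zeroʳ (num n (suc k))))
    through p (yes p∈T) with complement subT p∈T
    ... | H , subH , p∉H , H⊆T , T⊆ = trans (≤-antisym at-most at-least)
        (trans (flats-count k subH ∣H∣) (sym (*-identityʳ _)))
      where
      cancel : ∀ {a b} → suc (n * a) ≡ suc (n * b) → a ≡ b
      cancel {a} {b} eq = *-cancelˡ-≡ a b n (suc-injective eq)
      ∣H∣ : ∣ H ∣ ≡ num n (suc k)
      ∣H∣ = cancel (trans (sym (∣join∣ subH p∉H order))
        (trans (cong ∣_∣ (⊆-antisym (join-least subT p∉H H⊆T p∈T) T⊆)) ∣T∣))
      at-most : length (flatsThrough p) ≤ length (flats H k)
      at-most = length-≤-injection (_∩ H) (Unique.filter⁺ (p ∈?_) (flats-unique T (suc k))) into inj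
        where
        into : ∀ {S} → S ∈ₗ flatsThrough p → S ∩ H ∈ₗ flats H k
        into {S} S∈ with ∈-flatsThrough⁻ S∈
        ... | (subS , S⊆T , ∣S∣) , p∈S = ∈-flats⁺ (∩-subspace subS subH , p∩q⊆q S H
          , cancel (trans (sym (∣W∩H∣ subS subH p∈S p∉H (⊆-trans S⊆T T⊆))) ∣S∣))
        inj : ∀ {S S′} → S ∈ₗ flatsThrough p → S′ ∈ₗ flatsThrough p → S ∩ H ≡ S′ ∩ H → S ≡ S′
        inj S∈ S′∈ eq with ∈-flatsThrough⁻ S∈ | ∈-flatsThrough⁻ S′∈
        ... | (subS , S⊆T , _) , p∈S | (subS′ , S′⊆T , _) , p∈S′ =
          trans (sym (join-∩ subS p∈S p∉H (⊆-trans S⊆T T⊆)))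
            (trans (cong (λ W → join W p) eq) (join-∩ subS′ p∈S′ p∉H (⊆-trans S′⊆T T⊆)))
      at-least : length (flats H k) ≤ length (flatsThrough p)
      at-least = length-≤-injection (λ W → join W p) (flats-unique H k) into inj
        where
        into : ∀ {W} → W ∈ₗ flats H k → join W p ∈ₗ flatsThrough p
        into {W} W∈ with ∈-flats⁻ {H} {k} W∈
        ... | subW , W⊆H , ∣W∣ = ∈-filter⁺ (p ∈?_) (∈-flats⁺
          ( join-subspace subW (p∉H ∘ W⊆H)
          , join-least subT (p∉H ∘ W⊆H) (⊆-trans W⊆H H⊆T) p∈T
          , trans (∣join∣ subW (p∉H ∘ W⊆H) order) (cong (λ j → suc (n * j)) ∣W∣))) (p∈join W p)
        inj : ∀ {W W′} → W ∈ₗ flats H k → W′ ∈ₗ flats H k → join W p ≡ join W′ p → W ≡ W′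
        inj W∈ W′∈ eq with ∈-flats⁻ {H} {k} W∈ | ∈-flats⁻ {H} {k} W′∈
        ... | _ , W⊆H , _ | _ , W′⊆H , _ =
          trans (sym (∩-join subH W⊆H p∉H)) (trans (cong (_∩ H) eq) (∩-join subH W′⊆H p∉H))

  module _ {d : ℕ} (∣P∣ : np ≡ num n (suc d)) where

    private
      cancel : ∀ {a b} → suc (n * a) ≡ suc (n * b) → a ≡ b
      cancel {a} {b} eq = *-cancelˡ-≡ a b n (suc-injective eq)

      ∣⊤∣ : ∣ ⊤ {np} ∣ ≡ num n (suc d)
      ∣⊤∣ = trans (∣⊤∣≡n np) ∣P∣

    flat⇒join≡⊤ : ∀ {H p} → Subspace H → ∣ H ∣ ≡ num n d → p ∉ H → join H p ≡ ⊤
    flat⇒join≡⊤ subH ∣H∣ p∉H = ⊆-∣∣-≡ ⊆⊤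
      (trans (∣join∣ subH p∉H order) (trans (cong (λ k → suc (n * k)) ∣H∣) (sym ∣⊤∣)))

    -- By maximality the join with any outside point is the whole space, and `∣join∣` then
    -- determines the size of H.
    hyperplane-flat : ∀ {H} → IsHyperplane PS H → IsFlat ⊤ d H
    hyperplane-flat {H} (subH , H≢⊤ , maximal) = subH , ⊆⊤ , cancel (trans (sym ∣join∣′) ∣⊤∣)
      where
      outsider : ∃[ p ] p ∉ H
      outsider with Fin.any? (λ p → ¬? (p ∈? H))
      ... | yes found = found
      ... | no none = contradiction (⊆-antisym ⊆⊤ (λ {x} _ → decidable-stable (x ∈? H) (λ x∉H → none (x , x∉H)))) H≢⊤
      p∉H = proj₂ outsider
      ∣join∣′ : ∣ ⊤ {np} ∣ ≡ suc (n * ∣ H ∣)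
      ∣join∣′ with maximal _ (join-subspace subH p∉H) (S⊆join H (proj₁ outsider))
      ... | inj₁ eq = contradiction (subst (proj₁ outsider ∈_) eq (p∈join H (proj₁ outsider))) p∉H
      ... | inj₂ eq = trans (cong ∣_∣ (sym eq)) (∣join∣ subH p∉H order)

    num<num-suc : ∀ k → num n k < num n (suc k)
    num<num-suc k = s≤s (m≤n*m (num n k) n)

    flat-hyperplane : ∀ {H} → IsFlat ⊤ d H → IsHyperplane PS H
    flat-hyperplane {H} (subH , _ , ∣H∣) = subH , H≢⊤ , maximal
      where
      H≢⊤ : H ≢ ⊤
      H≢⊤ eq = <-irrefl (trans (sym ∣H∣) (trans (cong ∣_∣ eq) ∣⊤∣)) (num<num-suc d)
      maximal : ∀ S → Subspace S → H ⊆ S → S ≡ H ⊎ S ≡ ⊤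
      maximal S subS H⊆S with S ⊆? H
      ... | yes S⊆H = inj₁ (⊆-antisym S⊆H H⊆S)
      ... | no S⊈H with Fin.any? (λ p → (p ∈? S) ×-dec ¬? (p ∈? H))
      ...   | yes (p , p∈S , p∉H) = inj₂ (⊆-antisym ⊆⊤
              (subst (_⊆ S) (flat⇒join≡⊤ subH ∣H∣ p∉H) (join-least subS p∉H H⊆S p∈S)))
      ...   | no none = contradiction (λ {x} x∈S → decidable-stable (x ∈? H) (λ x∉H → none (x , x∈S , x∉H))) S⊈H

    flats-enumerate : EnumeratesHyperplanes PS (flats ⊤ d)
    flats-enumerate = flats-unique ⊤ d , λ S → mk⇔ (flat-hyperplane ∘ ∈-flats⁻) (∈-flats⁺ ∘ hyperplane-flat)

    hyperplane-count : ∀ {hs} → EnumeratesHyperplanes PS hs → length hs ≡ num n (suc d)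
    hyperplane-count {hs} (uniq , enum) = trans (≤-antisym
        (length-≤-injection (λ S → S) uniq (∈-flats⁺ ∘ hyperplane-flat ∘ Equivalence.to (enum _)) (λ _ _ eq → eq))
        (length-≤-injection (λ S → S) (flats-unique ⊤ d) (Equivalence.from (enum _) ∘ flat-hyperplane ∘ ∈-flats⁻) (λ _ _ eq → eq)))
      (flats-count d ⊤-subspace ∣⊤∣)

    -- `join H p` is the whole space and thus contains W, so `∣W∩H∣` applies: a hyperplane not
    -- containing W lowers its rank by exactly one.
    ∩-hyperplane : ∀ {W H p k} → Subspace W → ∣ W ∣ ≡ num n (suc k) → IsHyperplane PS H → p ∈ W → p ∉ H →
      ∣ W ∩ H ∣ ≡ num n k
    ∩-hyperplane {W} {H} {p} subW ∣W∣ hypH p∈W p∉H with hyperplane-flat hypH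
    ... | subH , _ , ∣H∣ = cancel (trans (sym (∣W∩H∣ subW subH p∈W p∉H
            (λ _ → subst (_ ∈_) (sym (flat⇒join≡⊤ subH ∣H∣ p∉H)) ∈⊤))) ∣W∣)

-- The VC dimension

module VCDimension {np nl : ℕ} (PS : ProjectiveSpace np nl) (n : ℕ) .{{_ : NonZero n}} (order : HasOrder PS n)
    {d : ℕ} (dim : HasDimension PS d) {hs : List (Subset np)} (enum : EnumeratesHyperplanes PS hs) where
  open ProjectiveSpace PS
  open Geometry PS
  open Counting PS n order

  private
    A : Fin np → Fin (length hs) → Sign
    A = incMatrix PS hs

    ∣P∣ : np ≡ num n (suc d)
    ∣P∣ = point-count dim

  hyperplane-lookup : ∀ j → IsHyperplane PS (List.lookup hs j)
  hyperplane-lookup j = Equivalence.to (proj₂ enum _) (∈-lookup j)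

  ∈⇒+ : ∀ {p j} → p ∈ List.lookup hs j → A p j ≡ Sign.+
  ∈⇒+ p∈ = cong (λ b → if b then Sign.+ else Sign.-) (Vec.[]=⇒lookup p∈)

  ∉⇒- : ∀ {p j} → p ∉ List.lookup hs j → A p j ≡ Sign.-
  ∉⇒- {p} {j} p∉ with Vec.lookup (List.lookup hs j) p in eq
  ... | true  = contradiction (Vec.lookup⇒[]= p _ eq) p∉
  ... | false = refl

  +⇒∈ : ∀ {p j} → A p j ≡ Sign.+ → p ∈ List.lookup hs j
  +⇒∈ {p} {j} eq with p ∈? List.lookup hs j
  ... | yes p∈ = p∈
  ... | no p∉ with trans (sym (∉⇒- p∉)) eq
  ...   | ()

  -⇒∉ : ∀ {p j} → A p j ≡ Sign.- → p ∉ List.lookup hs j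
  -⇒∉ eq p∈ with trans (sym (∈⇒+ p∈)) eq
  ... | ()

  shattered-≤ : ∀ C → Shattered A C → ∣ C ∣ ≤ d
  shattered-≤ C shattered = finish (Subset-induction (λ D → D ⊆ C → Cut D) base step C ⊆-refl)
    where
    Cut : Subset (length hs) → Set
    Cut D = ∃[ W ] ∃[ k ] (Subspace W × ∣ W ∣ ≡ num n k × k + ∣ D ∣ ≡ suc d ×
      (∀ p → (∀ j → j ∈ D → p ∈ List.lookup hs j) → p ∈ W))

    nonempty-rank : ∀ {W : Subset np} {k p} → ∣ W ∣ ≡ num n k → p ∈ W → ∃[ k′ ] k ≡ suc k′
    nonempty-rank {k = zero}  ∣W∣ p∈W = contradiction (subst (1 ≤_) ∣W∣ (Nonempty-∣∣ p∈W)) (λ ())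
    nonempty-rank {k = suc k} _   _   = k , refl

    base : ⊥ ⊆ C → Cut ⊥
    base _ = ⊤ , suc d , ⊤-subspace , trans (∣⊤∣≡n np) ∣P∣
      , trans (cong (suc d +_) (∣⊥∣≡0 (length hs))) (+-identityʳ (suc d)) , λ _ _ → ∈⊤

    step : ∀ D j → j ∉ D → (D ⊆ C → Cut D) → D ∪ ⁅ j ⁆ ⊆ C → Cut (D ∪ ⁅ j ⁆)
    -- The pattern whose only minus is at j gives a point on all hyperplanes of D and off the j-th
    -- one, so the new intersection is proper.
    step D j j∉D ih D∪j⊆C with ih (⊆-trans (p⊆p∪q ⁅ j ⁆) D∪j⊆C)
                             | shattered (λ i → if does (i Fin.≟ j) then Sign.- else Sign.+)
    ... | W , k , subW , ∣W∣ , k+∣D∣ , contains | p , pattern-p = cut (nonempty-rank ∣W∣ p∈W) ∣W∣ k+∣D∣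
      where
      p∈W : p ∈ W
      p∈W = contains p λ i i∈D → +⇒∈ (trans (pattern-p i (D∪j⊆C (p⊆p∪q ⁅ j ⁆ i∈D)))
        (cong (λ b → if b then Sign.- else Sign.+) (dec-false (i Fin.≟ j) (λ { refl → j∉D i∈D }))))
      p∉H : p ∉ List.lookup hs j
      p∉H = -⇒∉ (trans (pattern-p j (D∪j⊆C (q⊆p∪q D ⁅ j ⁆ (x∈⁅x⁆ j))))
        (cong (λ b → if b then Sign.- else Sign.+) (dec-true (j Fin.≟ j) refl)))
      cut : ∀ {k} → ∃[ k′ ] k ≡ suc k′ → ∣ W ∣ ≡ num n k → k + ∣ D ∣ ≡ suc d → Cut (D ∪ ⁅ j ⁆)
      cut (k′ , refl) ∣W∣ k+∣D∣ = W ∩ List.lookup hs j , k′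
        , ∩-subspace subW (proj₁ (hyperplane-lookup j))
        , ∩-hyperplane ∣P∣ subW ∣W∣ (hyperplane-lookup j) p∈W p∉H
        , trans (cong (k′ +_) (∣S∪⁅x⁆∣ D j j∉D)) (trans (+-suc k′ ∣ D ∣) k+∣D∣)
        , λ q q∈ → x∈p∩q⁺ (contains q (λ i i∈D → q∈ i (p⊆p∪q ⁅ j ⁆ i∈D)) , q∈ j (q⊆p∪q D ⁅ j ⁆ (x∈⁅x⁆ j)))

    finish : Cut C → ∣ C ∣ ≤ d
    -- The all-plus pattern gives a point common to all hyperplanes, so k is at least 1; this
    -- improves the bound from d + 1 to d.
    finish (W , k , _ , ∣W∣ , k+∣C∣ , contains) with shattered (λ _ → Sign.+)
    ... | p , pattern-p with nonempty-rank ∣W∣ (contains p (λ j j∈C → +⇒∈ (pattern-p j j∈C)))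
    ...   | k′ , refl = subst (∣ C ∣ ≤_) (suc-injective k+∣C∣) (m≤n+m ∣ C ∣ k′)

  third-point : ∀ {p q} → p ≢ q → ∃[ x ] ∃[ l ] (x ≢ p × x ≢ q × p I l × q I l × x I l)
  third-point {p} {q} p≢q with line-exists p q p≢q
  ... | l , pl , ql with Fin.any? (λ x → ¬? (x Fin.≟ p) ×-dec (¬? (x Fin.≟ q) ×-dec (x I? l)))
  ...   | yes (x , x≢p , x≢q , xl) = x , l , x≢p , x≢q , pl , ql , xl
  ...   | no none = contradiction (≤-trans (thick l) (≤-trans (p⊆q⇒∣p∣≤∣q∣ on⊆) (≤-reflexive ∣pq∣))) (λ { (s≤s (s≤s ())) })
    where
    ∣pq∣ : ∣ ⁅ p ⁆ ∪ ⁅ q ⁆ ∣ ≡ 2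
    ∣pq∣ = trans (∣S∪⁅x⁆∣ ⁅ p ⁆ q (λ q∈ → p≢q (sym (x∈⁅y⁆⇒x≡y p q∈)))) (cong suc (∣⁅x⁆∣≡1 p))
    on⊆ : pointsOn PS l ⊆ ⁅ p ⁆ ∪ ⁅ q ⁆
    on⊆ {x} x∈ with x Fin.≟ p | x Fin.≟ q
    ... | yes refl | _ = x∈p∪q⁺ (inj₁ (x∈⁅x⁆ x))
    ... | no _ | yes refl = x∈p∪q⁺ {p = ⁅ p ⁆} (inj₂ (x∈⁅x⁆ x))
    ... | no x≢p | no x≢q = contradiction
      (x , x≢p , x≢q , trans (sym (Vec.lookup∘tabulate (λ y → inc y l) x)) (Vec.[]=⇒lookup x∈)) none

  module Basis {X : Subset np} (spans : Spans PS X) (∣X∣ : ∣ X ∣ ≡ suc d) where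

    remove : Fin np → Subset np
    remove x = ⟪ (λ y → (y ∈? X) ×-dec ¬? (y Fin.≟ x)) ⟫

    ∈-remove⁺ : ∀ {x y} → y ∈ X → y ≢ x → y ∈ remove x
    ∈-remove⁺ {x} y∈X y≢x = ∈⟪⟫⁺ (λ y → (y ∈? X) ×-dec ¬? (y Fin.≟ x)) (y∈X , y≢x)

    ∈-remove⁻ : ∀ {x y} → y ∈ remove x → y ∈ X × y ≢ x
    ∈-remove⁻ {x} = ∈⟪⟫⁻ (λ y → (y ∈? X) ×-dec ¬? (y Fin.≟ x))

    ∣remove∣ : ∀ {x} → x ∈ X → ∣ remove x ∣ ≡ d
    ∣remove∣ {x} x∈X = suc-injective (trans (sym (∣S∪⁅x⁆∣ (remove x) x (λ x∈ → proj₂ (∈-remove⁻ x∈) refl)))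
      (trans (cong ∣_∣ (⊆-antisym to from)) ∣X∣))
      where
      to : remove x ∪ ⁅ x ⁆ ⊆ X
      to y∈ with x∈p∪q⁻ (remove x) ⁅ x ⁆ y∈
      ... | inj₁ y∈R = proj₁ (∈-remove⁻ y∈R)
      ... | inj₂ y∈x = subst (_∈ X) (sym (x∈⁅y⁆⇒x≡y x y∈x)) x∈X
      from : X ⊆ remove x ∪ ⁅ x ⁆
      from {y} y∈X with y Fin.≟ x
      ... | yes refl = q⊆p∪q (remove x) ⁅ x ⁆ (x∈⁅x⁆ x)
      ... | no y≢x = p⊆p∪q ⁅ x ⁆ (∈-remove⁺ y∈X y≢x)

    -- H acts as the facet opposite the vertex x of the simplex with vertex set X.
    Facet : Fin np → Subset np → Set
    Facet x H = Subspace H × x ∉ H × (∀ {y} → y ∈ X → y ≢ x → y ∈ H)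

    -- The hull S of the other vertices has rank at most d, so it cannot contain x, or it would
    -- contain X and be everything. Its join with x does contain X, which fixes the size of S.
    facet : ∀ {x} → x ∈ X → ∃[ j ] Facet x (List.lookup hs j)
    facet {x} x∈X with hull (remove x)
    ... | S , Y , subS , R⊆S , Y⊆R , card , _ =
        Any.index S∈hs , subst (Facet x) (lookup-index S∈hs) (subS , x∉S , λ y∈X y≢x → R⊆S (∈-remove⁺ y∈X y≢x))
      where
      X⊆ : ∀ {T} → S ⊆ T → x ∈ T → X ⊆ T
      X⊆ S⊆T x∈T {y} y∈X with y Fin.≟ x
      ... | yes refl = x∈T
      ... | no y≢x = S⊆T (R⊆S (∈-remove⁺ y∈X y≢x))
      ∣⊤∣ : ∣ ⊤ {np} ∣ ≡ num n (suc d)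
      ∣⊤∣ = trans (∣⊤∣≡n np) ∣P∣
      x∉S : x ∉ S
      x∉S x∈S = <-irrefl (num-injective n (trans (sym card) (trans (cong ∣_∣ (spans S subS (X⊆ ⊆-refl x∈S))) ∣⊤∣)))
        (s≤s (subst (∣ Y ∣ ≤_) (∣remove∣ x∈X) (p⊆q⇒∣p∣≤∣q∣ Y⊆R)))
      ∣S∣ : ∣ S ∣ ≡ num n d
      ∣S∣ = *-cancelˡ-≡ _ _ n (suc-injective (trans (sym (∣join∣ subS x∉S order)) (trans (cong ∣_∣
        (spans (join S x) (join-subspace subS x∉S) (X⊆ (S⊆join S x) (p∈join S x)))) ∣⊤∣)))
      S∈hs : S ∈ₗ hs
      S∈hs = Equivalence.from (proj₂ enum S) (flat-hyperplane ∣P∣ (subS , ⊆⊤ , ∣S∣))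

    module _ {e : Fin np} (e∈X : e ∈ X) where

      -- The second conjunct strengthens the induction: p remains on every facet whose opposite
      -- vertex has not been treated, ready to be moved off it. The vertex `e` is excluded because
      -- it is the initial p, lying on all facets except the one opposite itself.
      Realises : Subset np → Subset (length hs) → Set
      Realises D C = ∀ (f : Fin (length hs) → Sign) →
        ∃[ p ] ((∀ j → j ∈ C → A p j ≡ f j) × (∀ {x H} → x ∉ D → x ≢ e → Facet x H → p ∈ H))

      ShatteredBy : Subset np → Set
      ShatteredBy D = ∃[ C ] (∣ C ∣ ≡ ∣ D ∣ ×
        (∀ j → j ∈ C → ∃[ x ] (x ∈ D × Facet x (List.lookup hs j))) × Realises D C)

      module _ {D : Subset np} {C : Subset (length hs)} {z : Fin np} {j : Fin (length hs)}
          (facets : ∀ j → j ∈ C → ∃[ x ] (x ∈ D × Facet x (List.lookup hs j)))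
          (z∉D : z ∉ D) (z∈X : z ∈ X) (z≢e : z ≢ e) (Fj : Facet z (List.lookup hs j)) where

        private
          ≢z : ∀ {x} → x ∈ D → z ≢ x
          ≢z x∈D refl = z∉D x∈D

          ∉D : ∀ {x} → x ∉ D ∪ ⁅ z ⁆ → x ∉ D
          ∉D x∉ = x∉ ∘ p⊆p∪q ⁅ z ⁆

          z∈facet : ∀ {x H} → x ∉ D ∪ ⁅ z ⁆ → Facet x H → z ∈ H
          z∈facet x∉ (_ , _ , others) = others z∈X (λ { refl → x∉ (q⊆p∪q D ⁅ z ⁆ (x∈⁅x⁆ z)) })

        new-facet : j ∉ C
        new-facet j∈C with facets j j∈C
        ... | x , x∈D , _ , _ , others = proj₁ (proj₂ Fj) (others z∈X (≢z x∈D))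

        insert-facet : ∀ i → i ∈ C ∪ ⁅ j ⁆ → ∃[ x ] (x ∈ D ∪ ⁅ z ⁆ × Facet x (List.lookup hs i))
        insert-facet i i∈ with x∈p∪q⁻ C ⁅ j ⁆ i∈
        ... | inj₁ i∈C = let x , x∈D , Fx = facets i i∈C in x , p⊆p∪q ⁅ z ⁆ x∈D , Fx
        ... | inj₂ i∈j = z , q⊆p∪q D ⁅ z ⁆ (x∈⁅x⁆ z)
            , subst (λ i → Facet z (List.lookup hs i)) (sym (x∈⁅y⁆⇒x≡y j i∈j)) Fj

        -- A third point q on the line through z and a point p of the new facet leaves that facet
        -- but stays on the same side as p of every facet containing z.
        insert-realises : Realises D C → Realises (D ∪ ⁅ z ⁆) (C ∪ ⁅ j ⁆)
        insert-realises realises f with realises f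
        ... | p , agree , rest = by-sign (f j) refl
          where
          p∈H : p ∈ List.lookup hs j
          p∈H = rest z∉D z≢e Fj
          p≢z : p ≢ z
          p≢z refl = proj₁ (proj₂ Fj) p∈H

          extend : ∀ q → (∀ i → i ∈ C → A q i ≡ f i) → A q j ≡ f j → ∀ i → i ∈ C ∪ ⁅ j ⁆ → A q i ≡ f i
          extend q old new i i∈ with x∈p∪q⁻ C ⁅ j ⁆ i∈
          ... | inj₁ i∈C = old i i∈C
          ... | inj₂ i∈j = subst (λ i → A q i ≡ f i) (sym (x∈⁅y⁆⇒x≡y j i∈j)) new

          by-sign : ∀ s → f j ≡ s →
            ∃[ q ] ((∀ i → i ∈ C ∪ ⁅ j ⁆ → A q i ≡ f i) × (∀ {x H} → x ∉ D ∪ ⁅ z ⁆ → x ≢ e → Facet x H → q ∈ H))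
          by-sign Sign.+ fj = p , extend p agree (trans (∈⇒+ p∈H) (sym fj)) , λ x∉ x≢e Fx → rest (∉D x∉) x≢e Fx
          by-sign Sign.- fj with third-point p≢z
          ... | q , l , q≢p , q≢z , pl , zl , ql = q , extend q old (trans (∉⇒- q∉H) (sym fj))
              , λ x∉ x≢e Fx → proj₁ Fx p z l q p≢z (rest (∉D x∉) x≢e Fx) (z∈facet x∉ Fx) pl zl ql
            where
            q∉H : q ∉ List.lookup hs j
            q∉H q∈H = proj₁ (proj₂ Fj) (proj₁ Fj p q l z (q≢p ∘ sym) p∈H q∈H pl ql zl)
            old : ∀ i → i ∈ C → A q i ≡ f i
            old i i∈C = trans (same-side (p ∈? List.lookup hs i)) (agree i i∈C)
              where
              sub : Subspace (List.lookup hs i)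
              sub = proj₁ (hyperplane-lookup i)
              z∈ : z ∈ List.lookup hs i
              z∈ = let _ , x∈D , _ , _ , others = facets i i∈C in others z∈X (≢z x∈D)
              same-side : Dec (p ∈ List.lookup hs i) → A q i ≡ A p i
              same-side (yes p∈) = trans (∈⇒+ (sub p z l q p≢z p∈ z∈ pl zl ql)) (sym (∈⇒+ p∈))
              same-side (no p∉)  = trans (∉⇒- (λ q∈ → p∉ (sub q z l p q≢z q∈ z∈ ql zl pl))) (sym (∉⇒- p∉))

      facets-shattered : ∀ D → D ⊆ remove e → ShatteredBy D
      facets-shattered = Subset-induction (λ D → D ⊆ remove e → ShatteredBy D) base step
        where
        base : ⊥ ⊆ remove e → ShatteredBy ⊥
        base _ = ⊥ , trans (∣⊥∣≡0 (length hs)) (sym (∣⊥∣≡0 np)) , (λ _ j∈⊥ → contradiction j∈⊥ ∉⊥)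
          , λ f → e , (λ _ j∈⊥ → contradiction j∈⊥ ∉⊥) , λ _ x≢e (_ , _ , others) → others e∈X (x≢e ∘ sym)

        step : ∀ D z → z ∉ D → (D ⊆ remove e → ShatteredBy D) → D ∪ ⁅ z ⁆ ⊆ remove e → ShatteredBy (D ∪ ⁅ z ⁆)
        step D z z∉D ih D∪z⊆ =
          let C , ∣C∣ , facets , realises = ih (⊆-trans (p⊆p∪q ⁅ z ⁆) D∪z⊆)
              z∈X , z≢e = ∈-remove⁻ (D∪z⊆ (q⊆p∪q D ⁅ z ⁆ (x∈⁅x⁆ z)))
              j , Fj = facet z∈X
          in C ∪ ⁅ j ⁆
            , trans (∣S∪⁅x⁆∣ C j (new-facet facets z∉D z∈X z≢e Fj)) (trans (cong suc ∣C∣) (sym (∣S∪⁅x⁆∣ D z z∉D)))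
            , insert-facet facets z∉D z∈X z≢e Fj
            , insert-realises facets z∉D z∈X z≢e Fj realises

    shattered-exists : ∃[ C ] (Shattered A C × ∣ C ∣ ≡ d)
    shattered-exists with nonempty? X
    ... | no none = contradiction (trans (sym ∣X∣) (trans (cong ∣_∣ (Empty-unique none)) (∣⊥∣≡0 np))) (λ ())
    ... | yes (e , e∈X) =
      let C , ∣C∣ , _ , realises = facets-shattered e∈X (remove e) ⊆-refl
      in C , (λ f → let p , agree , _ = realises f in p , agree) , trans ∣C∣ (∣remove∣ e∈X)

  vc-dimension : VCdim≡ A d
  vc-dimension = (let X , spans , ∣X∣ = proj₁ dim in Basis.shattered-exists spans ∣X∣) , shattered-≤

-- Arithmetic of the numbers N_{n,d}

num-suc : ∀ n k → num n (suc k) ≡ n ^ k + num n k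
num-suc n zero    = cong suc (*-zeroʳ n)
num-suc n (suc k) = begin
  suc (n * num n (suc k))         ≡⟨ cong (λ x → suc (n * x)) (num-suc n k) ⟩
  suc (n * (n ^ k + num n k))     ≡⟨ lemma n (n ^ k) (num n k) ⟩
  n * n ^ k + suc (n * num n k)   ∎
  where
  open ≡-Reasoning
  lemma : ∀ n a b → 1 + n * (a + b) ≡ n * a + (1 + n * b)
  lemma = solve-∀

Nnd≡num : ∀ n d → Nnd n d ≡ num n (suc d)
Nnd≡num n zero    = cong suc (sym (*-zeroʳ n))
Nnd≡num n (suc d) = trans (cong (n ^ suc d +_) (Nnd≡num n d)) (sym (num-suc n (suc d)))

suc-num*pred : ∀ m k → suc (num (suc m) k * m) ≡ suc m ^ k
suc-num*pred m zero    = refl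
suc-num*pred m (suc k) = trans (lemma m (num (suc m) k)) (cong (suc m *_) (suc-num*pred m k))
  where
  lemma : ∀ m a → 1 + (1 + (1 + m) * a) * m ≡ (1 + m) * (1 + a * m)
  lemma = solve-∀

num*pred : ∀ m k → num (suc m) k * m ≡ suc m ^ k ∸ 1
num*pred m k = cong (_∸ 1) (suc-num*pred m k)

-- An exact form of log-concavity. It yields both the `design` inequality of the sign-rank bound and
-- N n^(d-2) ≤ Δ² for the power bound.
num-product : ∀ n k → num n (suc (suc k)) * num n k + n ^ k ≡ num n (suc k) * num n (suc k)
num-product n k = begin
  suc (n * num n (suc k)) * num n k + n ^ k            ≡⟨ lemma n (num n (suc k)) (num n k) (n ^ k) ⟩
  (n ^ k + num n k) + num n (suc k) * (n * num n k)    ≡⟨ cong (_+ num n (suc k) * (n * num n k)) (num-suc n k) ⟨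
  num n (suc k) + num n (suc k) * (n * num n k)        ≡⟨ *-suc (num n (suc k)) (n * num n k) ⟨
  num n (suc k) * suc (n * num n k)                    ∎
  where
  open ≡-Reasoning
  lemma : ∀ n a b c → (1 + n * a) * b + c ≡ (c + b) + a * (n * b)
  lemma = solve-∀

^-≤-num : ∀ n k → n ^ k ≤ num n (suc k)
^-≤-num n k = subst (n ^ k ≤_) (sym (num-suc n k)) (m≤m+n (n ^ k) (num n k))

^-distribʳ-* : ∀ k a b → (a * b) ^ k ≡ a ^ k * b ^ k
^-distribʳ-* zero    a b = refl
^-distribʳ-* (suc k) a b = trans (cong (a * b *_) (^-distribʳ-* k a b)) (lemma a b (a ^ k) (b ^ k))
  where
  lemma : ∀ a b c d → a * b * (c * d) ≡ a * c * (b * d)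
  lemma = solve-∀

-- This is Δ / n^((d-1)/2) ≥ N^(1/2 - 1/(2d)) with d = 2 + e, raised to the power 2d. Splitting
-- d(d-1) as (d-2)(d-1) + 2(d-1), one uses N n^(d-2) ≤ Δ² to the power d - 1 and n^(d-1) ≤ Δ
-- squared.
num-power-bound : ∀ n e →
  num n (3 + e) ^ suc e * n ^ ((2 + e) * suc e) ≤ num n (2 + e) ^ (2 * (2 + e))
num-power-bound n e = begin
  N ^ suc e * n ^ ((2 + e) * suc e)              ≡⟨ cong (λ k → N ^ suc e * n ^ k) (exponent e) ⟩
  N ^ suc e * n ^ (e * suc e + suc e * 2)        ≡⟨ cong (N ^ suc e *_) (^-distribˡ-+-* n (e * suc e) (suc e * 2)) ⟩
  N ^ suc e * (n ^ (e * suc e) * n ^ (suc e * 2)) ≡⟨ cong₂ (λ x y → N ^ suc e * (x * y)) (^-*-assoc n e (suc e)) (^-*-assoc n (suc e) 2) ⟨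
  N ^ suc e * ((n ^ e) ^ suc e * (n ^ suc e) ^ 2) ≡⟨ *-assoc (N ^ suc e) _ _ ⟨
  N ^ suc e * (n ^ e) ^ suc e * (n ^ suc e) ^ 2  ≡⟨ cong (_* (n ^ suc e) ^ 2) (^-distribʳ-* (suc e) N (n ^ e)) ⟨
  (N * n ^ e) ^ suc e * (n ^ suc e) ^ 2          ≤⟨ *-mono-≤ (^-monoˡ-≤ (suc e) base) (^-monoˡ-≤ 2 (^-≤-num n (suc e))) ⟩
  (Δ ^ 2) ^ suc e * Δ ^ 2                        ≡⟨ cong (_* Δ ^ 2) (^-*-assoc Δ 2 (suc e)) ⟩
  Δ ^ (2 * suc e) * Δ ^ 2                        ≡⟨ ^-distribˡ-+-* Δ (2 * suc e) 2 ⟨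
  Δ ^ (2 * suc e + 2)                            ≡⟨ cong (Δ ^_) (exponent′ e) ⟩
  Δ ^ (2 * (2 + e))                              ∎
  where
  open ≤-Reasoning
  N = num n (3 + e)
  Δ = num n (2 + e)
  exponent : ∀ e → (2 + e) * (1 + e) ≡ e * (1 + e) + (1 + e) * 2
  exponent = solve-∀
  exponent′ : ∀ e → 2 * (1 + e) + 2 ≡ 2 * (2 + e)
  exponent′ = solve-∀
  base : N * n ^ e ≤ Δ ^ 2
  base = begin
    N * n ^ e                          ≤⟨ *-monoʳ-≤ N (^-≤-num n e) ⟩
    N * num n (suc e)                  ≤⟨ m≤m+n _ (n ^ suc e) ⟩
    N * num n (suc e) + n ^ suc e      ≡⟨ num-product n (suc e) ⟩
    Δ * Δ                              ≡⟨ cong (Δ *_) (*-identityʳ Δ) ⟨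
    Δ ^ 2                              ∎

-- Equality would force n ∣ Δ², but Δ = num n d ≡ 1 mod n.
num-square-≢ : ∀ n e r → 2 ≤ n → num n (2 + e) * num n (2 + e) ≢ r * r * n ^ suc e
num-square-≢ n e r 2≤n eq = <-irrefl (sym (∣1⇒≡1 n∣1)) 2≤n
  where
  a = num n (suc e)
  expand : ∀ n a → (1 + n * a) * (1 + n * a) ≡ n * (2 * a + a * (n * a)) + 1
  expand = solve-∀
  n∣1 : n ∣ 1
  n∣1 = ∣m+n∣m⇒∣n (subst (n ∣_) (trans (sym eq) (expand n a)) (∣n⇒∣m*n (r * r) (m∣m*n (n ^ e)))) (m∣m*n _)

sign-rank-arithmetic : ∀ m e r → 1 ≤ m → num (suc m) (2 + e) * num (suc m) (2 + e) ≤ r * r * suc m ^ suc e →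
  (suc m ^ (2 + e) ∸ 1) ^ 2 < r ^ 2 * suc m ^ suc e * m ^ 2
sign-rank-arithmetic m@(suc _) e r 1≤m bound = begin-strict
  (suc m ^ (2 + e) ∸ 1) ^ 2      ≡⟨ cong (_^ 2) (num*pred m (2 + e)) ⟨
  (Δ * m) ^ 2                    ≡⟨ square Δ m ⟩
  Δ * Δ * (m * m)                <⟨ *-monoˡ-< (m * m) (≤∧≢⇒< bound (num-square-≢ (suc m) e r (s≤s 1≤m))) ⟩
  r * r * suc m ^ suc e * (m * m) ≡⟨ cong₂ (λ x y → x * suc m ^ suc e * y) (cong (r *_) (*-identityʳ r)) (cong (m *_) (*-identityʳ m)) ⟨
  r ^ 2 * suc m ^ suc e * m ^ 2  ∎
  where
  open ≤-Reasoning
  Δ = num (suc m) (2 + e)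
  square : ∀ a b → a * b * (a * b * 1) ≡ a * a * (b * b)
  square = solve-∀

-- Points and hyperplanes as a symmetric design; assembly

∣∩∣≡sum : ∀ {n} (S T : Subset n) → sum (λ x → bit (Vec.lookup S x) * bit (Vec.lookup T x)) ≡ ∣ S ∩ T ∣
∣∩∣≡sum S T = trans (sum-cong-≗ (λ x → trans (bit-∧ (Vec.lookup S x) (Vec.lookup T x))
    (cong bit (sym (Vec.lookup-zipWith _∧_ x S T))))) (sym (∣∣≡sum (S ∩ T)))
  where
  bit-∧ : ∀ a b → bit a * bit b ≡ bit (a ∧ b)
  bit-∧ true  b = *-identityˡ (bit b)
  bit-∧ false b = refl

lookup-injective : ∀ {A : Set} {xs : List A} → Unique xs → ∀ i j → List.lookup xs i ≡ List.lookup xs j → i ≡ j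
lookup-injective (_ ∷ _) fzero fzero _ = refl
lookup-injective (x∉ ∷ _) fzero (fsuc j) eq = contradiction eq (All.lookup x∉ (∈-lookup j))
lookup-injective (x∉ ∷ _) (fsuc i) fzero eq = contradiction (sym eq) (All.lookup x∉ (∈-lookup i))
lookup-injective (_ ∷ uniq) (fsuc i) (fsuc j) eq = cong fsuc (lookup-injective uniq i j eq)

module SignRank {np nl : ℕ} (PS : ProjectiveSpace np nl) {n : ℕ} (2≤n : 2 ≤ n) .{{_ : NonZero n}} (order : HasOrder PS n)
    {e : ℕ} (dim : HasDimension PS (suc e)) {hs : List (Subset np)} (enum : EnumeratesHyperplanes PS hs) where
  open Geometry PS
  open Counting PS n order
  open VCDimension PS n order dim enum using (hyperplane-lookup)

  private
    Δ : ℕ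
    Δ = num n (suc e)

    ∣P∣ : np ≡ num n (suc (suc e))
    ∣P∣ = point-count dim

    flat : ∀ j → IsFlat ⊤ (suc e) (List.lookup hs j)
    flat j = hyperplane-flat ∣P∣ (hyperplane-lookup j)

  -- Hyperplanes have equal size, so distinct ones are not nested and some point of H lies off H′.
  ∣H∩H′∣ : ∀ j j′ → j ≢ j′ → ∣ List.lookup hs j ∩ List.lookup hs j′ ∣ ≡ num n e
  ∣H∩H′∣ j j′ j≢j′ = by-cases (Fin.any? (λ p → (p ∈? H) ×-dec ¬? (p ∈? H′)))
    where
    H H′ : Subset np
    H = List.lookup hs j
    H′ = List.lookup hs j′
    by-cases : Dec (∃[ p ] (p ∈ H × p ∉ H′)) → ∣ H ∩ H′ ∣ ≡ num n e
    by-cases (yes (p , p∈H , p∉H′)) =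
      ∩-hyperplane ∣P∣ (proj₁ (flat j)) (proj₂ (proj₂ (flat j))) (hyperplane-lookup j′) p∈H p∉H′
    by-cases (no none) = contradiction (lookup-injective (proj₁ enum) j j′ (⊆-∣∣-≡
      (λ {x} x∈H → decidable-stable (x ∈? H′) (λ x∉H′ → none (x , x∈H , x∉H′)))
      (trans (proj₂ (proj₂ (flat j))) (sym (proj₂ (proj₂ (flat j′))))))) j≢j′

  sign-rank-bound : ∀ r → SignRealizable (incMatrix PS hs) r → Δ * Δ ≤ r * r * n ^ e
  sign-rank-bound = symmetric-design-sign-rank (λ p j → Vec.lookup (List.lookup hs j) p)
    (λ np≡0 → contradiction (trans (sym ∣P∣) np≡0) (λ ()))
    (trans (hyperplane-count ∣P∣ enum) (sym ∣P∣))
    (λ j → trans (sym (∣∣≡sum (List.lookup hs j))) (proj₂ (proj₂ (flat j))))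
    (λ j j′ j≢j′ → trans (∣∩∣≡sum (List.lookup hs j) (List.lookup hs j′)) (∣H∩H′∣ j j′ j≢j′))
    (trans (num-suc n e) (+-comm (n ^ e) (num n e)))
    (subst (λ k → k * num n e ≤ Δ * Δ) (sym ∣P∣) (subst (num n (suc (suc e)) * num n e ≤_) (num-product n e) (m≤m+n _ (n ^ e))))
    -- The number of points is 1 + nΔ, and n ≥ 2.
    (subst (Δ + Δ ≤_) (sym ∣P∣) (≤-trans (≤-reflexive (cong (Δ +_) (sym (+-identityʳ Δ)))) (≤-trans (*-monoˡ-≤ Δ 2≤n) (n≤1+n (n * Δ)))))

theorem9 : ∀ (d n np nl : ℕ) → 2 ≤ d → 3 ≤ n →
    (PS : ProjectiveSpace np nl) → HasOrder PS n → HasDimension PS d →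
    (np ≡ Nnd n d) ×
    (Nnd n d * (n ∸ 1) ≡ n ^ (d + 1) ∸ 1) ×
    (∃[ hs ] EnumeratesHyperplanes PS hs) ×
    (∀ (hs : List (Subset np)) → EnumeratesHyperplanes PS hs →
    (length hs ≡ Nnd n d) ×
    VCdim≡ (incMatrix PS hs) d ×
    (∀ r → SignRealizable (incMatrix PS hs) r →
    (n ^ d ∸ 1) ^ 2 < r ^ 2 * n ^ (d ∸ 1) * (n ∸ 1) ^ 2)) ×
    (Nnd n d ^ (d ∸ 1) * n ^ (d * (d ∸ 1)) * (n ∸ 1) ^ (2 * d) ≤ (n ^ d ∸ 1) ^ (2 * d))
theorem9 d@(suc (suc e)) n@(suc m) np nl (s≤s (s≤s z≤n)) (s≤s 2≤m) PS order dim =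
    trans ∣P∣ (sym (Nnd≡num n d))
  , trans (cong (_* m) (Nnd≡num n d)) (trans (num*pred m (suc d)) (cong (λ k → n ^ k ∸ 1) (+-comm 1 d)))
  , (flats ⊤ d , flats-enumerate ∣P∣)
  , (λ hs enum →
        trans (hyperplane-count ∣P∣ enum) (sym (Nnd≡num n d))
      , VCDimension.vc-dimension PS n order dim enum
      , λ r realizable → sign-rank-arithmetic m e r 1≤m
          (SignRank.sign-rank-bound PS (s≤s 1≤m) order dim enum r realizable))
  , power-bound
  where
  open Counting PS n order
  1≤m : 1 ≤ m
  1≤m = ≤-trans (s≤s z≤n) 2≤m
  ∣P∣ : np ≡ num n (suc d)
  ∣P∣ = point-count dim
  open ≤-Reasoning
  power-bound : Nnd n d ^ (d ∸ 1) * n ^ (d * (d ∸ 1)) * (n ∸ 1) ^ (2 * d) ≤ (n ^ d ∸ 1) ^ (2 * d)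
  power-bound = begin
    Nnd n d ^ suc e * n ^ (d * suc e) * m ^ (2 * d)          ≡⟨ cong (λ k → k ^ suc e * n ^ (d * suc e) * m ^ (2 * d)) (Nnd≡num n d) ⟩
    num n (suc d) ^ suc e * n ^ (d * suc e) * m ^ (2 * d)    ≤⟨ *-monoˡ-≤ (m ^ (2 * d)) (num-power-bound n e) ⟩
    num n d ^ (2 * d) * m ^ (2 * d)                          ≡⟨ ^-distribʳ-* (2 * d) (num n d) m ⟨
    (num n d * m) ^ (2 * d)                                  ≡⟨ cong (_^ (2 * d)) (num*pred m d) ⟩
    (n ^ d ∸ 1) ^ (2 * d)                                    ∎
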